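{- Let $\nu=(\nu_1,\ldots,\nu_\ell)$ be a given partition and $S_\nu(\lambda):=\prod_{1\le i\le\ell}S(\lambda,\nu_i)$. Then $S_\nu$ is a $D$-polynomial of degree at most $|\nu|+\ell$. Furthermore, for each nonnegative integer $k$ there exist rational numbers $b_\delta$ (independent of $\lambda$), indexed by partitions $\delta$ with $|\delta|\le 2|\nu|+2\ell-2k$, such that $$D^k\Bigl(\frac{S_\nu(\lambda)}{H_\lambda}\Bigr)=\sum_{|\delta|\le 2|\nu|+2\ell-2k}b_\delta\frac{q_\delta(\lambda)}{H_\lambda}$$ for every partition $\lambda$.
   Context: $h_\square$ is the hook length of a box (arm + leg + 1), $H_\lambda=\prod_{\square\in\lambda}h_\square$ ($H_\emptyset=1$), and $S(\lambda,r)=\sum_{\square\in\lambda}\prod_{1\le j\le r}(h_\square^2-j^2)$. Boxes are indexed $(i,j)$ with row $i$, column $j$. For a partition $\lambda$, let $(\alpha_1,\beta_1),\ldots,(\alpha_m,\beta_m)$ be the coordinates of its removable boxes, ordered with $\alpha_1>\cdots>\alpha_m$; set $\alpha_{m+1}=\beta_0=0$, $x_i=\beta_i-\alpha_{i+1}$ ($0\le i\le m$), $y_j=\beta_j-\alpha_j$ ($1\le j\le m$), $q_k(\lambda)=\sum_{i=0}^mx_i^k-\sum_{j=1}^my_j^k$, and $q_\delta=q_{\delta_1}\cdots q_{\delta_s}$, $q_\emptyset=1$. For a function $g$ on partitions, $Dg(\lambda)=\sum_{\lambda^+}g(\lambda^+)-g(\lambda)$, where $\lambda^+$ ranges over partitions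 obtained from $\lambda$ by adding one box; $D^0g=g$, $D^kg=D(D^{k-1}g)$. A function $g$ is a $D$-polynomial of degree at most $d$ if $D^{d+1}(g(\lambda)/H_\lambda)=0$ for all $\lambda$. -}

module Defs where

open import Data.Nat as ℕ using (ℕ; zero; suc; _<ᵇ_; _<_; _≥_)
open import Data.Integer as ℤ using (ℤ; +_)
open import Data.Rational as ℚ using (ℚ; 0ℚ; 1ℚ)
open import Data.List using (List; []; _∷_; _++_; map; length; reverse; zipWith; concat; upTo; foldr)
open import Data.List.Relation.Unary.All using (All)
open import Data.List.Relation.Unary.Linked using (Linked)
open import Data.Maybe using (Maybe; just; nothing)
open import Data.Bool using (Bool; true; false; if_then_else_)
open import Data.Product using (_×_; _,_; proj₁; proj₂)
open import Data.Nat.ListAction as LA using ()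
open import Relation.Binary.PropositionalEquality using (_≡_)

IsPartition : List ℕ → Set
IsPartition la = All (λ x → 0 < x) la × Linked _≥_ la

size : List ℕ → ℕ
size = LA.sum

sumℤ : List ℤ → ℤ
sumℤ = foldr ℤ._+_ (+ 0)

prodℤ : List ℤ → ℤ
prodℤ = foldr ℤ._*_ (+ 1)

sumℚ : List ℚ → ℚ
sumℚ = foldr ℚ._+_ 0ℚ

prodℚ : List ℚ → ℚ
prodℚ = foldr ℚ._*_ 1ℚ

ℤtoℚ : ℤ → ℚ
ℤtoℚ z = z ℚ./ 1

ℕtoℚ : ℕ → ℚ
ℕtoℚ n = ℤtoℚ (+ n)

-- division by a natural number (only ever applied to H_λ ≥ 1 for partitions;
-- division by 0 is set to 0 to make the function total)
_÷ℕ_ : ℚ → ℕ → ℚ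
q ÷ℕ zero = 0ℚ
q ÷ℕ suc n = q ℚ.* (+ 1 ℚ./ suc n)

-- length of row i (1-indexed), 0 beyond the last row
row : List ℕ → ℕ → ℕ
row [] _ = 0
row (x ∷ xs) zero = 0
row (x ∷ xs) (suc zero) = x
row (x ∷ xs) (suc (suc i)) = row xs (suc i)

conj : List ℕ → ℕ → ℕ
conj [] j = 0
conj (x ∷ xs) j = (if x ℕ.<ᵇ j then 0 else 1) ℕ.+ conj xs j

boxes : List ℕ → List (ℕ × ℕ)
boxes la = concat (map (λ i → map (λ j → (suc i , suc j)) (upTo (row la (suc i)))) (upTo (length la)))

hook : List ℕ → ℕ × ℕ → ℕ
hook la (i , j) = (row la i ℕ.∸ j) ℕ.+ (conj la j ℕ.∸ i) ℕ.+ 1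

hooks : List ℕ → List ℕ
hooks la = map (hook la) (boxes la)

H : List ℕ → ℕ
H la = LA.product (hooks la)

S : List ℕ → ℕ → ℤ
S la r = sumℤ (map (λ h → prodℤ (map (λ j → (+ (h ℕ.* h)) ℤ.- (+ (suc j ℕ.* suc j))) (upTo r))) (hooks la))

Sν : List ℕ → List ℕ → ℤ
Sν nu la = prodℤ (map (S la) nu)

removableTop : List ℕ → List (ℕ × ℕ)
removableTop la = go 1 la
  where
  go : ℕ → List ℕ → List (ℕ × ℕ)
  go i [] = []
  go i (x ∷ []) = (i , x) ∷ []
  go i (x ∷ y ∷ ys) = (if y ℕ.<ᵇ x then ((i , x) ∷ []) else []) ++ go (suc i) (y ∷ ys)

-- removable boxes (α₁,β₁),…,(α_m,β_m) ordered with α₁ > ⋯ > α_m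
removable : List ℕ → List (ℕ × ℕ)
removable la = reverse (removableTop la)

-- x_i = β_i - α_{i+1} (0 ≤ i ≤ m), with α_{m+1} = β₀ = 0
xs : List ℕ → List ℤ
xs la = zipWith (λ b a → (+ b) ℤ.- (+ a))
          (0 ∷ map proj₂ (removable la))
          (map proj₁ (removable la) ++ (0 ∷ []))

ys : List ℕ → List ℤ
ys la = map (λ p → (+ proj₂ p) ℤ.- (+ proj₁ p)) (removable la)

q : ℕ → List ℕ → ℤ
q k la = sumℤ (map (λ x → x ℤ.^ k) (xs la)) ℤ.- sumℤ (map (λ y → y ℤ.^ k) (ys la))

qδ : List ℕ → List ℕ → ℤ
qδ delta la = prodℤ (map (λ d → q d la) delta)

-- all partitions λ⁺ obtained from λ by adding one box
-- (the Maybe is the length of the previous row, nothing for the first row)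
addBoxFrom : Maybe ℕ → List ℕ → List (List ℕ)
addBoxFrom b [] = if fits b 0 then ((1 ∷ []) ∷ []) else []
  where
  fits : Maybe ℕ → ℕ → Bool
  fits nothing _ = true
  fits (just p) v = v ℕ.<ᵇ p
addBoxFrom b (x ∷ rest) =
  (if fits b x then ((suc x ∷ rest) ∷ []) else []) ++ map (x ∷_) (addBoxFrom (just x) rest)
  where
  fits : Maybe ℕ → ℕ → Bool
  fits nothing _ = true
  fits (just p) v = v ℕ.<ᵇ p

addBox : List ℕ → List (List ℕ)
addBox = addBoxFrom nothing

D : (List ℕ → ℚ) → List ℕ → ℚ
D g la = sumℚ (map g (addBox la)) ℚ.- g la

D^ : ℕ → (List ℕ → ℚ) → List ℕ → ℚ
D^ zero g = g
D^ (suc k) g = D (D^ k g)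

IsDPoly : (List ℕ → ℚ) → ℕ → Set
IsDPoly g d = ∀ la → IsPartition la → D^ (suc d) (λ mu → g mu ÷ℕ H mu) la ≡ 0ℚ

-- The row-one hooks of λ together with the differences a_1 - a_k (a_k = λ_k - k + 1)
-- fill the interval 1, …, λ_1 + ℓ - 1. Summing an even polynomial over the hooks and
-- telescoping twice, this gives S(λ,r) = ½ Σ ± F(u - v), where u and v each run over the
-- x_i (sign +) and the y_j (sign -) and F is the even polynomial of degree 2r + 2 with
-- second central difference ∏ (z² - j²): a polynomial of weight 2r + 2 in the q_k.
-- Multiplied instead of summed, it gives H_λ / H_{λ⁺} as a function of the content c of
-- the new box: these weights have Cauchy transform ∏ (z - y_j) / ∏ (z - x_i), so they
-- sum to 1 and, by Newton's identities, Σ c^k H_λ / H_{λ⁺} is a polynomial of weight k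
-- in the q_k. Adding the box changes q_k by (c+1)^k + (c-1)^k - 2c^k, of degree k - 2
-- in c; hence H_λ D(q_δ / H_λ) has weight at most |δ| - 2, and D can be iterated.

module Submission where

open import Defs
open import Data.Nat using (ℕ; zero; suc; _+_; _*_; _∸_; _≤_; _<_; _≥_; z≤n; s≤s; _<ᵇ_; _!)
import Data.Nat.Properties as ℕₚ
open import Algebra.Properties.CommutativeSemigroup ℕₚ.+-commutativeSemigroup using () renaming (interchange to +-interchange)
import Data.Nat.ListAction as LA
import Data.Nat.ListAction.Properties as LAₚ
open import Data.Nat.Tactic.RingSolver using () renaming (solve-∀ to ℕ-solve-∀)
open import Data.Integer as ℤ using (ℤ; +_; -[1+_]; 0ℤ; 1ℤ)
import Data.Integer.Properties as ℤₚ
open import Data.Integer.Tactic.RingSolver using (solve-∀)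
open import Data.Rational as ℚ using (ℚ; 0ℚ; 1ℚ; ½) renaming (_*_ to _*ℚ_)
import Data.Rational.Properties as ℚₚ
import Data.Rational.Unnormalised as ℚᵘ
import Data.Rational.Unnormalised.Properties as ℚᵘₚ
import Data.Rational.Solver as ℚSolver
open import Data.List using (List; []; _∷_; _++_; [_]; length; map; concat; upTo; reverse; zipWith)
import Data.List.Properties as Listₚ
open import Data.List.Relation.Unary.All as All using (All; []; _∷_)
import Data.List.Relation.Unary.All.Properties as Allₚ
open import Data.List.Relation.Unary.Linked using ([]; [-]; _∷_)
open import Data.List.Relation.Binary.Permutation.Propositional using (_↭_; ↭-refl; prep; swap; trans; refl; module PermutationReasoning)
import Data.List.Relation.Binary.Permutation.Propositional.Properties as ↭ₚ
open import Data.Bool using (Bool; true; false; if_then_else_)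
open import Data.Maybe using (Maybe; just; nothing)
open import Data.Empty using (⊥-elim)
open import Data.Unit using (⊤; tt)
open import Data.Sum using (inj₁; inj₂)
open import Data.Product using (Σ; _×_; _,_; proj₁; proj₂)
open import Function using (_∘_; id; case_of_)
open import Relation.Nullary using (¬_)
open import Relation.Binary.PropositionalEquality as ≡ using (_≡_; _≢_; refl; sym; cong; cong₂; subst; module ≡-Reasoning)

open ℚSolver.+-*-Solver using (solve; _:=_; _:+_; _:*_; :-_; _:-_; con)

-- Partitions

-- The corners of a partition are not listed recursively in its rows, whereas removing the first row
-- leaves all other hooks and contents intact. Everything is therefore defined by recursion on the
-- rows, with the content `s` of the first cell as a parameter that drops by one per row, and every
-- row is kept, corner or not. Rows of equal length do no harm: their extra terms cancel in `Q`, and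
-- in `T` a position where no box fits has weight zero. A combination of monomials is a list of
-- coefficients built before any partition is given, which is what makes the b_δ independent of λ.
-- Its weight bound is stored as two numbers: `D` raises the drop `e` by two and leaves the bound
-- `d` alone. Once `e` exceeds `d`, only the empty combination remains, so the claim about
-- D-polynomials is the case k = |ν| + ℓ + 1 of the expansion.

HeadBound : ℕ → List ℕ → Set
HeadBound x []      = ⊤
HeadBound x (y ∷ _) = y ≤ x

-- Unfolds one row at a time, so that inductions can drop the first row. `HeadBound` is separate
-- because `μ` is also compared with a row of length `x` that is merely imagined above it.
Par : List ℕ → Set
Par []      = ⊤
Par (x ∷ μ) = 0 < x × HeadBound x μ × Par μ

IsPartition⇒Par : ∀ {la} → IsPartition la → Par la
IsPartition⇒Par {[]}        _                      = tt
IsPartition⇒Par {x ∷ []}    (p ∷ [] , _)           = p , tt , tt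
IsPartition⇒Par {x ∷ y ∷ μ} (p ∷ ps , y≤x ∷ linked) = p , y≤x , IsPartition⇒Par (ps , linked)

-- Hook lengths of a row

row-≤ : ∀ {x} μ i → HeadBound x μ → Par μ → row μ i ≤ x
row-≤ []          i             _   _             = z≤n
row-≤ (y ∷ μ)     zero          _   _             = z≤n
row-≤ (y ∷ μ)     (suc zero)    y≤x _             = y≤x
row-≤ (y ∷ [])    (suc (suc i)) y≤x (_ , _ , pμ)  = z≤n
row-≤ (y ∷ z ∷ μ) (suc (suc i)) y≤x (_ , z≤y , pμ) = row-≤ (z ∷ μ) (suc i) (ℕₚ.≤-trans z≤y y≤x) pμ

≤⇒<ᵇ≡false : ∀ {j x} → j ≤ x → (x <ᵇ j) ≡ false
≤⇒<ᵇ≡false {zero}              _         = refl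
≤⇒<ᵇ≡false {suc j} {suc x} (s≤s j≤x) = ≤⇒<ᵇ≡false j≤x

<⇒<ᵇ≡true : ∀ {x j} → x < j → (x <ᵇ j) ≡ true
<⇒<ᵇ≡true {zero}  {suc j} _         = refl
<⇒<ᵇ≡true {suc x} {suc j} (s≤s x<j) = <⇒<ᵇ≡true x<j

conj-∷-≤ : ∀ x μ {j} → j ≤ x → conj (x ∷ μ) j ≡ suc (conj μ j)
conj-∷-≤ x μ j≤x rewrite ≤⇒<ᵇ≡false j≤x = refl

conj-> : ∀ {y} μ {j} → HeadBound y μ → Par μ → y < j → conj μ j ≡ 0
conj-> []      _   _             _   = refl
conj-> (z ∷ μ) z≤y (_ , hb , pμ) y<j
  rewrite <⇒<ᵇ≡true (ℕₚ.≤-<-trans z≤y y<j) = conj-> μ hb pμ (ℕₚ.≤-<-trans z≤y y<j)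

topHooks : ℕ → List ℕ → List ℕ
topHooks x μ = map (λ j → (x ∸ suc j) + conj μ (suc j) + 1) (upTo x)

map-upTo-cong : ∀ {A : Set} {f g : ℕ → A} n → (∀ j → j < n → f j ≡ g j) → map f (upTo n) ≡ map g (upTo n)
map-upTo-cong n f≗g = Listₚ.map-cong-local (Allₚ.applyUpTo⁺₁ id n (f≗g _))

map-upTo-suc : ∀ {A : Set} (f : ℕ → A) n → map f (upTo (suc n)) ≡ f 0 ∷ map (f ∘ suc) (upTo n)
map-upTo-suc f n = cong (f 0 ∷_) (≡.trans (Listₚ.map-applyUpTo suc f n) (sym (Listₚ.map-upTo (f ∘ suc) n)))

private
  hooksByRow : ∀ la → hooks la ≡
    concat (map (λ i → map (λ j → hook la (suc i , suc j)) (upTo (row la (suc i)))) (upTo (length la)))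
  hooksByRow la = begin
    map (hook la) (concat (map cells (upTo (length la))))
      ≡⟨ sym (Listₚ.concat-map (map cells (upTo (length la)))) ⟩
    concat (map (map (hook la)) (map cells (upTo (length la))))
      ≡⟨ cong concat (sym (Listₚ.map-∘ (upTo (length la)))) ⟩
    concat (map (map (hook la) ∘ cells) (upTo (length la)))
      ≡⟨ cong concat (Listₚ.map-cong (λ i → sym (Listₚ.map-∘ (upTo (row la (suc i))))) (upTo (length la))) ⟩
    concat (map (λ i → map (λ j → hook la (suc i , suc j)) (upTo (row la (suc i)))) (upTo (length la))) ∎
    where
    open ≡-Reasoning
    cells : ℕ → List (ℕ × ℕ)
    cells i = map (λ j → (suc i , suc j)) (upTo (row la (suc i)))

-- A new first row raises by one both the row index of each lower box and the height of its column
-- (every lower row has length at most `x`), so legs, and with them the lower hooks, stay the same.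
hooks-∷ : ∀ x μ → Par (x ∷ μ) → hooks (x ∷ μ) ≡ topHooks x μ ++ hooks μ
hooks-∷ x μ (_ , hb , pμ) = begin
  hooks (x ∷ μ)
    ≡⟨ hooksByRow (x ∷ μ) ⟩
  concat (map rowHooks (upTo (suc (length μ))))
    ≡⟨ cong concat (map-upTo-suc rowHooks (length μ)) ⟩
  rowHooks 0 ++ concat (map (rowHooks ∘ suc) (upTo (length μ)))
    ≡⟨ cong₂ _++_ top (cong concat (Listₚ.map-cong lower (upTo (length μ)))) ⟩
  topHooks x μ ++ concat (map (λ i → map (λ j → hook μ (suc i , suc j)) (upTo (row μ (suc i)))) (upTo (length μ)))
    ≡⟨ cong (topHooks x μ ++_) (sym (hooksByRow μ)) ⟩
  topHooks x μ ++ hooks μ ∎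
  where
  open ≡-Reasoning
  rowHooks : ℕ → List ℕ
  rowHooks i = map (λ j → hook (x ∷ μ) (suc i , suc j)) (upTo (row (x ∷ μ) (suc i)))
  top : rowHooks 0 ≡ topHooks x μ
  top = map-upTo-cong x (λ j j<x → cong (λ c → (x ∸ suc j) + (c ∸ 1) + 1) (conj-∷-≤ x μ j<x))
  lower : ∀ i → rowHooks (suc i) ≡ map (λ j → hook μ (suc i , suc j)) (upTo (row μ (suc i)))
  lower i = map-upTo-cong (row μ (suc i)) (λ j j< →
    cong (λ c → (row μ (suc i) ∸ suc j) + (c ∸ suc (suc i)) + 1)
         (conj-∷-≤ x μ (ℕₚ.≤-trans j< (row-≤ μ (suc i) hb pμ))))

-- The differences between the first-column hook length of a row of length x and those of the rows μ below it.
gaps : ℕ → List ℕ → List ℕ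
gaps x []      = []
gaps x (y ∷ μ) = suc (x ∸ y) ∷ map (_+_ (suc (x ∸ y))) (gaps y μ)

range : ℕ → List ℕ
range n = map suc (upTo n)

range-suc : ∀ n → range (suc n) ≡ range n ++ [ suc n ]
range-suc n = ≡.trans (cong (map suc) (sym (Listₚ.upTo-∷ʳ n))) (Listₚ.map-++ suc (upTo n) [ n ])

range-+ : ∀ m n → range (m + n) ≡ range m ++ map (_+_ m) (range n)
range-+ m zero    = ≡.trans (cong range (ℕₚ.+-identityʳ m)) (sym (Listₚ.++-identityʳ (range m)))
range-+ m (suc n) = begin
  range (m + suc n)                                 ≡⟨ cong range (ℕₚ.+-suc m n) ⟩
  range (suc (m + n))                               ≡⟨ range-suc (m + n) ⟩
  range (m + n) ++ [ suc (m + n) ]                  ≡⟨ cong₂ (λ a b → a ++ [ b ]) (range-+ m n) (sym (ℕₚ.+-suc m n)) ⟩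
  (range m ++ map (_+_ m) (range n)) ++ [ m + suc n ] ≡⟨ Listₚ.++-assoc (range m) _ _ ⟩
  range m ++ (map (_+_ m) (range n) ++ [ m + suc n ]) ≡⟨ cong (range m ++_) (sym (Listₚ.map-++ (_+_ m) (range n) [ suc n ])) ⟩
  range m ++ map (_+_ m) (range n ++ [ suc n ])      ≡⟨ cong (λ l → range m ++ map (_+_ m) l) (sym (range-suc n)) ⟩
  range m ++ map (_+_ m) (range (suc n)) ∎
  where open ≡-Reasoning

topHooks-[] : ∀ x → topHooks x [] ↭ range x
topHooks-[] zero    = ↭-refl
topHooks-[] (suc x) = begin
  topHooks (suc x) []
    ≡⟨ map-upTo-suc (λ j → (suc x ∸ suc j) + 0 + 1) x ⟩
  (x + 0 + 1) ∷ topHooks x []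
    ≡⟨ cong (_∷ topHooks x []) (≡.trans (ℕₚ.+-comm (x + 0) 1) (cong suc (ℕₚ.+-identityʳ x))) ⟩
  suc x ∷ topHooks x []
    ↭⟨ prep (suc x) (topHooks-[] x) ⟩
  suc x ∷ range x
    ↭⟨ ↭ₚ.++-comm [ suc x ] (range x) ⟩
  range x ++ [ suc x ]
    ≡⟨ sym (range-suc x) ⟩
  range (suc x) ∎
  where open PermutationReasoning

upTo-+ : ∀ {A : Set} (f : ℕ → A) m n → map f (upTo (m + n)) ≡ map f (upTo m) ++ map (f ∘ (_+_ m)) (upTo n)
upTo-+ f zero    n = refl
upTo-+ f (suc m) n = begin
  map f (upTo (suc (m + n)))                               ≡⟨ map-upTo-suc f (m + n) ⟩
  f 0 ∷ map (f ∘ suc) (upTo (m + n))                       ≡⟨ cong (f 0 ∷_) (upTo-+ (f ∘ suc) m n) ⟩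
  f 0 ∷ map (f ∘ suc) (upTo m) ++ map (f ∘ (_+_ (suc m))) (upTo n) ≡⟨ cong (_++ map (f ∘ (_+_ (suc m))) (upTo n)) (sym (map-upTo-suc f m)) ⟩
  map f (upTo (suc m)) ++ map (f ∘ (_+_ (suc m))) (upTo n) ∎
  where open ≡-Reasoning

-- Cut the columns at `y`: in the first `y` columns the arm grows by `d` and the leg by one compared
-- with the row of length `y` on `μ`; in the last `d` columns the leg is zero.
topHooks-∷ : ∀ d y μ → Par (y ∷ μ) →
  topHooks (y + d) (y ∷ μ) ≡ map (_+_ (suc d)) (topHooks y μ) ++ topHooks d []
topHooks-∷ d y μ par = begin
  map f (upTo (y + d))                              ≡⟨ upTo-+ f y d ⟩
  map f (upTo y) ++ map (f ∘ (_+_ y)) (upTo d)       ≡⟨ cong₂ _++_ (map-upTo-cong y left) (map-upTo-cong d right) ⟩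
  map (λ j → suc d + ((y ∸ suc j) + conj μ (suc j) + 1)) (upTo y) ++ topHooks d []
    ≡⟨ cong (_++ topHooks d []) (Listₚ.map-∘ (upTo y)) ⟩
  map (_+_ (suc d)) (topHooks y μ) ++ topHooks d [] ∎
  where
  open ≡-Reasoning
  f : ℕ → ℕ
  f j = (y + d ∸ suc j) + conj (y ∷ μ) (suc j) + 1
  left : ∀ j → j < y → f j ≡ suc d + ((y ∸ suc j) + conj μ (suc j) + 1)
  left j j<y = begin
    (y + d ∸ suc j) + conj (y ∷ μ) (suc j) + 1
      ≡⟨ cong₂ (λ a b → a + b + 1) (≡.trans (cong (_∸ suc j) (ℕₚ.+-comm y d)) (ℕₚ.+-∸-assoc d j<y)) (conj-∷-≤ y μ j<y) ⟩
    (d + (y ∸ suc j)) + suc (conj μ (suc j)) + 1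
      ≡⟨ regroup d (y ∸ suc j) (conj μ (suc j)) ⟩
    suc d + ((y ∸ suc j) + conj μ (suc j) + 1) ∎
    where
    regroup : ∀ d a c → (d + a) + suc c + 1 ≡ suc d + (a + c + 1)
    regroup = ℕ-solve-∀
  right : ∀ j → j < d → f (y + j) ≡ (d ∸ suc j) + 0 + 1
  right j j<d = cong₂ (λ a b → a + b + 1)
    (≡.trans (cong (y + d ∸_) (sym (ℕₚ.+-suc y j))) (ℕₚ.[m+n]∸[m+o]≡n∸o y d (suc j)))
    (conj-> (y ∷ μ) ℕₚ.≤-refl par (s≤s (ℕₚ.m≤m+n y j)))

-- With d = x - y, the `d` columns beyond `y` supply 1, ..., d, the first gap is d + 1, and the
-- hooks and gaps of the next row, all shifted by d + 1, supply the rest of the interval by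
-- induction.
topHooks-++-gaps : ∀ x μ → HeadBound x μ → Par μ → topHooks x μ ++ gaps x μ ↭ range (x + length μ)
topHooks-++-gaps x []      _   _  = begin
  topHooks x [] ++ []  ≡⟨ Listₚ.++-identityʳ _ ⟩
  topHooks x []        ↭⟨ topHooks-[] x ⟩
  range x              ≡⟨ cong range (sym (ℕₚ.+-identityʳ x)) ⟩
  range (x + 0) ∎
  where open PermutationReasoning
topHooks-++-gaps x (y ∷ μ) y≤x par@(_ , hb , pμ) = begin
  topHooks x (y ∷ μ) ++ suc d ∷ map shift (gaps y μ)
    ≡⟨ cong (λ z → topHooks z (y ∷ μ) ++ suc d ∷ map shift (gaps y μ)) (sym x≡) ⟩
  topHooks (y + d) (y ∷ μ) ++ suc d ∷ map shift (gaps y μ)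
    ≡⟨ cong (_++ suc d ∷ map shift (gaps y μ)) (topHooks-∷ d y μ par) ⟩
  (map shift (topHooks y μ) ++ topHooks d []) ++ suc d ∷ map shift (gaps y μ)
    ↭⟨ ↭ₚ.++⁺ʳ _ (↭ₚ.++-comm (map shift (topHooks y μ)) (topHooks d [])) ⟩
  (topHooks d [] ++ map shift (topHooks y μ)) ++ suc d ∷ map shift (gaps y μ)
    ↭⟨ ↭ₚ.shift (suc d) (topHooks d [] ++ map shift (topHooks y μ)) (map shift (gaps y μ)) ⟩
  suc d ∷ (topHooks d [] ++ map shift (topHooks y μ)) ++ map shift (gaps y μ)
    ≡⟨ cong (suc d ∷_) (≡.trans (Listₚ.++-assoc (topHooks d []) _ _)
         (cong (topHooks d [] ++_) (sym (Listₚ.map-++ shift (topHooks y μ) (gaps y μ))))) ⟩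
  suc d ∷ topHooks d [] ++ map shift (topHooks y μ ++ gaps y μ)
    ↭⟨ prep (suc d) (↭ₚ.++⁺ (topHooks-[] d) (↭ₚ.map⁺ shift (topHooks-++-gaps y μ hb pμ))) ⟩
  suc d ∷ range d ++ map shift (range (y + length μ))
    ↭⟨ ↭ₚ.++⁺ʳ _ (↭ₚ.++-comm [ suc d ] (range d)) ⟩
  (range d ++ [ suc d ]) ++ map shift (range (y + length μ))
    ≡⟨ cong (_++ map shift (range (y + length μ))) (sym (range-suc d)) ⟩
  range (suc d) ++ map shift (range (y + length μ))
    ≡⟨ sym (range-+ (suc d) (y + length μ)) ⟩
  range (suc d + (y + length μ))
    ≡⟨ cong range (≡.trans (regroup d y (length μ))
                           (cong (λ z → z + suc (length μ)) x≡)) ⟩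
  range (x + suc (length μ)) ∎
  where
  open PermutationReasoning
  d : ℕ
  d = x ∸ y
  shift : ℕ → ℕ
  shift = _+_ (suc d)
  regroup : ∀ d y l → suc d + (y + l) ≡ y + d + suc l
  regroup = ℕ-solve-∀
  x≡ : y + d ≡ x
  x≡ = ℕₚ.m+[n∸m]≡n y≤x

-- Rationals

ι-def : ∀ z → ℚ.toℚᵘ (ℤtoℚ z) ℚᵘ.≃ ℚᵘ.mkℚᵘ z 0
ι-def z = ℚₚ.toℚᵘ-fromℚᵘ (ℚᵘ.mkℚᵘ z 0)

ι-+ : ∀ a b → ℤtoℚ (a ℤ.+ b) ≡ ℤtoℚ a ℚ.+ ℤtoℚ b
ι-+ a b = ℚₚ.toℚᵘ-injective (begin
  ℚ.toℚᵘ (ℤtoℚ (a ℤ.+ b))                ≈⟨ ι-def (a ℤ.+ b) ⟩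
  ℚᵘ.mkℚᵘ (a ℤ.+ b) 0                    ≈⟨ ℚᵘ.*≡* (cong (ℤ._* 1ℤ) (sym (cong₂ ℤ._+_ (ℤₚ.*-identityʳ a) (ℤₚ.*-identityʳ b)))) ⟩
  ℚᵘ.mkℚᵘ a 0 ℚᵘ.+ ℚᵘ.mkℚᵘ b 0           ≈⟨ ℚᵘₚ.+-cong (ℚᵘₚ.≃-sym (ι-def a)) (ℚᵘₚ.≃-sym (ι-def b)) ⟩
  ℚ.toℚᵘ (ℤtoℚ a) ℚᵘ.+ ℚ.toℚᵘ (ℤtoℚ b)   ≈⟨ ℚᵘₚ.≃-sym (ℚₚ.toℚᵘ-homo-+ (ℤtoℚ a) (ℤtoℚ b)) ⟩
  ℚ.toℚᵘ (ℤtoℚ a ℚ.+ ℤtoℚ b) ∎)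
  where open ℚᵘₚ.≃-Reasoning

ι-* : ∀ a b → ℤtoℚ (a ℤ.* b) ≡ ℤtoℚ a *ℚ ℤtoℚ b
ι-* a b = ℚₚ.toℚᵘ-injective (begin
  ℚ.toℚᵘ (ℤtoℚ (a ℤ.* b))                ≈⟨ ι-def (a ℤ.* b) ⟩
  ℚᵘ.mkℚᵘ a 0 ℚᵘ.* ℚᵘ.mkℚᵘ b 0           ≈⟨ ℚᵘₚ.*-cong (ℚᵘₚ.≃-sym (ι-def a)) (ℚᵘₚ.≃-sym (ι-def b)) ⟩
  ℚ.toℚᵘ (ℤtoℚ a) ℚᵘ.* ℚ.toℚᵘ (ℤtoℚ b)   ≈⟨ ℚᵘₚ.≃-sym (ℚₚ.toℚᵘ-homo-* (ℤtoℚ a) (ℤtoℚ b)) ⟩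
  ℚ.toℚᵘ (ℤtoℚ a *ℚ ℤtoℚ b) ∎)
  where open ℚᵘₚ.≃-Reasoning

ι-neg : ∀ a → ℤtoℚ (ℤ.- a) ≡ ℚ.- ℤtoℚ a
ι-neg a = begin
  ℤtoℚ (ℤ.- a)                ≡⟨ cong ℤtoℚ (sym (ℤₚ.-1*i≡-i a)) ⟩
  ℤtoℚ (ℤ.-1ℤ ℤ.* a)          ≡⟨ ι-* ℤ.-1ℤ a ⟩
  ℤtoℚ ℤ.-1ℤ *ℚ ℤtoℚ a        ≡⟨ solve 1 (λ a → con (ℤtoℚ ℤ.-1ℤ) :* a := :- a) refl (ℤtoℚ a) ⟩
  ℚ.- ℤtoℚ a ∎
  where open ≡-Reasoning

ι-- : ∀ a b → ℤtoℚ (a ℤ.- b) ≡ ℤtoℚ a ℚ.- ℤtoℚ b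
ι-- a b = ≡.trans (ι-+ a (ℤ.- b)) (cong (ℤtoℚ a ℚ.+_) (ι-neg b))

-- inv 0 = 0, in accordance with _÷ℕ_.
inv : ℤ → ℚ
inv (+ zero)    = 0ℚ
inv (+ (suc n)) = + 1 ℚ./ suc n
inv -[1+ n ]    = ℚ.- (+ 1 ℚ./ suc n)

private
  *-inv-+ : ∀ n → ℤtoℚ (+ suc n) *ℚ (+ 1 ℚ./ suc n) ≡ 1ℚ
  *-inv-+ n = ℚₚ.toℚᵘ-injective (begin
    ℚ.toℚᵘ (ℤtoℚ (+ suc n) *ℚ (+ 1 ℚ./ suc n))
      ≈⟨ ℚₚ.toℚᵘ-homo-* (ℤtoℚ (+ suc n)) (+ 1 ℚ./ suc n) ⟩
    ℚ.toℚᵘ (ℤtoℚ (+ suc n)) ℚᵘ.* ℚ.toℚᵘ (+ 1 ℚ./ suc n)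
      ≈⟨ ℚᵘₚ.*-cong (ι-def (+ suc n)) (ℚₚ.toℚᵘ-fromℚᵘ (ℚᵘ.mkℚᵘ (+ 1) n)) ⟩
    ℚᵘ.mkℚᵘ (+ suc n) 0 ℚᵘ.* ℚᵘ.mkℚᵘ (+ 1) n
      ≈⟨ ℚᵘ.*≡* (cong +_ (≡.trans (ℕₚ.*-identityʳ (suc n * 1)) (≡.trans (ℕₚ.*-comm (suc n) 1) (sym (ℕₚ.*-identityˡ (1 * suc n)))))) ⟩
    ℚᵘ.1ℚᵘ ∎)
    where open ℚᵘₚ.≃-Reasoning

*-inv : ∀ {z} → z ≢ 0ℤ → ℤtoℚ z *ℚ inv z ≡ 1ℚ
*-inv {+ zero}    z≢0 = ⊥-elim (z≢0 refl)
*-inv {+ (suc n)} _   = *-inv-+ n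
*-inv { -[1+ n ]} _   = begin
  ℤtoℚ -[1+ n ] *ℚ (ℚ.- (+ 1 ℚ./ suc n))          ≡⟨ cong (_*ℚ (ℚ.- (+ 1 ℚ./ suc n))) (ι-neg (+ suc n)) ⟩
  (ℚ.- ℤtoℚ (+ suc n)) *ℚ (ℚ.- (+ 1 ℚ./ suc n))   ≡⟨ solve 2 (λ a b → (:- a) :* (:- b) := a :* b) refl (ℤtoℚ (+ suc n)) (+ 1 ℚ./ suc n) ⟩
  ℤtoℚ (+ suc n) *ℚ (+ 1 ℚ./ suc n)               ≡⟨ *-inv-+ n ⟩
  1ℚ ∎
  where open ≡-Reasoning

÷ℕ-inv : ∀ p n → p ÷ℕ n ≡ p *ℚ inv (+ n)
÷ℕ-inv p zero    = sym (ℚₚ.*-zeroʳ p)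
÷ℕ-inv p (suc n) = refl

*-cancel-ι : ∀ {z} → z ≢ 0ℤ → ∀ {p r} → ℤtoℚ z *ℚ p ≡ ℤtoℚ z *ℚ r → p ≡ r
*-cancel-ι {z} z≢0 {p} {r} zp≡zr = begin
  p                           ≡⟨ unit p ⟩
  inv z *ℚ (ℤtoℚ z *ℚ p)      ≡⟨ cong (inv z *ℚ_) zp≡zr ⟩
  inv z *ℚ (ℤtoℚ z *ℚ r)      ≡⟨ sym (unit r) ⟩
  r ∎
  where
  open ≡-Reasoning
  unit : ∀ p → p ≡ inv z *ℚ (ℤtoℚ z *ℚ p)
  unit p = begin
    p                         ≡⟨ sym (ℚₚ.*-identityˡ p) ⟩
    1ℚ *ℚ p                   ≡⟨ cong (_*ℚ p) (sym (*-inv z≢0)) ⟩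
    (ℤtoℚ z *ℚ inv z) *ℚ p    ≡⟨ solve 3 (λ z i p → (z :* i) :* p := i :* (z :* p)) refl (ℤtoℚ z) (inv z) p ⟩
    inv z *ℚ (ℤtoℚ z *ℚ p) ∎

-- The ring solver knows nothing of inverses. Identities in the field are stated as ring identities
-- with correction terms that are multiples of `v * inv v - 1`; this removes such terms.
vanish : ∀ {a} p → a ≡ 1ℚ → p *ℚ (a ℚ.- 1ℚ) ≡ 0ℚ
vanish p refl = ℚₚ.*-zeroʳ p

<⇒-≢0 : ∀ {a z} → a ℤ.< z → z ℤ.- a ≢ 0ℤ
<⇒-≢0 {a} {z} a<z z-a≡0 = ℤₚ.<-irrefl (sym (ℤₚ.i-j≡0⇒i≡j z a z-a≡0)) a<z

pow : ℕ → ℤ → ℚ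
pow zero    z = 1ℚ
pow (suc k) z = ℤtoℚ z *ℚ pow k z

ι-^ : ∀ z k → ℤtoℚ (z ℤ.^ k) ≡ pow k z
ι-^ z zero    = refl
ι-^ z (suc k) = ≡.trans (ι-* z (z ℤ.^ k)) (cong (ℤtoℚ z *ℚ_) (ι-^ z k))

-- Contents

-- Contents of the cells just right of each row of μ and of the first cell below μ,
-- when the first cell of μ has content s. Rows to which no box can be added are kept:
-- this makes X recursive in μ, and its entries are still pairwise distinct.
X : ℤ → List ℕ → List ℤ
X s []      = s ∷ []
X s (y ∷ μ) = (+ y ℤ.+ s) ∷ X (s ℤ.- 1ℤ) μ

-- ∏ (z - y) / ∏ (z - x) with x over X s μ and y over x - 1 for all x but the last.
E : ℤ → List ℕ → ℤ → ℚ
E s []      z = inv (z ℤ.- s)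
E s (x ∷ μ) z = (ℤtoℚ (z ℤ.- (+ x ℤ.+ s)) ℚ.+ 1ℚ) *ℚ inv (z ℤ.- (+ x ℤ.+ s)) *ℚ E (s ℤ.- 1ℤ) μ z

-- Equal to 1 - 1/(a - c) for c ≠ a. It is the factor by which the reciprocal hook product of a row
-- ending just before content `a` changes when a box of content `c` is added below
-- (`inv-topProduct-Adds`), and it is zero at c = a - 1.
slope : ℤ → ℤ → ℚ
slope a c = (ℤtoℚ (a ℤ.- c) ℚ.- 1ℚ) *ℚ inv (a ℤ.- c)

-- H μ times the sum of f(c(μ⁺/μ)) / H μ⁺ (see sumAdd-T), by recursion on the first row.
T : ℤ → List ℕ → (ℤ → ℚ) → ℚ
T s []      f = f s
T s (x ∷ μ) f = E (s ℤ.- 1ℤ) μ (+ x ℤ.+ s) *ℚ f (+ x ℤ.+ s)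
            ℚ.+ T (s ℤ.- 1ℤ) μ (λ c → f c *ℚ slope (+ x ℤ.+ s) c)

-- Σ f(x_i) - Σ f(y_j): the x and y of X that do not belong to a corner cancel,
-- so Q 0ℤ μ (pow k) is q_k (see removable-Q).
Q : ℤ → List ℕ → (ℤ → ℚ) → ℚ
Q s []      f = f s
Q s (x ∷ μ) f = f (+ x ℤ.+ s) ℚ.- f (+ x ℤ.+ s ℤ.- 1ℤ) ℚ.+ Q (s ℤ.- 1ℤ) μ f

-- Cauchy transform, total mass and moment recursion of `T`

X-< : ∀ {x z} s μ → HeadBound x μ → Par μ → + x ℤ.+ s ℤ.< z → All (ℤ._< z) (X s μ)
X-< {x} s []      _   _             x+s<z = ℤₚ.≤-<-trans (ℤₚ.i≤j+i s (+ x)) x+s<z ∷ []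
X-< {x} {z} s (y ∷ μ) y≤x (_ , hb , pμ) x+s<z = y+s<z ∷
  X-< (s ℤ.- 1ℤ) μ hb pμ (ℤₚ.≤-<-trans (ℤₚ.+-monoʳ-≤ (+ y) (ℤₚ.i-j≤i s 1ℤ)) y+s<z)
  where
  y+s<z : + y ℤ.+ s ℤ.< z
  y+s<z = ℤₚ.≤-<-trans (ℤₚ.+-monoˡ-≤ s (ℤ.+≤+ y≤x)) x+s<z

+-pred-< : ∀ x s → + x ℤ.+ (s ℤ.- 1ℤ) ℤ.< + x ℤ.+ s
+-pred-< x s = ℤₚ.+-monoʳ-< (+ x) (subst (s ℤ.- 1ℤ ℤ.<_) (ℤₚ.+-identityʳ s) (ℤₚ.+-monoʳ-< s ℤ.-<+))

T-cong : ∀ s μ {f g} → All (λ c → f c ≡ g c) (X s μ) → T s μ f ≡ T s μ g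
T-cong s []      (f≡g ∷ []) = f≡g
T-cong s (x ∷ μ) (f≡g ∷ fs≡gs) = cong₂ ℚ._+_ (cong (E (s ℤ.- 1ℤ) μ (+ x ℤ.+ s) *ℚ_) f≡g)
  (T-cong (s ℤ.- 1ℤ) μ (All.map (λ {c} → cong (_*ℚ slope (+ x ℤ.+ s) c)) fs≡gs))

T-linear : ∀ s μ p f r g → T s μ (λ c → p *ℚ f c ℚ.+ r *ℚ g c) ≡ p *ℚ T s μ f ℚ.+ r *ℚ T s μ g
T-linear s []      p f r g = refl
T-linear s (x ∷ μ) p f r g = begin
  e *ℚ (p *ℚ f a ℚ.+ r *ℚ g a) ℚ.+ T s' μ (λ c → (p *ℚ f c ℚ.+ r *ℚ g c) *ℚ slope a c)
    ≡⟨ cong (e *ℚ (p *ℚ f a ℚ.+ r *ℚ g a) ℚ.+_) (≡.trans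
         (T-cong s' μ (All.universal (λ c → solve 5 (λ p f r g w → (p :* f :+ r :* g) :* w := p :* (f :* w) :+ r :* (g :* w))
                                      refl p (f c) r (g c) (slope a c)) (X s' μ)))
         (T-linear s' μ p f' r g')) ⟩
  e *ℚ (p *ℚ f a ℚ.+ r *ℚ g a) ℚ.+ (p *ℚ T s' μ f' ℚ.+ r *ℚ T s' μ g')
    ≡⟨ solve 7 (λ e p f r g F G → e :* (p :* f :+ r :* g) :+ (p :* F :+ r :* G) := p :* (e :* f :+ F) :+ r :* (e :* g :+ G))
         refl e p (f a) r (g a) (T s' μ f') (T s' μ g') ⟩
  p *ℚ (e *ℚ f a ℚ.+ T s' μ f') ℚ.+ r *ℚ (e *ℚ g a ℚ.+ T s' μ g') ∎
  where
  open ≡-Reasoning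
  s' = s ℤ.- 1ℤ
  a = + x ℤ.+ s
  e = E s' μ a
  f' = λ c → f c *ℚ slope a c
  g' = λ c → g c *ℚ slope a c

-- Used with u = z - a and v = a - c: it separates the poles at c = a and c = z of `slope a c` / (z
-- - c), so that `T` of the product reduces to two Cauchy transforms.
partialFractions : ∀ {u v} → u ≢ 0ℤ → v ≢ 0ℤ → u ℤ.+ v ≢ 0ℤ →
  inv (u ℤ.+ v) *ℚ ((ℤtoℚ v ℚ.- 1ℚ) *ℚ inv v)
    ≡ (ℚ.- inv u) *ℚ inv v ℚ.+ (ℤtoℚ u ℚ.+ 1ℚ) *ℚ inv u *ℚ inv (u ℤ.+ v)
partialFractions {u'} {v'} u≢0 v≢0 u+v≢0 = begin
  t *ℚ ((v ℚ.- 1ℚ) *ℚ r)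
    ≡⟨ solve 5 (λ u v p r t →
         t :* ((v :- con 1ℚ) :* r) :=
         (:- p) :* r :+ (u :+ con 1ℚ) :* p :* t
           :+ ((t :+ p :* t) :* (v :* r :- con 1ℚ) :+ (r :* t :- t) :* (u :* p :- con 1ℚ) :+ (:- (p :* r)) :* ((u :+ v) :* t :- con 1ℚ)))
         refl u v p r t ⟩
  rhs ℚ.+ ((t ℚ.+ p *ℚ t) *ℚ (v *ℚ r ℚ.- 1ℚ) ℚ.+ (r *ℚ t ℚ.- t) *ℚ (u *ℚ p ℚ.- 1ℚ) ℚ.+ (ℚ.- (p *ℚ r)) *ℚ ((u ℚ.+ v) *ℚ t ℚ.- 1ℚ))
    ≡⟨ cong (rhs ℚ.+_) (cong₂ ℚ._+_ (cong₂ ℚ._+_ (vanish (t ℚ.+ p *ℚ t) (*-inv v≢0)) (vanish (r *ℚ t ℚ.- t) (*-inv u≢0)))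
         (vanish (ℚ.- (p *ℚ r)) (≡.trans (cong (_*ℚ t) (sym (ι-+ u' v'))) (*-inv u+v≢0)))) ⟩
  rhs ℚ.+ 0ℚ
    ≡⟨ ℚₚ.+-identityʳ rhs ⟩
  rhs ∎
  where
  open ≡-Reasoning
  u = ℤtoℚ u'
  v = ℤtoℚ v'
  p = inv u'
  r = inv v'
  t = inv (u' ℤ.+ v')
  rhs = (ℚ.- p) *ℚ r ℚ.+ (u ℚ.+ 1ℚ) *ℚ p *ℚ t

-- After `partialFractions`, the induction hypothesis at the point `a` itself evaluates the part
-- with the pole at c = a to `E s' μ a`, which is precisely the weight of the first row's own term;
-- the two cancel, and the remaining part is the next factor of `E`.
T-inv : ∀ {x z} s μ → HeadBound x μ → Par μ → + x ℤ.+ s ℤ.< z → T s μ (λ c → inv (z ℤ.- c)) ≡ E s μ z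
T-inv             s []      _   _                x+s<z = refl
T-inv {x} {z} s (y ∷ μ) y≤x (_ , hb , pμ) x+s<z = begin
  e *ℚ inv (z ℤ.- a) ℚ.+ T s' μ (λ c → inv (z ℤ.- c) *ℚ slope a c)
    ≡⟨ cong (e *ℚ inv (z ℤ.- a) ℚ.+_) (≡.trans (T-cong s' μ (All.map step (X-< s' μ hb pμ (+-pred-< y s))))
         (T-linear s' μ (ℚ.- inv (z ℤ.- a)) (λ c → inv (a ℤ.- c)) ((w ℚ.+ 1ℚ) *ℚ inv (z ℤ.- a)) (λ c → inv (z ℤ.- c)))) ⟩
  e *ℚ inv (z ℤ.- a) ℚ.+ ((ℚ.- inv (z ℤ.- a)) *ℚ T s' μ (λ c → inv (a ℤ.- c)) ℚ.+ (w ℚ.+ 1ℚ) *ℚ inv (z ℤ.- a) *ℚ T s' μ (λ c → inv (z ℤ.- c)))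
    ≡⟨ cong₂ (λ e' f' → e *ℚ inv (z ℤ.- a) ℚ.+ ((ℚ.- inv (z ℤ.- a)) *ℚ e' ℚ.+ (w ℚ.+ 1ℚ) *ℚ inv (z ℤ.- a) *ℚ f'))
         (T-inv s' μ hb pμ (+-pred-< y s)) (T-inv s' μ hb pμ (ℤₚ.<-trans (+-pred-< y s) a<z)) ⟩
  e *ℚ inv (z ℤ.- a) ℚ.+ ((ℚ.- inv (z ℤ.- a)) *ℚ e ℚ.+ (w ℚ.+ 1ℚ) *ℚ inv (z ℤ.- a) *ℚ E s' μ z)
    ≡⟨ solve 4 (λ e i w f → e :* i :+ ((:- i) :* e :+ (w :+ con 1ℚ) :* i :* f) := (w :+ con 1ℚ) :* i :* f)
         refl e (inv (z ℤ.- a)) w (E s' μ z) ⟩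
  (w ℚ.+ 1ℚ) *ℚ inv (z ℤ.- a) *ℚ E s' μ z ∎
  where
  open ≡-Reasoning
  s' = s ℤ.- 1ℤ
  a = + y ℤ.+ s
  e = E s' μ a
  w = ℤtoℚ (z ℤ.- a)
  a<z : a ℤ.< z
  a<z = ℤₚ.≤-<-trans (ℤₚ.+-monoˡ-≤ s (ℤ.+≤+ y≤x)) x+s<z
  split : ∀ z a c → (z ℤ.- a) ℤ.+ (a ℤ.- c) ≡ z ℤ.- c
  split = solve-∀
  step : ∀ {c} → c ℤ.< a → inv (z ℤ.- c) *ℚ slope a c
                           ≡ (ℚ.- inv (z ℤ.- a)) *ℚ inv (a ℤ.- c) ℚ.+ (w ℚ.+ 1ℚ) *ℚ inv (z ℤ.- a) *ℚ inv (z ℤ.- c)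
  step {c} c<a = subst (λ d → inv d *ℚ slope a c ≡ (ℚ.- inv (z ℤ.- a)) *ℚ inv (a ℤ.- c) ℚ.+ (w ℚ.+ 1ℚ) *ℚ inv (z ℤ.- a) *ℚ inv d)
    (split z a c)
    (partialFractions (<⇒-≢0 a<z) (<⇒-≢0 c<a) (subst (_≢ 0ℤ) (sym (split z a c)) (<⇒-≢0 (ℤₚ.<-trans c<a a<z))))

-- Since `slope a c` is 1 - 1/(a - c), the rows below lose the mass `E s' μ a` by `T-inv`, and that
-- is the mass given to the first row.
T-1 : ∀ s μ → Par μ → T s μ (λ _ → 1ℚ) ≡ 1ℚ
T-1 s []      _             = refl
T-1 s (x ∷ μ) (_ , hb , pμ) = begin
  e *ℚ 1ℚ ℚ.+ T s' μ (λ c → 1ℚ *ℚ slope a c)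
    ≡⟨ cong (e *ℚ 1ℚ ℚ.+_) (≡.trans (T-cong s' μ (All.map step (X-< s' μ hb pμ (+-pred-< x s)))) (T-linear s' μ 1ℚ (λ _ → 1ℚ) (ℚ.- 1ℚ) (λ c → inv (a ℤ.- c)))) ⟩
  e *ℚ 1ℚ ℚ.+ (1ℚ *ℚ T s' μ (λ _ → 1ℚ) ℚ.+ (ℚ.- 1ℚ) *ℚ T s' μ (λ c → inv (a ℤ.- c)))
    ≡⟨ cong₂ (λ o f → e *ℚ 1ℚ ℚ.+ (1ℚ *ℚ o ℚ.+ (ℚ.- 1ℚ) *ℚ f)) (T-1 s' μ pμ) (T-inv s' μ hb pμ (+-pred-< x s)) ⟩
  e *ℚ 1ℚ ℚ.+ (1ℚ *ℚ 1ℚ ℚ.+ (ℚ.- 1ℚ) *ℚ e)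
    ≡⟨ solve 1 (λ e → e :* con 1ℚ :+ (con 1ℚ :* con 1ℚ :+ (:- con 1ℚ) :* e) := con 1ℚ) refl e ⟩
  1ℚ ∎
  where
  open ≡-Reasoning
  s' = s ℤ.- 1ℤ
  a = + x ℤ.+ s
  e = E s' μ a
  step : ∀ {c} → c ℤ.< a → 1ℚ *ℚ slope a c ≡ 1ℚ *ℚ 1ℚ ℚ.+ (ℚ.- 1ℚ) *ℚ inv (a ℤ.- c)
  step {c} c<a = begin
    1ℚ *ℚ ((v ℚ.- 1ℚ) *ℚ r)
      ≡⟨ solve 2 (λ v r → con 1ℚ :* ((v :- con 1ℚ) :* r) := (con 1ℚ :* con 1ℚ :+ (:- con 1ℚ) :* r) :+ con 1ℚ :* (v :* r :- con 1ℚ)) refl v r ⟩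
    (1ℚ *ℚ 1ℚ ℚ.+ (ℚ.- 1ℚ) *ℚ r) ℚ.+ 1ℚ *ℚ (v *ℚ r ℚ.- 1ℚ)
      ≡⟨ cong ((1ℚ *ℚ 1ℚ ℚ.+ (ℚ.- 1ℚ) *ℚ r) ℚ.+_) (vanish 1ℚ (*-inv (<⇒-≢0 c<a))) ⟩
    (1ℚ *ℚ 1ℚ ℚ.+ (ℚ.- 1ℚ) *ℚ r) ℚ.+ 0ℚ
      ≡⟨ ℚₚ.+-identityʳ _ ⟩
    1ℚ *ℚ 1ℚ ℚ.+ (ℚ.- 1ℚ) *ℚ r ∎
    where
    v = ℤtoℚ (a ℤ.- c)
    r = inv (a ℤ.- c)

-- Coefficient form of (1 - a t) A(t) = (1 - (a - 1) t) A'(t), where A and A' are the moment series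
-- of `x ∷ μ` and `μ`. The factor c - a kills the first row's term, and (c - a) `slope a c` = c - (a
-- - 1) clears the denominator in the others.
T-pow-suc : ∀ s x μ → Par (x ∷ μ) → let a = + x ℤ.+ s ; s' = s ℤ.- 1ℤ in ∀ k →
  T s (x ∷ μ) (pow (suc k)) ≡
    ℤtoℚ a *ℚ T s (x ∷ μ) (pow k) ℚ.+ (T s' μ (pow (suc k)) ℚ.- (ℤtoℚ a ℚ.- 1ℚ) *ℚ T s' μ (pow k))
T-pow-suc s x μ (_ , hb , pμ) k = begin
  e *ℚ (a *ℚ P) ℚ.+ t₁
    ≡⟨ solve 5 (λ e a P t₁ t₀ → e :* (a :* P) :+ t₁ := a :* (e :* P :+ t₀) :+ (con 1ℚ :* t₁ :+ (:- a) :* t₀)) refl e a P t₁ t₀ ⟩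
  a *ℚ (e *ℚ P ℚ.+ t₀) ℚ.+ (1ℚ *ℚ t₁ ℚ.+ (ℚ.- a) *ℚ t₀)
    ≡⟨ cong (a *ℚ (e *ℚ P ℚ.+ t₀) ℚ.+_) (begin
         1ℚ *ℚ t₁ ℚ.+ (ℚ.- a) *ℚ t₀
           ≡⟨ sym (T-linear s' μ 1ℚ (λ c → pow (suc k) c *ℚ slope a' c) (ℚ.- a) (λ c → pow k c *ℚ slope a' c)) ⟩
         T s' μ (λ c → 1ℚ *ℚ (pow (suc k) c *ℚ slope a' c) ℚ.+ (ℚ.- a) *ℚ (pow k c *ℚ slope a' c))
           ≡⟨ T-cong s' μ (All.map step (X-< s' μ hb pμ (+-pred-< x s))) ⟩
         T s' μ (λ c → 1ℚ *ℚ pow (suc k) c ℚ.+ (ℚ.- (a ℚ.- 1ℚ)) *ℚ pow k c)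
           ≡⟨ T-linear s' μ 1ℚ (pow (suc k)) (ℚ.- (a ℚ.- 1ℚ)) (pow k) ⟩
         1ℚ *ℚ u₁ ℚ.+ (ℚ.- (a ℚ.- 1ℚ)) *ℚ u₀
           ≡⟨ solve 3 (λ a u₁ u₀ → con 1ℚ :* u₁ :+ (:- (a :- con 1ℚ)) :* u₀ := u₁ :- (a :- con 1ℚ) :* u₀) refl a u₁ u₀ ⟩
         u₁ ℚ.- (a ℚ.- 1ℚ) *ℚ u₀ ∎) ⟩
  a *ℚ (e *ℚ P ℚ.+ t₀) ℚ.+ (u₁ ℚ.- (a ℚ.- 1ℚ) *ℚ u₀) ∎
  where
  open ≡-Reasoning
  s' = s ℤ.- 1ℤ
  a' = + x ℤ.+ s
  a = ℤtoℚ a'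
  P = pow k a'
  e = E s' μ a'
  t₁ = T s' μ (λ c → pow (suc k) c *ℚ slope a' c)
  t₀ = T s' μ (λ c → pow k c *ℚ slope a' c)
  u₁ = T s' μ (pow (suc k))
  u₀ = T s' μ (pow k)
  split : ∀ a c → a ℤ.- (a ℤ.- c) ≡ c
  split = solve-∀
  step : ∀ {c} → c ℤ.< a' → 1ℚ *ℚ (pow (suc k) c *ℚ slope a' c) ℚ.+ (ℚ.- a) *ℚ (pow k c *ℚ slope a' c)
                            ≡ 1ℚ *ℚ pow (suc k) c ℚ.+ (ℚ.- (a ℚ.- 1ℚ)) *ℚ pow k c
  step {c} c<a = begin
    1ℚ *ℚ (C *ℚ p *ℚ ((v ℚ.- 1ℚ) *ℚ r)) ℚ.+ (ℚ.- a) *ℚ (p *ℚ ((v ℚ.- 1ℚ) *ℚ r))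
      ≡⟨ cong (λ C → 1ℚ *ℚ (C *ℚ p *ℚ ((v ℚ.- 1ℚ) *ℚ r)) ℚ.+ (ℚ.- a) *ℚ (p *ℚ ((v ℚ.- 1ℚ) *ℚ r))) C≡ ⟩
    1ℚ *ℚ ((a ℚ.- v) *ℚ p *ℚ ((v ℚ.- 1ℚ) *ℚ r)) ℚ.+ (ℚ.- a) *ℚ (p *ℚ ((v ℚ.- 1ℚ) *ℚ r))
      ≡⟨ solve 4 (λ a v r p →
           con 1ℚ :* ((a :- v) :* p :* ((v :- con 1ℚ) :* r)) :+ (:- a) :* (p :* ((v :- con 1ℚ) :* r))
           := (con 1ℚ :* ((a :- v) :* p) :+ (:- (a :- con 1ℚ)) :* p) :+ (:- ((v :- con 1ℚ) :* p)) :* (v :* r :- con 1ℚ)) refl a v r p ⟩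
    (1ℚ *ℚ ((a ℚ.- v) *ℚ p) ℚ.+ (ℚ.- (a ℚ.- 1ℚ)) *ℚ p) ℚ.+ (ℚ.- ((v ℚ.- 1ℚ) *ℚ p)) *ℚ (v *ℚ r ℚ.- 1ℚ)
      ≡⟨ cong ((1ℚ *ℚ ((a ℚ.- v) *ℚ p) ℚ.+ (ℚ.- (a ℚ.- 1ℚ)) *ℚ p) ℚ.+_) (vanish (ℚ.- ((v ℚ.- 1ℚ) *ℚ p)) (*-inv (<⇒-≢0 c<a))) ⟩
    (1ℚ *ℚ ((a ℚ.- v) *ℚ p) ℚ.+ (ℚ.- (a ℚ.- 1ℚ)) *ℚ p) ℚ.+ 0ℚ
      ≡⟨ ℚₚ.+-identityʳ _ ⟩
    1ℚ *ℚ ((a ℚ.- v) *ℚ p) ℚ.+ (ℚ.- (a ℚ.- 1ℚ)) *ℚ p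
      ≡⟨ cong (λ C → 1ℚ *ℚ (C *ℚ p) ℚ.+ (ℚ.- (a ℚ.- 1ℚ)) *ℚ p) (sym C≡) ⟩
    1ℚ *ℚ (C *ℚ p) ℚ.+ (ℚ.- (a ℚ.- 1ℚ)) *ℚ p ∎
    where
    C = ℤtoℚ c
    v = ℤtoℚ (a' ℤ.- c)
    r = inv (a' ℤ.- c)
    p = pow k c
    C≡ : C ≡ a ℚ.- v
    C≡ = ≡.trans (cong ℤtoℚ (sym (split a' c))) (ι-- a' (a' ℤ.- c))

-- Hook products

init-X : ℤ → List ℕ → List ℤ
init-X s []      = []
init-X s (y ∷ μ) = (+ y ℤ.+ s) ∷ init-X (s ℤ.- 1ℤ) μ

gaps-X : ∀ {x} s μ → HeadBound x μ → Par μ → map +_ (gaps x μ) ≡ map (λ c → + suc x ℤ.+ s ℤ.- c) (init-X s μ)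
gaps-X         s []      _   _             = refl
gaps-X {x} s (y ∷ μ) y≤x (_ , hb , pμ) = cong₂ _∷_ first (begin
  map +_ (map (_+_ (suc d)) (gaps y μ))
    ≡⟨ sym (Listₚ.map-∘ (gaps y μ)) ⟩
  map (λ g → + suc d ℤ.+ + g) (gaps y μ)
    ≡⟨ Listₚ.map-∘ (gaps y μ) ⟩
  map (ℤ._+_ (+ suc d)) (map +_ (gaps y μ))
    ≡⟨ cong (map (ℤ._+_ (+ suc d))) (gaps-X (s ℤ.- 1ℤ) μ hb pμ) ⟩
  map (ℤ._+_ (+ suc d)) (map (λ c → + suc y ℤ.+ (s ℤ.- 1ℤ) ℤ.- c) (init-X (s ℤ.- 1ℤ) μ))
    ≡⟨ sym (Listₚ.map-∘ (init-X (s ℤ.- 1ℤ) μ)) ⟩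
  map (λ c → + suc d ℤ.+ (+ suc y ℤ.+ (s ℤ.- 1ℤ) ℤ.- c)) (init-X (s ℤ.- 1ℤ) μ)
    ≡⟨ Listₚ.map-cong (λ c → ≡.trans (later (+ d) (+ y) s c) (cong (λ x → 1ℤ ℤ.+ x ℤ.+ s ℤ.- c) y+d)) (init-X (s ℤ.- 1ℤ) μ) ⟩
  map (λ c → + suc x ℤ.+ s ℤ.- c) (init-X (s ℤ.- 1ℤ) μ) ∎)
  where
  open ≡-Reasoning
  d = x ∸ y
  y+d : + y ℤ.+ + d ≡ + x
  y+d = cong +_ (ℕₚ.m+[n∸m]≡n y≤x)
  first′ : ∀ d y s → 1ℤ ℤ.+ d ≡ 1ℤ ℤ.+ (y ℤ.+ d) ℤ.+ s ℤ.- (y ℤ.+ s)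
  first′ = solve-∀
  first : + suc d ≡ + suc x ℤ.+ s ℤ.- (+ y ℤ.+ s)
  first = ≡.trans (first′ (+ d) (+ y) s) (cong (λ x → 1ℤ ℤ.+ x ℤ.+ s ℤ.- (+ y ℤ.+ s)) y+d)
  later : ∀ d y s c → (1ℤ ℤ.+ d) ℤ.+ ((1ℤ ℤ.+ y) ℤ.+ (s ℤ.- 1ℤ) ℤ.- c) ≡ 1ℤ ℤ.+ (y ℤ.+ d) ℤ.+ s ℤ.- c
  later = solve-∀

prodℤ-+ : ∀ l → prodℤ (map +_ l) ≡ + LA.product l
prodℤ-+ []      = refl
prodℤ-+ (n ∷ l) = ≡.trans (cong (+ n ℤ.*_) (prodℤ-+ l)) (sym (ℤₚ.pos-* n (LA.product l)))

-- The denominator of `E`. It is kept in the integers, where products of hooks can be compared with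
-- factorials without division.
PX : ℤ → List ℕ → ℤ → ℤ
PX s []      z = z ℤ.- s
PX s (y ∷ μ) z = (z ℤ.- (+ y ℤ.+ s)) ℤ.* PX (s ℤ.- 1ℤ) μ z

PX-init : ∀ s μ z → PX s μ z ≡ prodℤ (map (λ c → z ℤ.- c) (init-X s μ)) ℤ.* (z ℤ.- s ℤ.+ + length μ)
PX-init s []      z = base s z
  where
  base : ∀ s z → z ℤ.- s ≡ 1ℤ ℤ.* (z ℤ.- s ℤ.+ 0ℤ)
  base = solve-∀
PX-init s (y ∷ μ) z = ≡.trans (cong ((z ℤ.- (+ y ℤ.+ s)) ℤ.*_) (PX-init (s ℤ.- 1ℤ) μ z))
  (step (z ℤ.- (+ y ℤ.+ s)) (prodℤ (map (λ c → z ℤ.- c) (init-X (s ℤ.- 1ℤ) μ))) z s (+ length μ))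
  where
  step : ∀ a b z s l → a ℤ.* (b ℤ.* (z ℤ.- (s ℤ.- 1ℤ) ℤ.+ l)) ≡ (a ℤ.* b) ℤ.* (z ℤ.- s ℤ.+ (1ℤ ℤ.+ l))
  step = solve-∀

product-range : ∀ n → LA.product (range n) ≡ n !
product-range zero    = refl
product-range (suc n) = begin
  LA.product (range (suc n))          ≡⟨ cong LA.product (range-suc n) ⟩
  LA.product (range n ++ [ suc n ])   ≡⟨ LAₚ.product-++ (range n) [ suc n ] ⟩
  LA.product (range n) * (suc n * 1)  ≡⟨ cong₂ _*_ (product-range n) (ℕₚ.*-identityʳ (suc n)) ⟩
  n ! * suc n                         ≡⟨ ℕₚ.*-comm (n !) (suc n) ⟩
  suc n ! ∎
  where open ≡-Reasoning

topProduct : ℕ → List ℕ → ℕ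
topProduct x μ = LA.product (topHooks x μ)

-- At this point the factors of `PX` are the gaps (`gaps-X`), which complete the hooks to the
-- factorial of `x + length μ`, and one factor x + ℓ + 1 from the last entry of `X`, which has no
-- row.
topProduct-PX : ∀ {x} s μ → HeadBound x μ → Par μ →
  + topProduct x μ ℤ.* PX s μ (+ suc x ℤ.+ s) ≡ + (suc (x + length μ) !)
topProduct-PX {x} s μ hb pμ = begin
  + topProduct x μ ℤ.* PX s μ z
    ≡⟨ cong (+ topProduct x μ ℤ.*_) (PX-init s μ z) ⟩
  + topProduct x μ ℤ.* (prodℤ (map (λ c → z ℤ.- c) (init-X s μ)) ℤ.* (z ℤ.- s ℤ.+ + length μ))
    ≡⟨ cong₂ (λ g l → + topProduct x μ ℤ.* (g ℤ.* l))
         (≡.trans (cong prodℤ (sym (gaps-X s μ hb pμ))) (prodℤ-+ (gaps x μ))) (last (+ x) s (+ length μ)) ⟩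
  + topProduct x μ ℤ.* (+ LA.product (gaps x μ) ℤ.* + suc (x + length μ))
    ≡⟨ sym (ℤₚ.*-assoc (+ topProduct x μ) (+ LA.product (gaps x μ)) (+ suc (x + length μ))) ⟩
  (+ topProduct x μ ℤ.* + LA.product (gaps x μ)) ℤ.* + suc (x + length μ)
    ≡⟨ cong (ℤ._* + suc (x + length μ)) (≡.trans (sym (ℤₚ.pos-* (topProduct x μ) (LA.product (gaps x μ)))) (cong +_ hooks!)) ⟩
  + ((x + length μ) !) ℤ.* + suc (x + length μ)
    ≡⟨ ≡.trans (sym (ℤₚ.pos-* ((x + length μ) !) (suc (x + length μ)))) (cong +_ (ℕₚ.*-comm ((x + length μ) !) (suc (x + length μ)))) ⟩
  + (suc (x + length μ) !) ∎
  where
  open ≡-Reasoning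
  z = + suc x ℤ.+ s
  last : ∀ x s l → 1ℤ ℤ.+ x ℤ.+ s ℤ.- s ℤ.+ l ≡ 1ℤ ℤ.+ (x ℤ.+ l)
  last = solve-∀
  hooks! : topProduct x μ * LA.product (gaps x μ) ≡ (x + length μ) !
  hooks! = begin
    topProduct x μ * LA.product (gaps x μ)      ≡⟨ sym (LAₚ.product-++ (topHooks x μ) (gaps x μ)) ⟩
    LA.product (topHooks x μ ++ gaps x μ)       ≡⟨ LAₚ.product-↭ (topHooks-++-gaps x μ hb pμ) ⟩
    LA.product (range (x + length μ))           ≡⟨ product-range (x + length μ) ⟩
    (x + length μ) ! ∎

!≢0 : ∀ n → + (n !) ≢ 0ℤ
!≢0 n n!≡0 = ℕₚ.1+n≰n (ℕₚ.≤-trans (ℕₚ.1≤n! n) (ℕₚ.≤-reflexive (ℤₚ.+-injective n!≡0)))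

*≢0ˡ : ∀ {a b c} → a ℤ.* b ≡ c → c ≢ 0ℤ → a ≢ 0ℤ
*≢0ˡ ab≡c c≢0 refl = c≢0 (sym ab≡c)

*≢0ʳ : ∀ {a b c} → a ℤ.* b ≡ c → c ≢ 0ℤ → b ≢ 0ℤ
*≢0ʳ {a} ab≡c c≢0 refl = c≢0 (≡.trans (sym ab≡c) (ℤₚ.*-zeroʳ a))

topProduct≢0 : ∀ {x} μ → HeadBound x μ → Par μ → + topProduct x μ ≢ 0ℤ
topProduct≢0 {x} μ hb pμ = *≢0ˡ (topProduct-PX 0ℤ μ hb pμ) (!≢0 (suc (x + length μ)))

PX≢0 : ∀ {x} s μ → HeadBound x μ → Par μ → PX s μ (+ suc x ℤ.+ s) ≢ 0ℤ
PX≢0 {x} s μ hb pμ = *≢0ʳ {+ topProduct x μ} (topProduct-PX s μ hb pμ) (!≢0 (suc (x + length μ)))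

-- Raising `z` by one turns each row's factor of `PX` into the corresponding numerator of `E`. The
-- last entry of `X` has no numerator in `E`, hence the extra factor on the right.
PX-suc : ∀ s μ z → All (ℤ._< z) (X s μ) →
  ℤtoℚ (PX s μ (1ℤ ℤ.+ z)) ≡ E s μ z *ℚ ℤtoℚ (PX s μ z) *ℚ ℤtoℚ (1ℤ ℤ.+ z ℤ.- s ℤ.+ + length μ)
PX-suc s []      z (s<z ∷ []) = begin
  ℤtoℚ (1ℤ ℤ.+ z ℤ.- s)
    ≡⟨ cong ℤtoℚ (sym (ℤₚ.+-identityʳ (1ℤ ℤ.+ z ℤ.- s))) ⟩
  ℤtoℚ (1ℤ ℤ.+ z ℤ.- s ℤ.+ 0ℤ)
    ≡⟨ sym (ℚₚ.*-identityˡ _) ⟩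
  1ℚ *ℚ ℤtoℚ (1ℤ ℤ.+ z ℤ.- s ℤ.+ 0ℤ)
    ≡⟨ cong (_*ℚ ℤtoℚ (1ℤ ℤ.+ z ℤ.- s ℤ.+ 0ℤ)) (≡.trans (sym (*-inv (<⇒-≢0 s<z))) (ℚₚ.*-comm (ℤtoℚ (z ℤ.- s)) (inv (z ℤ.- s)))) ⟩
  inv (z ℤ.- s) *ℚ ℤtoℚ (z ℤ.- s) *ℚ ℤtoℚ (1ℤ ℤ.+ z ℤ.- s ℤ.+ 0ℤ) ∎
  where open ≡-Reasoning
PX-suc s (y ∷ μ) z (y<z ∷ <z) = begin
  ℤtoℚ ((1ℤ ℤ.+ z ℤ.- a) ℤ.* PX s' μ (1ℤ ℤ.+ z))
    ≡⟨ ι-* (1ℤ ℤ.+ z ℤ.- a) (PX s' μ (1ℤ ℤ.+ z)) ⟩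
  ℤtoℚ (1ℤ ℤ.+ z ℤ.- a) *ℚ ℤtoℚ (PX s' μ (1ℤ ℤ.+ z))
    ≡⟨ cong₂ _*ℚ_ (≡.trans (cong ℤtoℚ (shift z a)) (ι-+ (z ℤ.- a) 1ℤ)) (PX-suc s' μ z <z) ⟩
  (v ℚ.+ 1ℚ) *ℚ (e *ℚ p *ℚ ℤtoℚ (1ℤ ℤ.+ z ℤ.- s' ℤ.+ + length μ))
    ≡⟨ cong (λ l → (v ℚ.+ 1ℚ) *ℚ (e *ℚ p *ℚ ℤtoℚ l)) (len z s (+ length μ)) ⟩
  (v ℚ.+ 1ℚ) *ℚ (e *ℚ p *ℚ l)
    ≡⟨ solve 5 (λ v r e p l → (v :+ con 1ℚ) :* (e :* p :* l)
         := (v :+ con 1ℚ) :* r :* e :* (v :* p) :* l :+ (:- ((v :+ con 1ℚ) :* e :* p :* l)) :* (v :* r :- con 1ℚ)) refl v r e p l ⟩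
  (v ℚ.+ 1ℚ) *ℚ r *ℚ e *ℚ (v *ℚ p) *ℚ l ℚ.+ (ℚ.- ((v ℚ.+ 1ℚ) *ℚ e *ℚ p *ℚ l)) *ℚ (v *ℚ r ℚ.- 1ℚ)
    ≡⟨ cong ((v ℚ.+ 1ℚ) *ℚ r *ℚ e *ℚ (v *ℚ p) *ℚ l ℚ.+_) (vanish (ℚ.- ((v ℚ.+ 1ℚ) *ℚ e *ℚ p *ℚ l)) (*-inv (<⇒-≢0 y<z))) ⟩
  (v ℚ.+ 1ℚ) *ℚ r *ℚ e *ℚ (v *ℚ p) *ℚ l ℚ.+ 0ℚ
    ≡⟨ ℚₚ.+-identityʳ _ ⟩
  (v ℚ.+ 1ℚ) *ℚ r *ℚ e *ℚ (v *ℚ p) *ℚ l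
    ≡⟨ cong (λ vp → (v ℚ.+ 1ℚ) *ℚ r *ℚ e *ℚ vp *ℚ l) (sym (ι-* (z ℤ.- a) (PX s' μ z))) ⟩
  (v ℚ.+ 1ℚ) *ℚ r *ℚ e *ℚ ℤtoℚ (PX s (y ∷ μ) z) *ℚ l ∎
  where
  open ≡-Reasoning
  s' = s ℤ.- 1ℤ
  a = + y ℤ.+ s
  v = ℤtoℚ (z ℤ.- a)
  r = inv (z ℤ.- a)
  e = E s' μ z
  p = ℤtoℚ (PX s' μ z)
  l = ℤtoℚ (1ℤ ℤ.+ z ℤ.- s ℤ.+ + suc (length μ))
  shift : ∀ z a → 1ℤ ℤ.+ z ℤ.- a ≡ z ℤ.- a ℤ.+ 1ℤ
  shift = solve-∀
  len : ∀ z s l → 1ℤ ℤ.+ z ℤ.- (s ℤ.- 1ℤ) ℤ.+ l ≡ 1ℤ ℤ.+ z ℤ.- s ℤ.+ (1ℤ ℤ.+ l)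
  len = solve-∀

HeadBound-mono : ∀ {x x'} μ → x ≤ x' → HeadBound x μ → HeadBound x' μ
HeadBound-mono []      _    _   = tt
HeadBound-mono (y ∷ μ) x≤x' y≤x = ℕₚ.≤-trans y≤x x≤x'

inv-unique : ∀ {z} p → z ≢ 0ℤ → ℤtoℚ z *ℚ p ≡ 1ℚ → inv z ≡ p
inv-unique p z≢0 zp≡1 = *-cancel-ι z≢0 (≡.trans (*-inv z≢0) (sym zp≡1))

inv-* : ∀ {y z} → y ≢ 0ℤ → z ≢ 0ℤ → inv (y ℤ.* z) ≡ inv y *ℚ inv z
inv-* {y} {z} y≢0 z≢0 = inv-unique (inv y *ℚ inv z) (λ yz≡0 → case ℤₚ.i*j≡0⇒i≡0∨j≡0 y yz≡0 of λ where
    (inj₁ y≡0) → y≢0 y≡0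
    (inj₂ z≡0) → z≢0 z≡0) (begin
  ℤtoℚ (y ℤ.* z) *ℚ (inv y *ℚ inv z)          ≡⟨ cong (_*ℚ (inv y *ℚ inv z)) (ι-* y z) ⟩
  ℤtoℚ y *ℚ ℤtoℚ z *ℚ (inv y *ℚ inv z)        ≡⟨ solve 4 (λ y z p r → y :* z :* (p :* r) := (y :* p) :* (z :* r)) refl (ℤtoℚ y) (ℤtoℚ z) (inv y) (inv z) ⟩
  (ℤtoℚ y *ℚ inv y) *ℚ (ℤtoℚ z *ℚ inv z)      ≡⟨ cong₂ _*ℚ_ (*-inv y≢0) (*-inv z≢0) ⟩
  1ℚ *ℚ 1ℚ                                    ≡⟨ ℚₚ.*-identityˡ 1ℚ ⟩
  1ℚ ∎)
  where open ≡-Reasoning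

-- Compare `topProduct-PX` for rows of lengths `x` and `suc x`: the evaluation point moves up by
-- one, which produces `E` by `PX-suc`, and the extra factor there is the quotient of the two
-- factorials.
inv-topProduct-suc : ∀ {x} s μ → HeadBound x μ → Par μ →
  inv (+ topProduct (suc x) μ) ≡ E (s ℤ.- 1ℤ) μ (+ x ℤ.+ s) *ℚ inv (+ topProduct x μ)
inv-topProduct-suc {x} s μ hb pμ = inv-unique _ (topProduct≢0 μ hb⁺ pμ) (begin
  R⁺ *ℚ (e *ℚ inv (+ topProduct x μ))         ≡⟨ sym (ℚₚ.*-assoc R⁺ e (inv (+ topProduct x μ))) ⟩
  R⁺ *ℚ e *ℚ inv (+ topProduct x μ)           ≡⟨ cong (_*ℚ inv (+ topProduct x μ)) R⁺e≡R ⟩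
  R *ℚ inv (+ topProduct x μ)                 ≡⟨ *-inv (topProduct≢0 μ hb pμ) ⟩
  1ℚ ∎)
  where
  open ≡-Reasoning
  hb⁺ : HeadBound (suc x) μ
  hb⁺ = HeadBound-mono μ (ℕₚ.n≤1+n x) hb
  s' = s ℤ.- 1ℤ
  a = + x ℤ.+ s
  R⁺ = ℤtoℚ (+ topProduct (suc x) μ)
  R = ℤtoℚ (+ topProduct x μ)
  e = E s' μ a
  n = x + length μ
  a≡ : + suc x ℤ.+ s' ≡ a
  a≡ = h (+ x) s
    where
    h : ∀ x s → 1ℤ ℤ.+ x ℤ.+ (s ℤ.- 1ℤ) ≡ x ℤ.+ s
    h = solve-∀
  1+a≡ : + suc (suc x) ℤ.+ s' ≡ 1ℤ ℤ.+ a
  1+a≡ = h (+ x) s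
    where
    h : ∀ x s → 1ℤ ℤ.+ (1ℤ ℤ.+ x) ℤ.+ (s ℤ.- 1ℤ) ≡ 1ℤ ℤ.+ (x ℤ.+ s)
    h = solve-∀
  last : 1ℤ ℤ.+ a ℤ.- s' ℤ.+ + length μ ≡ + suc (suc n)
  last = h (+ x) s (+ length μ)
    where
    h : ∀ x s l → 1ℤ ℤ.+ (x ℤ.+ s) ℤ.- (s ℤ.- 1ℤ) ℤ.+ l ≡ 1ℤ ℤ.+ (1ℤ ℤ.+ (x ℤ.+ l))
    h = solve-∀
  P = ℤtoℚ (PX s' μ a)
  N = ℤtoℚ (+ suc (suc n))
  RP : R *ℚ P ≡ ℤtoℚ (+ (suc n !))
  RP = ≡.trans (sym (ι-* (+ topProduct x μ) (PX s' μ a)))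
    (cong ℤtoℚ (subst (λ z → + topProduct x μ ℤ.* PX s' μ z ≡ + (suc n !)) a≡ (topProduct-PX s' μ hb pμ)))
  R⁺P : R⁺ *ℚ (e *ℚ P *ℚ N) ≡ ℤtoℚ (+ (suc (suc n) !))
  R⁺P = begin
    R⁺ *ℚ (e *ℚ P *ℚ N)
      ≡⟨ cong (λ l → R⁺ *ℚ (e *ℚ P *ℚ ℤtoℚ l)) (sym last) ⟩
    R⁺ *ℚ (e *ℚ P *ℚ ℤtoℚ (1ℤ ℤ.+ a ℤ.- s' ℤ.+ + length μ))
      ≡⟨ cong (R⁺ *ℚ_) (sym (PX-suc s' μ a (X-< s' μ hb pμ (+-pred-< x s)))) ⟩
    R⁺ *ℚ ℤtoℚ (PX s' μ (1ℤ ℤ.+ a))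
      ≡⟨ sym (ι-* (+ topProduct (suc x) μ) (PX s' μ (1ℤ ℤ.+ a))) ⟩
    ℤtoℚ (+ topProduct (suc x) μ ℤ.* PX s' μ (1ℤ ℤ.+ a))
      ≡⟨ cong ℤtoℚ (subst (λ z → + topProduct (suc x) μ ℤ.* PX s' μ z ≡ + (suc (suc n) !)) 1+a≡ (topProduct-PX s' μ hb⁺ pμ)) ⟩
    ℤtoℚ (+ (suc (suc n) !)) ∎
  R⁺e≡R : R⁺ *ℚ e ≡ R
  R⁺e≡R = *-cancel-ι (subst (λ z → PX s' μ z ≢ 0ℤ) a≡ (PX≢0 s' μ hb pμ)) (*-cancel-ι {+ suc (suc n)} (λ ()) (begin
    N *ℚ (P *ℚ (R⁺ *ℚ e))
      ≡⟨ solve 4 (λ n p r e → n :* (p :* (r :* e)) := r :* (e :* p :* n)) refl N P R⁺ e ⟩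
    R⁺ *ℚ (e *ℚ P *ℚ N)
      ≡⟨ R⁺P ⟩
    ℤtoℚ (+ (suc (suc n) !))
      ≡⟨ ≡.trans (cong ℤtoℚ (ℤₚ.pos-* (suc (suc n)) (suc n !))) (ι-* (+ suc (suc n)) (+ (suc n !))) ⟩
    N *ℚ ℤtoℚ (+ (suc n !))
      ≡⟨ cong (N *ℚ_) (≡.trans (sym RP) (ℚₚ.*-comm R P)) ⟩
    N *ℚ (P *ℚ R) ∎))

-- The box may extend any row; that the result is a partition is a separate hypothesis where it
-- matters. The polynomial identities in the content thus need no case distinction on corners.
data Adds : ℤ → List ℕ → List ℕ → ℤ → Set where
  new   : ∀ {s} → Adds s [] (1 ∷ []) s
  here  : ∀ {s x μ} → Adds s (x ∷ μ) (suc x ∷ μ) (+ x ℤ.+ s)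
  there : ∀ {s x μ m c} → Adds (s ℤ.- 1ℤ) μ m c → Adds s (x ∷ μ) (x ∷ m) c

-- The factor z - c becomes z - c - 1. A box that opens a new row also creates a new last factor,
-- equal to k + 1 because z - s = k, and the factorials account for it; otherwise they agree on both
-- sides.
PX-Adds : ∀ {s μ m c} → Adds s μ m c → ∀ {z} k → z ≡ + k ℤ.+ s →
  PX s m z ℤ.* (z ℤ.- c) ℤ.* + ((k + length μ) !) ≡ PX s μ z ℤ.* (z ℤ.- c ℤ.- 1ℤ) ℤ.* + ((k + length m) !)
PX-Adds {s} new k refl
  rewrite ℕₚ.+-identityʳ k | ℕₚ.+-comm k 1 =
    ≡.trans (h (+ k) s (+ (k !))) (cong (((+ k ℤ.+ s ℤ.- s) ℤ.* (+ k ℤ.+ s ℤ.- s ℤ.- 1ℤ)) ℤ.*_) (sym (ℤₚ.pos-* (suc k) (k !))))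
  where
  h : ∀ k s f → let z = k ℤ.+ s in
    ((z ℤ.- (1ℤ ℤ.+ s)) ℤ.* (z ℤ.- (s ℤ.- 1ℤ))) ℤ.* (z ℤ.- s) ℤ.* f ≡ (z ℤ.- s) ℤ.* (z ℤ.- s ℤ.- 1ℤ) ℤ.* ((1ℤ ℤ.+ k) ℤ.* f)
  h = solve-∀
PX-Adds {s} {x ∷ μ} here {z} k _ = h z (+ x ℤ.+ s) (z ℤ.- (+ x ℤ.+ s)) (+ suc x ℤ.+ s) (shift (+ x) s) (PX (s ℤ.- 1ℤ) μ z) (+ ((k + suc (length μ)) !))
  where
  shift : ∀ x s → 1ℤ ℤ.+ x ℤ.+ s ≡ 1ℤ ℤ.+ (x ℤ.+ s)
  shift = solve-∀
  h' : ∀ z a v p f → (z ℤ.- (1ℤ ℤ.+ a)) ℤ.* p ℤ.* v ℤ.* f ≡ v ℤ.* p ℤ.* (z ℤ.- a ℤ.- 1ℤ) ℤ.* f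
  h' = solve-∀
  h : ∀ z a v a⁺ → a⁺ ≡ 1ℤ ℤ.+ a → ∀ p f → (z ℤ.- a⁺) ℤ.* p ℤ.* v ℤ.* f ≡ v ℤ.* p ℤ.* (z ℤ.- a ℤ.- 1ℤ) ℤ.* f
  h z a v _ refl = h' z a v
PX-Adds {s} {x ∷ μ} {_ ∷ m} {c} (there add) {z} k z≡ rewrite ℕₚ.+-suc k (length μ) | ℕₚ.+-suc k (length m) = begin
  (v ℤ.* PX s' m z) ℤ.* (z ℤ.- c) ℤ.* + (suc (k + length μ) !)
    ≡⟨ assoc v (PX s' m z) (z ℤ.- c) (+ (suc (k + length μ) !)) ⟩
  v ℤ.* (PX s' m z ℤ.* (z ℤ.- c) ℤ.* + (suc (k + length μ) !))
    ≡⟨ cong (v ℤ.*_) (PX-Adds add (suc k) (≡.trans z≡ (shift (+ k) s))) ⟩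
  v ℤ.* (PX s' μ z ℤ.* (z ℤ.- c ℤ.- 1ℤ) ℤ.* + (suc (k + length m) !))
    ≡⟨ sym (assoc v (PX s' μ z) (z ℤ.- c ℤ.- 1ℤ) (+ (suc (k + length m) !))) ⟩
  (v ℤ.* PX s' μ z) ℤ.* (z ℤ.- c ℤ.- 1ℤ) ℤ.* + (suc (k + length m) !) ∎
  where
  open ≡-Reasoning
  s' = s ℤ.- 1ℤ
  v = z ℤ.- (+ x ℤ.+ s)
  assoc : ∀ a b c d → (a ℤ.* b) ℤ.* c ℤ.* d ≡ a ℤ.* (b ℤ.* c ℤ.* d)
  assoc = solve-∀
  shift : ∀ k s → k ℤ.+ s ≡ 1ℤ ℤ.+ k ℤ.+ (s ℤ.- 1ℤ)
  shift = solve-∀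

-- `topProduct-PX` is applied to `μ` and to `m`, and `PX-Adds` compares the two values of `PX`.
-- Everything is multiplied by both factorials, which are nonzero and are cancelled at the end.
topProduct-Adds : ∀ {x} s {μ m c} → Adds (s ℤ.- 1ℤ) μ m c →
  HeadBound x μ → Par μ → HeadBound x m → Par m → let v = + x ℤ.+ s ℤ.- c in
  + topProduct x m ℤ.* (v ℤ.- 1ℤ) ≡ + topProduct x μ ℤ.* v
topProduct-Adds {x} s {μ} {m} {c} add hbμ pμ hbm pm =
  subst (λ a → Rm ℤ.* (a ℤ.- c ℤ.- 1ℤ) ≡ Rμ ℤ.* (a ℤ.- c)) (a≡ (+ x) s)
    (ℤₚ.*-cancelʳ-≡ _ _ (f ℤ.* g) ⦃ f*g≢0 ⦄ (begin
      Rm ℤ.* (v ℤ.- 1ℤ) ℤ.* (f ℤ.* g)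
        ≡⟨ cong (λ g → Rm ℤ.* (v ℤ.- 1ℤ) ℤ.* (f ℤ.* g)) (sym (topProduct-PX s' μ hbμ pμ)) ⟩
      Rm ℤ.* (v ℤ.- 1ℤ) ℤ.* (f ℤ.* (Rμ ℤ.* PX s' μ z))
        ≡⟨ regroup₁ Rm Rμ v f (PX s' μ z) ⟩
      Rm ℤ.* Rμ ℤ.* (PX s' μ z ℤ.* (v ℤ.- 1ℤ) ℤ.* f)
        ≡⟨ cong (Rm ℤ.* Rμ ℤ.*_) (sym (PX-Adds add (suc x) refl)) ⟩
      Rm ℤ.* Rμ ℤ.* (PX s' m z ℤ.* v ℤ.* g)
        ≡⟨ regroup₂ Rm Rμ v g (PX s' m z) ⟩
      Rμ ℤ.* v ℤ.* (Rm ℤ.* PX s' m z ℤ.* g)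
        ≡⟨ cong (λ f → Rμ ℤ.* v ℤ.* (f ℤ.* g)) (topProduct-PX s' m hbm pm) ⟩
      Rμ ℤ.* v ℤ.* (f ℤ.* g) ∎))
  where
  open ≡-Reasoning
  s' = s ℤ.- 1ℤ
  z = + suc x ℤ.+ s'
  v = z ℤ.- c
  Rm = + topProduct x m
  Rμ = + topProduct x μ
  f = + (suc (x + length m) !)
  g = + (suc (x + length μ) !)
  f*g≢0 : ℤ.NonZero (f ℤ.* g)
  f*g≢0 = ℤₚ.i*j≢0 f g ⦃ ℤ.≢-nonZero (!≢0 (suc (x + length m))) ⦄ ⦃ ℤ.≢-nonZero (!≢0 (suc (x + length μ))) ⦄
  a≡ : ∀ x s → 1ℤ ℤ.+ x ℤ.+ (s ℤ.- 1ℤ) ≡ x ℤ.+ s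
  a≡ = solve-∀
  regroup₁ : ∀ m u v f p → m ℤ.* (v ℤ.- 1ℤ) ℤ.* (f ℤ.* (u ℤ.* p)) ≡ m ℤ.* u ℤ.* (p ℤ.* (v ℤ.- 1ℤ) ℤ.* f)
  regroup₁ = solve-∀
  regroup₂ : ∀ m u v g p → m ℤ.* u ℤ.* (p ℤ.* v ℤ.* g) ≡ u ℤ.* v ℤ.* (m ℤ.* p ℤ.* g)
  regroup₂ = solve-∀

inv-topProduct-Adds : ∀ {x} s {μ m c} → Adds (s ℤ.- 1ℤ) μ m c →
  HeadBound x μ → Par μ → HeadBound x m → Par m → c ℤ.< + x ℤ.+ s →
  inv (+ topProduct x m) ≡ inv (+ topProduct x μ) *ℚ slope (+ x ℤ.+ s) c
inv-topProduct-Adds {x} s {μ} {m} {c} add hbμ pμ hbm pm c<a = inv-unique _ (topProduct≢0 m hbm pm) (begin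
  ℤtoℚ Rm *ℚ (i *ℚ ((ℤtoℚ v ℚ.- 1ℚ) *ℚ inv v))
    ≡⟨ solve 4 (λ m i w r → m :* (i :* (w :* r)) := (m :* w) :* (i :* r)) refl (ℤtoℚ Rm) i (ℤtoℚ v ℚ.- 1ℚ) (inv v) ⟩
  (ℤtoℚ Rm *ℚ (ℤtoℚ v ℚ.- 1ℚ)) *ℚ (i *ℚ inv v)
    ≡⟨ cong (_*ℚ (i *ℚ inv v)) (begin
         ℤtoℚ Rm *ℚ (ℤtoℚ v ℚ.- 1ℚ)  ≡⟨ cong (ℤtoℚ Rm *ℚ_) (sym (ι-- v 1ℤ)) ⟩
         ℤtoℚ Rm *ℚ ℤtoℚ (v ℤ.- 1ℤ)  ≡⟨ sym (ι-* Rm (v ℤ.- 1ℤ)) ⟩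
         ℤtoℚ (Rm ℤ.* (v ℤ.- 1ℤ))    ≡⟨ cong ℤtoℚ (topProduct-Adds s add hbμ pμ hbm pm) ⟩
         ℤtoℚ (Rμ ℤ.* v)             ≡⟨ ι-* Rμ v ⟩
         ℤtoℚ Rμ *ℚ ℤtoℚ v ∎) ⟩
  (ℤtoℚ Rμ *ℚ ℤtoℚ v) *ℚ (i *ℚ inv v)
    ≡⟨ solve 4 (λ m i w r → (m :* w) :* (i :* r) := (m :* i) :* (w :* r)) refl (ℤtoℚ Rμ) i (ℤtoℚ v) (inv v) ⟩
  (ℤtoℚ Rμ *ℚ i) *ℚ (ℤtoℚ v *ℚ inv v)
    ≡⟨ cong₂ _*ℚ_ (*-inv (topProduct≢0 μ hbμ pμ)) (*-inv (<⇒-≢0 c<a)) ⟩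
  1ℚ *ℚ 1ℚ
    ≡⟨ ℚₚ.*-identityˡ 1ℚ ⟩
  1ℚ ∎)
  where
  open ≡-Reasoning
  v = + x ℤ.+ s ℤ.- c
  Rm = + topProduct x m
  Rμ = + topProduct x μ
  i = inv Rμ

-- Sums over the ways to add a box

allows : Maybe ℕ → ℕ → Bool
allows nothing  v = true
allows (just p) v = v <ᵇ p

-- The sum over `addBoxFrom` with the content of the new box passed along, since the weights and
-- increments are functions of that content. `allows` repeats the local test `fits` of `addBoxFrom`.
sumAdd : Maybe ℕ → ℤ → List ℕ → (List ℕ → ℤ → ℚ) → ℚ
sumAdd b s []      F = if allows b 0 then F (1 ∷ []) s else 0ℚ
sumAdd b s (x ∷ μ) F = (if allows b x then F (suc x ∷ μ) (+ x ℤ.+ s) else 0ℚ)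
                   ℚ.+ sumAdd (just x) (s ℤ.- 1ℤ) μ (λ m → F (x ∷ m))

sumℚ-++ : ∀ l l' → sumℚ (l ++ l') ≡ sumℚ l ℚ.+ sumℚ l'
sumℚ-++ []      l' = sym (ℚₚ.+-identityˡ (sumℚ l'))
sumℚ-++ (p ∷ l) l' = ≡.trans (cong (p ℚ.+_) (sumℚ-++ l l')) (sym (ℚₚ.+-assoc p (sumℚ l) (sumℚ l')))

sumℚ-addBoxFrom : ∀ b s μ (g : List ℕ → ℚ) → sumℚ (map g (addBoxFrom b μ)) ≡ sumAdd b s μ (λ m _ → g m)
sumℚ-addBoxFrom nothing        s [] g = ℚₚ.+-identityʳ (g (1 ∷ []))
sumℚ-addBoxFrom (just zero)    s [] g = refl
sumℚ-addBoxFrom (just (suc p)) s [] g = ℚₚ.+-identityʳ (g (1 ∷ []))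
sumℚ-addBoxFrom nothing  s (x ∷ μ) g = cong (g (suc x ∷ μ) ℚ.+_)
  (≡.trans (cong sumℚ (sym (Listₚ.map-∘ (addBoxFrom (just x) μ)))) (sumℚ-addBoxFrom (just x) (s ℤ.- 1ℤ) μ (g ∘ (x ∷_))))
sumℚ-addBoxFrom (just p) s (x ∷ μ) g with x <ᵇ p
... | true  = cong (g (suc x ∷ μ) ℚ.+_)
  (≡.trans (cong sumℚ (sym (Listₚ.map-∘ (addBoxFrom (just x) μ)))) (sumℚ-addBoxFrom (just x) (s ℤ.- 1ℤ) μ (g ∘ (x ∷_))))
... | false = ≡.trans
  (≡.trans (cong sumℚ (sym (Listₚ.map-∘ (addBoxFrom (just x) μ)))) (sumℚ-addBoxFrom (just x) (s ℤ.- 1ℤ) μ (g ∘ (x ∷_))))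
  (sym (ℚₚ.+-identityˡ _))

Bound : Maybe ℕ → List ℕ → Set
Bound nothing  μ = ⊤
Bound (just p) μ = HeadBound p μ

<ᵇ⇒< : ∀ {v p} → (v <ᵇ p) ≡ true → v < p
<ᵇ⇒< {zero}  {suc p} _  = s≤s z≤n
<ᵇ⇒< {suc v} {suc p} eq = s≤s (<ᵇ⇒< eq)

≮ᵇ⇒≥ : ∀ {v p} → (v <ᵇ p) ≡ false → p ≤ v
≮ᵇ⇒≥ {v}     {zero}  _  = z≤n
≮ᵇ⇒≥ {suc v} {suc p} eq = s≤s (≮ᵇ⇒≥ eq)

allows⇒Bound : ∀ b {v μ} → allows b v ≡ true → Bound b (suc v ∷ μ)
allows⇒Bound nothing  _  = tt
allows⇒Bound (just p) eq = <ᵇ⇒< eq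

if-cong : ∀ b {p r : ℚ} → (b ≡ true → p ≡ r) → (if b then p else 0ℚ) ≡ (if b then r else 0ℚ)
if-cong true  p≡r = p≡r refl
if-cong false _   = refl

Bound-∷ : ∀ b {x μ m} → Bound b (x ∷ μ) → Bound b (x ∷ m)
Bound-∷ nothing  _  = tt
Bound-∷ (just p) hb = hb

sumAdd-cong : ∀ b s μ {F G} → Par μ → Bound b μ →
  (∀ {m c} → Adds s μ m c → Par m → Bound b m → F m c ≡ G m c) → sumAdd b s μ F ≡ sumAdd b s μ G
sumAdd-cong b s []      _              bd F≡G = if-cong (allows b 0) (λ ok → F≡G new (s≤s z≤n , tt , tt) (allows⇒Bound b ok))
sumAdd-cong b s (x ∷ μ) (0<x , hb , pμ) bd F≡G = cong₂ ℚ._+_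
  (if-cong (allows b x) (λ ok → F≡G here (s≤s z≤n , HeadBound-mono μ (ℕₚ.n≤1+n x) hb , pμ) (allows⇒Bound b ok)))
  (sumAdd-cong (just x) (s ℤ.- 1ℤ) μ pμ hb (λ add pm hbm → F≡G (there add) (0<x , hbm , pm) (Bound-∷ b bd)))

sumAdd-scale : ∀ b s μ p F → sumAdd b s μ (λ m c → p *ℚ F m c) ≡ p *ℚ sumAdd b s μ F
sumAdd-scale b s []      p F with allows b 0
... | true  = refl
... | false = sym (ℚₚ.*-zeroʳ p)
sumAdd-scale b s (x ∷ μ) p F with allows b x
... | true  = ≡.trans (cong (p *ℚ F (suc x ∷ μ) (+ x ℤ.+ s) ℚ.+_) (sumAdd-scale (just x) (s ℤ.- 1ℤ) μ p _))
                (sym (ℚₚ.*-distribˡ-+ p _ _))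
... | false = ≡.trans (cong (0ℚ ℚ.+_) (sumAdd-scale (just x) (s ℤ.- 1ℤ) μ p _))
                (solve 2 (λ p f → con 0ℚ :+ p :* f := p :* (con 0ℚ :+ f)) refl p _)

-- The row of length x above μ forbids a box at content x + s only; the weight slope
-- vanishes there.
sumAdd-unbounded : ∀ x s μ F → 0 < x → HeadBound x μ → (∀ m → F m (+ x ℤ.+ s) ≡ 0ℚ) →
  sumAdd (just x) s μ F ≡ sumAdd nothing s μ F
sumAdd-unbounded (suc x) s []      F _ _   _  = refl
sumAdd-unbounded x       s (y ∷ μ) F _ y≤x F≡0 with y <ᵇ x in eq
... | true  = refl
... | false = cong (ℚ._+ sumAdd (just y) (s ℤ.- 1ℤ) μ (λ m → F (y ∷ m)))
  (sym (subst (λ y → F (suc y ∷ μ) (+ y ℤ.+ s) ≡ 0ℚ) (ℕₚ.≤-antisym (≮ᵇ⇒≥ eq) y≤x) (F≡0 (suc x ∷ μ))))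

H-∷ : ∀ x μ → Par (x ∷ μ) → + H (x ∷ μ) ≡ + topProduct x μ ℤ.* + H μ
H-∷ x μ par = ≡.trans
  (cong +_ (≡.trans (cong LA.product (hooks-∷ x μ par)) (LAₚ.product-++ (topHooks x μ) (hooks μ))))
  (ℤₚ.pos-* (topProduct x μ) (H μ))

H≢0 : ∀ μ → Par μ → + H μ ≢ 0ℤ
H≢0 []      _                 = λ ()
H≢0 (x ∷ μ) par@(_ , hb , pμ) H≡0 = case ℤₚ.i*j≡0⇒i≡0∨j≡0 (+ topProduct x μ) (≡.trans (sym (H-∷ x μ par)) H≡0) of λ where
  (inj₁ R≡0) → topProduct≢0 μ hb pμ R≡0
  (inj₂ H≡0) → H≢0 μ pμ H≡0

inv-H-∷ : ∀ x μ → Par (x ∷ μ) → inv (+ H (x ∷ μ)) ≡ inv (+ topProduct x μ) *ℚ inv (+ H μ)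
inv-H-∷ x μ par@(_ , hb , pμ) = ≡.trans (cong inv (H-∷ x μ par)) (inv-* (topProduct≢0 μ hb pμ) (H≢0 μ pμ))

Adds-< : ∀ {x s μ m c} → Adds s μ m c → HeadBound x μ → Par μ → c ℤ.< + suc x ℤ.+ s
Adds-< {x} {s} add hb pμ = All.lookup (X-< s _ hb pμ (ℤₚ.+-monoˡ-< s (ℤ.+<+ ℕₚ.≤-refl))) (Adds-∈ add)
  where
  open import Data.List.Membership.Propositional using (_∈_)
  open import Data.List.Relation.Unary.Any using (here; there)
  Adds-∈ : ∀ {s μ m c} → Adds s μ m c → c ∈ X s μ
  Adds-∈ new         = here refl
  Adds-∈ here        = here refl
  Adds-∈ (there add) = there (Adds-∈ add)

sumAdd-T : ∀ s μ → Par μ → ∀ f → sumAdd nothing s μ (λ m c → f c *ℚ inv (+ H m)) ≡ inv (+ H μ) *ℚ T s μ f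
sumAdd-T s []      _                   f = solve 1 (λ f → f :* con 1ℚ := con 1ℚ :* f) refl (f s)
sumAdd-T s (x ∷ μ) par@(0<x , hb , pμ) f = begin
  f a *ℚ inv (+ H (suc x ∷ μ)) ℚ.+ sumAdd (just x) s' μ (λ m c → f c *ℚ inv (+ H (x ∷ m)))
    ≡⟨ cong₂ (λ h t → f a *ℚ h ℚ.+ t)
         (≡.trans (inv-H-∷ (suc x) μ (s≤s z≤n , HeadBound-mono μ (ℕₚ.n≤1+n x) hb , pμ)) (cong (_*ℚ inv (+ H μ)) (inv-topProduct-suc s μ hb pμ)))
         (≡.trans (sumAdd-cong (just x) s' μ pμ hb lower) (sumAdd-scale (just x) s' μ R G)) ⟩
  f a *ℚ (E s' μ a *ℚ R *ℚ inv (+ H μ)) ℚ.+ R *ℚ sumAdd (just x) s' μ G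
    ≡⟨ cong (λ t → f a *ℚ (E s' μ a *ℚ R *ℚ inv (+ H μ)) ℚ.+ R *ℚ t)
         (≡.trans (sumAdd-unbounded x s' μ G 0<x hb G≡0) (sumAdd-T s' μ pμ (λ c → f c *ℚ slope a c))) ⟩
  f a *ℚ (E s' μ a *ℚ R *ℚ inv (+ H μ)) ℚ.+ R *ℚ (inv (+ H μ) *ℚ T s' μ (λ c → f c *ℚ slope a c))
    ≡⟨ solve 5 (λ f e r h t → f :* (e :* r :* h) :+ r :* (h :* t) := (r :* h) :* (e :* f :+ t)) refl
         (f a) (E s' μ a) R (inv (+ H μ)) (T s' μ (λ c → f c *ℚ slope a c)) ⟩
  (R *ℚ inv (+ H μ)) *ℚ T s (x ∷ μ) f
    ≡⟨ cong (_*ℚ T s (x ∷ μ) f) (sym (inv-H-∷ x μ par)) ⟩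
  inv (+ H (x ∷ μ)) *ℚ T s (x ∷ μ) f ∎
  where
  open ≡-Reasoning
  s' = s ℤ.- 1ℤ
  a = + x ℤ.+ s
  R = inv (+ topProduct x μ)
  G : List ℕ → ℤ → ℚ
  G m c = f c *ℚ slope a c *ℚ inv (+ H m)
  a≡ : ∀ x s → 1ℤ ℤ.+ x ℤ.+ (s ℤ.- 1ℤ) ≡ x ℤ.+ s
  a≡ = solve-∀
  lower : ∀ {m c} → Adds s' μ m c → Par m → HeadBound x m → f c *ℚ inv (+ H (x ∷ m)) ≡ R *ℚ G m c
  lower {m} {c} add pm hbm = ≡.trans
    (cong (f c *ℚ_) (≡.trans (inv-H-∷ x m (0<x , hbm , pm))
      (cong (_*ℚ inv (+ H m)) (inv-topProduct-Adds s add hb pμ hbm pm (subst (c ℤ.<_) (a≡ (+ x) s) (Adds-< add hb pμ))))))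
    (solve 4 (λ f r w h → f :* (r :* w :* h) := r :* (f :* w :* h)) refl (f c) R (slope a c) (inv (+ H m)))
  1≡ : ∀ x s → x ℤ.+ s ℤ.- (x ℤ.+ (s ℤ.- 1ℤ)) ≡ 1ℤ
  1≡ = solve-∀
  G≡0 : ∀ m → G m (+ x ℤ.+ s') ≡ 0ℚ
  G≡0 m = begin
    f c *ℚ slope a c *ℚ inv (+ H m)
      ≡⟨ cong (λ v → f c *ℚ ((ℤtoℚ v ℚ.- 1ℚ) *ℚ inv v) *ℚ inv (+ H m)) (1≡ (+ x) s) ⟩
    f c *ℚ 0ℚ *ℚ inv (+ H m)
      ≡⟨ solve 2 (λ f h → f :* con 0ℚ :* h := con 0ℚ) refl (f c) (inv (+ H m)) ⟩
    0ℚ ∎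
    where c = + x ℤ.+ s'

-- Newton's identities

conv : (ℕ → ℚ) → (ℕ → ℚ) → ℕ → ℚ
conv p A zero    = p 0 *ℚ A 0
conv p A (suc k) = p 0 *ℚ A (suc k) ℚ.+ conv (p ∘ suc) A k

-- coefficients of (1 - b t) A(t)
timesLinear : ℚ → (ℕ → ℚ) → ℕ → ℚ
timesLinear b A zero    = A 0
timesLinear b A (suc k) = A (suc k) ℚ.- b *ℚ A k

-- Coefficientwise, A'(t) = P(t) A(t) with P(t) = Σ p_j t^j. Thus `p j` plays the role of the power
-- sum of degree j + 1, and `A` that of the complete homogeneous sums.
Newton : (ℕ → ℚ) → (ℕ → ℚ) → Set
Newton p A = ∀ k → ℤtoℚ (+ suc k) *ℚ A (suc k) ≡ conv p A k

conv-cong : ∀ {p p' A A'} k → (∀ j → p j ≡ p' j) → (∀ j → A j ≡ A' j) → conv p A k ≡ conv p' A' k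
conv-cong zero    p≗ A≗ = cong₂ _*ℚ_ (p≗ 0) (A≗ 0)
conv-cong (suc k) p≗ A≗ = cong₂ ℚ._+_ (cong₂ _*ℚ_ (p≗ 0) (A≗ (suc k))) (conv-cong k (p≗ ∘ suc) A≗)

conv-scale : ∀ r p A k → conv (λ j → r *ℚ p j) A k ≡ r *ℚ conv p A k
conv-scale r p A zero    = ℚₚ.*-assoc r (p 0) (A 0)
conv-scale r p A (suc k) = ≡.trans (cong (r *ℚ p 0 *ℚ A (suc k) ℚ.+_) (conv-scale r (p ∘ suc) A k))
  (solve 4 (λ r p a c → r :* p :* a :+ r :* c := r :* (p :* a :+ c)) refl r (p 0) (A (suc k)) (conv (p ∘ suc) A k))

conv-- : ∀ p p' A k → conv (λ j → p j ℚ.- p' j) A k ≡ conv p A k ℚ.- conv p' A k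
conv-- p p' A zero    = solve 3 (λ p q a → (p :- q) :* a := p :* a :- q :* a) refl (p 0) (p' 0) (A 0)
conv-- p p' A (suc k) = ≡.trans (cong ((p 0 ℚ.- p' 0) *ℚ A (suc k) ℚ.+_) (conv-- (p ∘ suc) (p' ∘ suc) A k))
  (solve 5 (λ p q a c d → (p :- q) :* a :+ (c :- d) := (p :* a :+ c) :- (q :* a :+ d)) refl
    (p 0) (p' 0) (A (suc k)) (conv (p ∘ suc) A k) (conv (p' ∘ suc) A k))

conv-timesLinear : ∀ p b A k → conv p (timesLinear b A) (suc k) ≡ conv p A (suc k) ℚ.- b *ℚ conv p A k
conv-timesLinear p b A zero =
  solve 5 (λ p q b a a' → p :* (a' :- b :* a) :+ q :* a := (p :* a' :+ q :* a) :- b :* (p :* a)) refl (p 0) (p 1) b (A 0) (A 1)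
conv-timesLinear p b A (suc k) = ≡.trans
  (cong (p 0 *ℚ (A (suc (suc k)) ℚ.- b *ℚ A (suc k)) ℚ.+_) (conv-timesLinear (p ∘ suc) b A k))
  (solve 6 (λ p b a a' c c' → p :* (a' :- b :* a) :+ (c' :- b :* c) := (p :* a' :+ c') :- b :* (p :* a :+ c)) refl
    (p 0) b (A (suc k)) (A (suc (suc k))) (conv (p ∘ suc) A k) (conv (p ∘ suc) A (suc k)))

powers : ℤ → ℕ → ℚ
powers z j = pow (suc j) z

-- `powers z` is the series z / (1 - z t), so its denominator cancels the factor 1 - z t.
conv-powers : ∀ z A k → conv (powers z) (timesLinear (ℤtoℚ z) A) k ≡ ℤtoℚ z *ℚ A k
conv-powers z A zero    = cong (_*ℚ A 0) (ℚₚ.*-identityʳ (ℤtoℚ z))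
conv-powers z A (suc k) = begin
  b *ℚ 1ℚ *ℚ (A (suc k) ℚ.- b *ℚ A k) ℚ.+ conv (λ j → b *ℚ powers z j) (timesLinear b A) k
    ≡⟨ cong (b *ℚ 1ℚ *ℚ (A (suc k) ℚ.- b *ℚ A k) ℚ.+_)
         (≡.trans (conv-scale b (powers z) (timesLinear b A) k) (cong (b *ℚ_) (conv-powers z A k))) ⟩
  b *ℚ 1ℚ *ℚ (A (suc k) ℚ.- b *ℚ A k) ℚ.+ b *ℚ (b *ℚ A k)
    ≡⟨ solve 3 (λ b a a' → b :* con 1ℚ :* (a' :- b :* a) :+ b :* (b :* a) := b :* a') refl b (A k) (A (suc k)) ⟩
  b *ℚ A (suc k) ∎
  where
  open ≡-Reasoning
  b = ℤtoℚ z

ι-suc : ∀ k → ℤtoℚ (+ suc k) ≡ 1ℚ ℚ.+ ℤtoℚ (+ k)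
ι-suc k = ι-+ 1ℤ (+ k)

conv-minus-powers : ∀ p z A k → conv (λ j → p j ℚ.- powers z j) (timesLinear (ℤtoℚ z) A) k
                              ≡ conv p (timesLinear (ℤtoℚ z) A) k ℚ.- ℤtoℚ z *ℚ A k
conv-minus-powers p z A k = ≡.trans (conv-- p (powers z) (timesLinear (ℤtoℚ z) A) k)
  (cong (λ c → conv p (timesLinear (ℤtoℚ z) A) k ℚ.- c) (conv-powers z A k))

-- The factor 1 - z t changes the logarithmic derivative of `A` by -z / (1 - z t), that is by minus
-- `powers z`.
Newton-times : ∀ z {p A} → Newton p A → Newton (λ j → p j ℚ.- powers z j) (timesLinear (ℤtoℚ z) A)
Newton-times z {p} {A} newton zero = begin
  1ℚ *ℚ (A 1 ℚ.- b *ℚ A 0)             ≡⟨ solve 3 (λ b a a' → con 1ℚ :* (a' :- b :* a) := con 1ℚ :* a' :- b :* a) refl b (A 0) (A 1) ⟩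
  1ℚ *ℚ A 1 ℚ.- b *ℚ A 0               ≡⟨ cong (ℚ._- b *ℚ A 0) (newton 0) ⟩
  p 0 *ℚ A 0 ℚ.- b *ℚ A 0              ≡⟨ sym (conv-minus-powers p z A 0) ⟩
  conv (λ j → p j ℚ.- powers z j) (timesLinear b A) 0 ∎
  where
  open ≡-Reasoning
  b = ℤtoℚ z
Newton-times z {p} {A} newton (suc k) = begin
  ℤtoℚ (+ suc (suc k)) *ℚ (A (suc (suc k)) ℚ.- b *ℚ A (suc k))
    ≡⟨ solve 4 (λ n b a a' → n :* (a' :- b :* a) := n :* a' :- b :* (n :* a)) refl (ℤtoℚ (+ suc (suc k))) b (A (suc k)) (A (suc (suc k))) ⟩
  ℤtoℚ (+ suc (suc k)) *ℚ A (suc (suc k)) ℚ.- b *ℚ (ℤtoℚ (+ suc (suc k)) *ℚ A (suc k))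
    ≡⟨ cong₂ (λ c n → c ℚ.- b *ℚ (n *ℚ A (suc k))) (newton (suc k)) (ι-suc (suc k)) ⟩
  conv p A (suc k) ℚ.- b *ℚ ((1ℚ ℚ.+ ℤtoℚ (+ suc k)) *ℚ A (suc k))
    ≡⟨ solve 4 (λ c b n a → c :- b :* ((con 1ℚ :+ n) :* a) := (c :- b :* (n :* a)) :- b :* a) refl (conv p A (suc k)) b (ℤtoℚ (+ suc k)) (A (suc k)) ⟩
  (conv p A (suc k) ℚ.- b *ℚ (ℤtoℚ (+ suc k) *ℚ A (suc k))) ℚ.- b *ℚ A (suc k)
    ≡⟨ cong (λ c → (conv p A (suc k) ℚ.- b *ℚ c) ℚ.- b *ℚ A (suc k)) (newton k) ⟩
  (conv p A (suc k) ℚ.- b *ℚ conv p A k) ℚ.- b *ℚ A (suc k)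
    ≡⟨ cong (ℚ._- b *ℚ A (suc k)) (sym (conv-timesLinear p b A k)) ⟩
  conv p (timesLinear b A) (suc k) ℚ.- b *ℚ A (suc k)
    ≡⟨ sym (conv-minus-powers p z A (suc k)) ⟩
  conv (λ j → p j ℚ.- powers z j) (timesLinear b A) (suc k) ∎
  where
  open ≡-Reasoning
  b = ℤtoℚ z

-- No inverse series is needed: the identity for the product at k + 1 involves `A` at k + 1 only
-- through the identity for `A` at `k`, which is the recursive call.
Newton-divide : ∀ z {p A} → Newton (λ j → p j ℚ.- powers z j) (timesLinear (ℤtoℚ z) A) → Newton p A
Newton-divide z {p} {A} newton zero = begin
  1ℚ *ℚ A 1                            ≡⟨ solve 3 (λ b a a' → con 1ℚ :* a' := con 1ℚ :* (a' :- b :* a) :+ b :* a) refl b (A 0) (A 1) ⟩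
  1ℚ *ℚ (A 1 ℚ.- b *ℚ A 0) ℚ.+ b *ℚ A 0
    ≡⟨ cong (ℚ._+ b *ℚ A 0) (≡.trans (newton 0) (conv-minus-powers p z A 0)) ⟩
  p 0 *ℚ A 0 ℚ.- b *ℚ A 0 ℚ.+ b *ℚ A 0 ≡⟨ solve 2 (λ c d → c :- d :+ d := c) refl (p 0 *ℚ A 0) (b *ℚ A 0) ⟩
  p 0 *ℚ A 0 ∎
  where
  open ≡-Reasoning
  b = ℤtoℚ z
Newton-divide z {p} {A} newton (suc k) = begin
  n⁺ *ℚ A (suc (suc k))
    ≡⟨ solve 4 (λ n b a a' → n :* a' := n :* (a' :- b :* a) :+ b :* (n :* a)) refl n⁺ b (A (suc k)) (A (suc (suc k))) ⟩
  n⁺ *ℚ (A (suc (suc k)) ℚ.- b *ℚ A (suc k)) ℚ.+ b *ℚ (n⁺ *ℚ A (suc k))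
    ≡⟨ cong₂ (λ c n → c ℚ.+ b *ℚ (n *ℚ A (suc k))) (≡.trans (newton (suc k)) (conv-minus-powers p z A (suc k))) (ι-suc (suc k)) ⟩
  (conv p (timesLinear b A) (suc k) ℚ.- b *ℚ A (suc k)) ℚ.+ b *ℚ ((1ℚ ℚ.+ n) *ℚ A (suc k))
    ≡⟨ cong (λ c → (c ℚ.- b *ℚ A (suc k)) ℚ.+ b *ℚ ((1ℚ ℚ.+ n) *ℚ A (suc k))) (conv-timesLinear p b A k) ⟩
  (conv p A (suc k) ℚ.- b *ℚ conv p A k ℚ.- b *ℚ A (suc k)) ℚ.+ b *ℚ ((1ℚ ℚ.+ n) *ℚ A (suc k))
    ≡⟨ cong (λ c → (conv p A (suc k) ℚ.- b *ℚ c ℚ.- b *ℚ A (suc k)) ℚ.+ b *ℚ ((1ℚ ℚ.+ n) *ℚ A (suc k)))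
         (sym (Newton-divide z newton k)) ⟩
  (conv p A (suc k) ℚ.- b *ℚ (n *ℚ A (suc k)) ℚ.- b *ℚ A (suc k)) ℚ.+ b *ℚ ((1ℚ ℚ.+ n) *ℚ A (suc k))
    ≡⟨ solve 4 (λ c b n a → (c :- b :* (n :* a) :- b :* a) :+ b :* ((con 1ℚ :+ n) :* a) := c) refl (conv p A (suc k)) b n (A (suc k)) ⟩
  conv p A (suc k) ∎
  where
  open ≡-Reasoning
  b = ℤtoℚ z
  n = ℤtoℚ (+ suc k)
  n⁺ = ℤtoℚ (+ suc (suc k))

Newton-cong : ∀ {p p' A A'} → (∀ j → p j ≡ p' j) → (∀ j → A j ≡ A' j) → Newton p A → Newton p' A'
Newton-cong p≗ A≗ newton k =
  ≡.trans (cong (ℤtoℚ (+ suc k) *ℚ_) (sym (A≗ (suc k)))) (≡.trans (newton k) (conv-cong k p≗ A≗))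

-- By `T-pow-suc` a new first row multiplies the moment series by (1 - (a - 1) t) / (1 - a t), so
-- its power sums change by the powers of `a` minus those of a - 1, as in the recursion of `Q`.
-- `T-1` supplies the constant coefficients.
Newton-T : ∀ s μ → Par μ → Newton (λ j → Q s μ (pow (suc j))) (λ k → T s μ (pow k))
Newton-T s [] _ = base
  where
  open ≡-Reasoning
  b = ℤtoℚ s
  base : Newton (powers s) (λ k → pow k s)
  base zero    = solve 1 (λ b → con 1ℚ :* (b :* con 1ℚ) := b :* con 1ℚ :* con 1ℚ) refl b
  base (suc k) = begin
    ℤtoℚ (+ suc (suc k)) *ℚ (b *ℚ P)
      ≡⟨ cong (_*ℚ (b *ℚ P)) (ι-suc (suc k)) ⟩
    (1ℚ ℚ.+ ℤtoℚ (+ suc k)) *ℚ (b *ℚ P)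
      ≡⟨ solve 3 (λ n b P → (con 1ℚ :+ n) :* (b :* P) := b :* con 1ℚ :* P :+ b :* (n :* P)) refl (ℤtoℚ (+ suc k)) b P ⟩
    b *ℚ 1ℚ *ℚ P ℚ.+ b *ℚ (ℤtoℚ (+ suc k) *ℚ P)
      ≡⟨ cong (λ c → b *ℚ 1ℚ *ℚ P ℚ.+ b *ℚ c) (base k) ⟩
    b *ℚ 1ℚ *ℚ P ℚ.+ b *ℚ conv (powers s) (λ k → pow k s) k
      ≡⟨ cong (b *ℚ 1ℚ *ℚ P ℚ.+_) (sym (conv-scale b (powers s) (λ k → pow k s) k)) ⟩
    b *ℚ 1ℚ *ℚ P ℚ.+ conv (λ j → b *ℚ powers s j) (λ k → pow k s) k ∎
    where P = pow (suc k) s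
Newton-T s (x ∷ μ) par@(_ , _ , pμ) = Newton-divide a (Newton-cong p≗ A≗ (Newton-times (a ℤ.- 1ℤ) (Newton-T s' μ pμ)))
  where
  s' = s ℤ.- 1ℤ
  a = + x ℤ.+ s
  A' : ℕ → ℚ
  A' k = T s (x ∷ μ) (pow k)
  p≗ : ∀ j → Q s' μ (pow (suc j)) ℚ.- powers (a ℤ.- 1ℤ) j ≡ Q s (x ∷ μ) (pow (suc j)) ℚ.- powers a j
  p≗ j = solve 3 (λ q b a → q :- b := a :- b :+ q :- a) refl (Q s' μ (pow (suc j))) (powers (a ℤ.- 1ℤ) j) (powers a j)
  A≗ : ∀ j → timesLinear (ℤtoℚ (a ℤ.- 1ℤ)) (λ k → T s' μ (pow k)) j ≡ timesLinear (ℤtoℚ a) A' j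
  A≗ zero    = ≡.trans (T-1 s' μ pμ) (sym (T-1 s (x ∷ μ) par))
  A≗ (suc k) = begin
    t₁ ℚ.- ℤtoℚ (a ℤ.- 1ℤ) *ℚ t₀                    ≡⟨ cong (λ b → t₁ ℚ.- b *ℚ t₀) (ι-- a 1ℤ) ⟩
    t₁ ℚ.- (ℤtoℚ a ℚ.- 1ℚ) *ℚ t₀
      ≡⟨ solve 4 (λ t₁ t₀ a A → t₁ :- (a :- con 1ℚ) :* t₀ := (a :* A :+ (t₁ :- (a :- con 1ℚ) :* t₀)) :- a :* A) refl t₁ t₀ (ℤtoℚ a) (A' k) ⟩
    (ℤtoℚ a *ℚ A' k ℚ.+ (t₁ ℚ.- (ℤtoℚ a ℚ.- 1ℚ) *ℚ t₀)) ℚ.- ℤtoℚ a *ℚ A' k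
      ≡⟨ cong (ℚ._- ℤtoℚ a *ℚ A' k) (sym (T-pow-suc s x μ par k)) ⟩
    A' (suc k) ℚ.- ℤtoℚ a *ℚ A' k ∎
    where
    open ≡-Reasoning
    t₁ = T s' μ (pow (suc k))
    t₀ = T s' μ (pow k)

-- Filtered spans

sumℚ-map-scale : ∀ {A : Set} r (f : A → ℚ) l → sumℚ (map (λ x → r *ℚ f x) l) ≡ r *ℚ sumℚ (map f l)
sumℚ-map-scale r f []      = sym (ℚₚ.*-zeroʳ r)
sumℚ-map-scale r f (x ∷ l) = ≡.trans (cong (r *ℚ f x ℚ.+_) (sumℚ-map-scale r f l)) (sym (ℚₚ.*-distribˡ-+ r (f x) (sumℚ (map f l))))

-- Instantiated three times: `Qs` for functions of a partition, `Mix` for functions of a partition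
-- and the content of a new box, `Biv` for polynomials in two contents. `Valid` restricts agreement
-- to partitions, where the moment identities are available.
module Span {Point Mono : Set} (Valid : Point → Set) (ev : Mono → Point → ℚ) (deg : Mono → ℕ) where

  Combination : Set
  Combination = List (Mono × ℚ)

  ⟦_⟧ : Combination → Point → ℚ
  ⟦ L ⟧ x = sumℚ (map (λ p → proj₂ p *ℚ ev (proj₁ p) x) L)

  -- Degree at most d - e, stated so that no truncated subtraction occurs.
  record InSpan (e d : ℕ) (f : Point → ℚ) : Set where
    constructor span
    field
      combination : Combination
      degrees     : All (λ p → deg (proj₁ p) + e ≤ d) combination
      agrees      : ∀ x → Valid x → f x ≡ ⟦ combination ⟧ x

  span-cong : ∀ {e d f g} → (∀ x → Valid x → g x ≡ f x) → InSpan e d f → InSpan e d g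
  span-cong g≗f (span L degs f≡) = span L degs (λ x v → ≡.trans (g≗f x v) (f≡ x v))

  span-weaken : ∀ {e d e' d' f} → (∀ w → w + e ≤ d → w + e' ≤ d') → InSpan e d f → InSpan e' d' f
  span-weaken weaken (span L degs f≡) = span L (All.map (weaken _) degs) f≡

  span-≤ : ∀ {e d d' f} → d ≤ d' → InSpan e d f → InSpan e d' f
  span-≤ d≤d' = span-weaken (λ _ h → ℕₚ.≤-trans h d≤d')

  span-mono : ∀ {e d} m → deg m + e ≤ d → InSpan e d (ev m)
  span-mono m h = span ((m , 1ℚ) ∷ []) (h ∷ [])
    (λ x _ → solve 1 (λ e → e := con 1ℚ :* e :+ con 0ℚ) refl (ev m x))

  span-0 : ∀ {e d} → InSpan e d (λ _ → 0ℚ)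
  span-0 = span [] [] (λ _ _ → refl)

  span-+ : ∀ {e d f g} → InSpan e d f → InSpan e d g → InSpan e d (λ x → f x ℚ.+ g x)
  span-+ (span L degs f≡) (span L' degs' g≡) = span (L ++ L') (Allₚ.++⁺ degs degs') λ x v →
    ≡.trans (cong₂ ℚ._+_ (f≡ x v) (g≡ x v))
      (≡.trans (sym (sumℚ-++ (map (term x) L) (map (term x) L'))) (cong sumℚ (sym (Listₚ.map-++ (term x) L L'))))
    where
    term : Point → Mono × ℚ → ℚ
    term x p = proj₂ p *ℚ ev (proj₁ p) x

  span-scale : ∀ {e d f} r → InSpan e d f → InSpan e d (λ x → r *ℚ f x)
  span-scale {f = f} r (span L degs f≡) = span (map (λ p → proj₁ p , r *ℚ proj₂ p) L) (Allₚ.map⁺ degs) λ x v → begin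
    r *ℚ f x                                                       ≡⟨ cong (r *ℚ_) (f≡ x v) ⟩
    r *ℚ ⟦ L ⟧ x                                                   ≡⟨ sym (sumℚ-map-scale r _ L) ⟩
    sumℚ (map (λ p → r *ℚ (proj₂ p *ℚ ev (proj₁ p) x)) L)          ≡⟨ cong sumℚ (Listₚ.map-cong (λ p → sym (ℚₚ.*-assoc r (proj₂ p) (ev (proj₁ p) x))) L) ⟩
    sumℚ (map (λ p → r *ℚ proj₂ p *ℚ ev (proj₁ p) x) L)            ≡⟨ cong sumℚ (Listₚ.map-∘ L) ⟩
    ⟦ map (λ p → proj₁ p , r *ℚ proj₂ p) L ⟧ x ∎
    where open ≡-Reasoning

  span-sum : ∀ {e d} {I : Set} (f : I → Point → ℚ) l → All (λ i → InSpan e d (f i)) l → InSpan e d (λ x → sumℚ (map (λ i → f i x) l))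
  span-sum f []      []       = span-0
  span-sum f (i ∷ l) (h ∷ hs) = span-+ h (span-sum f l hs)

  module Product (_∙_ : Mono → Mono → Mono)
                 (ev-∙ : ∀ m n x → ev (m ∙ n) x ≡ ev m x *ℚ ev n x)
                 (deg-∙ : ∀ m n → deg (m ∙ n) ≡ deg m + deg n) where

    span-* : ∀ {e d e' d' f g} → InSpan e d f → InSpan e' d' g → InSpan (e + e') (d + d') (λ x → f x *ℚ g x)
    span-* {e} {d} {e'} {d'} {f} {g} (span L degs f≡) (span L' degs' g≡) = span-cong
      (λ x v → begin
        f x *ℚ g x
          ≡⟨ cong₂ _*ℚ_ (f≡ x v) (g≡ x v) ⟩
        ⟦ L ⟧ x *ℚ ⟦ L' ⟧ x
          ≡⟨ ≡.trans (ℚₚ.*-comm (⟦ L ⟧ x) (⟦ L' ⟧ x)) (sym (sumℚ-map-scale (⟦ L' ⟧ x) _ L)) ⟩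
        sumℚ (map (λ p → ⟦ L' ⟧ x *ℚ (proj₂ p *ℚ ev (proj₁ p) x)) L)
          ≡⟨ cong sumℚ (Listₚ.map-cong (λ p → ≡.trans (ℚₚ.*-comm (⟦ L' ⟧ x) _) (sym (sumℚ-map-scale (proj₂ p *ℚ ev (proj₁ p) x) _ L'))) L) ⟩
        sumℚ (map (λ p → sumℚ (map (λ p' → (proj₂ p *ℚ ev (proj₁ p) x) *ℚ (proj₂ p' *ℚ ev (proj₁ p') x)) L')) L) ∎)
      (span-sum _ L (All.map (λ {p} h → span-sum _ L' (All.map (λ {p'} h' → term p p' h h') degs')) degs))
      where
      open ≡-Reasoning
      term : ∀ p p' → deg (proj₁ p) + e ≤ d → deg (proj₁ p') + e' ≤ d' →
        InSpan (e + e') (d + d') (λ x → (proj₂ p *ℚ ev (proj₁ p) x) *ℚ (proj₂ p' *ℚ ev (proj₁ p') x))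
      term (m , r) (m' , r') h h' = span-cong
        (λ x _ → ≡.trans (solve 4 (λ r m r' m' → (r :* m) :* (r' :* m') := (r :* r') :* (m :* m')) refl r (ev m x) r' (ev m' x))
                          (cong ((r *ℚ r') *ℚ_) (sym (ev-∙ m m' x))))
        (span-scale (r *ℚ r') (span-mono (m ∙ m') (ℕₚ.≤-trans (ℕₚ.≤-reflexive
          (≡.trans (cong (_+ (e + e')) (deg-∙ m m'))
                   (+-interchange (deg m) (deg m') e e')))
          (ℕₚ.+-mono-≤ h h'))))

evQ : List ℕ → List ℕ → ℚ
evQ δ μ = prodℚ (map (λ k → Q 0ℤ μ (pow k)) δ)

evQ-++ : ∀ δ ε μ → evQ (δ ++ ε) μ ≡ evQ δ μ *ℚ evQ ε μ
evQ-++ []      ε μ = sym (ℚₚ.*-identityˡ (evQ ε μ))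
evQ-++ (k ∷ δ) ε μ = ≡.trans (cong (Q 0ℤ μ (pow k) *ℚ_) (evQ-++ δ ε μ)) (sym (ℚₚ.*-assoc (Q 0ℤ μ (pow k)) (evQ δ μ) (evQ ε μ)))

module Qs where
  open Span Par evQ LA.sum public
  open Product _++_ evQ-++ LAₚ.sum-++ public

pow-+ : ∀ i j z → pow (i + j) z ≡ pow i z *ℚ pow j z
pow-+ zero    j z = sym (ℚₚ.*-identityˡ (pow j z))
pow-+ (suc i) j z = ≡.trans (cong (ℤtoℚ z *ℚ_) (pow-+ i j z)) (sym (ℚₚ.*-assoc (ℤtoℚ z) (pow i z) (pow j z)))

-- The monomial c^j q_δ, of weight j + |δ|: the content counts with the same weight as the power
-- sums it will be averaged into.
evMix : ℕ × List ℕ → List ℕ × ℤ → ℚ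
evMix (j , δ) (μ , c) = pow j c *ℚ evQ δ μ

module Mix where
  open Span (λ _ → ⊤) evMix (λ m → proj₁ m + LA.sum (proj₂ m)) public
  open Product
    (λ m n → proj₁ m + proj₁ n , proj₂ m ++ proj₂ n)
    (λ m n x → ≡.trans
      (cong₂ _*ℚ_ (pow-+ (proj₁ m) (proj₁ n) (proj₂ x)) (evQ-++ (proj₂ m) (proj₂ n) (proj₁ x)))
      (solve 4 (λ a b c d → (a :* b) :* (c :* d) := (a :* c) :* (b :* d)) refl
        (pow (proj₁ m) (proj₂ x)) (pow (proj₁ n) (proj₂ x)) (evQ (proj₂ m) (proj₁ x)) (evQ (proj₂ n) (proj₁ x))))
    (λ m n → ≡.trans (cong (_+_ (proj₁ m + proj₁ n)) (LAₚ.sum-++ (proj₂ m) (proj₂ n)))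
      (+-interchange (proj₁ m) (proj₁ n) (LA.sum (proj₂ m)) (LA.sum (proj₂ n)))) public

-- Moments of the transition measure

conv-span : ∀ i k (p A : ℕ → List ℕ → ℚ) →
  (∀ j → Qs.InSpan 0 (i + j) (p j)) → (∀ j → j ≤ k → Qs.InSpan 0 j (A j)) →
  Qs.InSpan 0 (i + k) (λ μ → conv (λ j → p j μ) (λ j → A j μ) k)
conv-span i zero    p A hp hA = Qs.span-≤ (ℕₚ.≤-reflexive (ℕₚ.+-identityʳ (i + 0))) (Qs.span-* (hp 0) (hA 0 ℕₚ.≤-refl))
conv-span i (suc k) p A hp hA = Qs.span-+
  (Qs.span-≤ (ℕₚ.≤-reflexive (cong (_+ suc k) (ℕₚ.+-identityʳ i))) (Qs.span-* (hp 0) (hA (suc k) ℕₚ.≤-refl)))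
  (Qs.span-≤ (ℕₚ.≤-reflexive (sym (ℕₚ.+-suc i k)))
    (conv-span (suc i) k (p ∘ suc) A (λ j → Qs.span-≤ (ℕₚ.≤-reflexive (ℕₚ.+-suc i j)) (hp (suc j)))
                                     (λ j j≤k → hA j (ℕₚ.m≤n⇒m≤1+n j≤k))))

moment : ℕ → List ℕ → ℚ
moment k μ = T 0ℤ μ (pow k)

private
  -- Newton's identity, divided by j + 1, expresses a moment through all lower ones. The bound `n`
  -- makes this course-of-values induction structural.
  moment-span-≤ : ∀ n j → j ≤ n → Qs.InSpan 0 j (moment j)
  moment-span-≤ n       zero    _         = Qs.span-cong (λ μ pμ → T-1 0ℤ μ pμ) (Qs.span-mono [] z≤n)
  moment-span-≤ (suc n) (suc j) (s≤s j≤n) = Qs.span-cong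
    (λ μ pμ → *-cancel-ι {+ suc j} (λ ()) (begin
      ℤtoℚ (+ suc j) *ℚ moment (suc j) μ
        ≡⟨ Newton-T 0ℤ μ pμ j ⟩
      c μ
        ≡⟨ sym (ℚₚ.*-identityˡ (c μ)) ⟩
      1ℚ *ℚ c μ
        ≡⟨ cong (_*ℚ c μ) (sym (*-inv {+ suc j} (λ ()))) ⟩
      (ℤtoℚ (+ suc j) *ℚ inv (+ suc j)) *ℚ c μ
        ≡⟨ ℚₚ.*-assoc (ℤtoℚ (+ suc j)) (inv (+ suc j)) (c μ) ⟩
      ℤtoℚ (+ suc j) *ℚ (inv (+ suc j) *ℚ c μ) ∎))
    (Qs.span-scale (inv (+ suc j))
      (conv-span 1 j (λ i μ → Q 0ℤ μ (pow (suc i))) moment q-span (λ i i≤j → moment-span-≤ n i (ℕₚ.≤-trans i≤j j≤n))))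
    where
    open ≡-Reasoning
    c : List ℕ → ℚ
    c μ = conv (λ i → Q 0ℤ μ (pow (suc i))) (λ i → moment i μ) j
    q-span : ∀ i → Qs.InSpan 0 (1 + i) (λ μ → Q 0ℤ μ (pow (suc i)))
    q-span i = Qs.span-cong (λ μ _ → sym (ℚₚ.*-identityʳ (Q 0ℤ μ (pow (suc i)))))
      (Qs.span-mono (suc i ∷ []) (ℕₚ.≤-reflexive (≡.trans (ℕₚ.+-identityʳ (suc i + 0)) (ℕₚ.+-identityʳ (suc i)))))

moment-span : ∀ k → Qs.InSpan 0 k (moment k)
moment-span k = moment-span-≤ k k ℕₚ.≤-refl

T-cong′ : ∀ s μ {f g} → (∀ c → f c ≡ g c) → T s μ f ≡ T s μ g
T-cong′ s μ f≗g = T-cong s μ (All.universal f≗g (X s μ))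

T-0 : ∀ s μ → T s μ (λ _ → 0ℚ) ≡ 0ℚ
T-0 s μ = begin
  T s μ (λ _ → 0ℚ)
    ≡⟨ T-cong′ s μ (λ _ → refl) ⟩
  T s μ (λ _ → 0ℚ *ℚ 0ℚ ℚ.+ 0ℚ *ℚ 0ℚ)
    ≡⟨ T-linear s μ 0ℚ (λ _ → 0ℚ) 0ℚ (λ _ → 0ℚ) ⟩
  0ℚ *ℚ T s μ (λ _ → 0ℚ) ℚ.+ 0ℚ *ℚ T s μ (λ _ → 0ℚ)
    ≡⟨ solve 1 (λ t → con 0ℚ :* t :+ con 0ℚ :* t := con 0ℚ) refl (T s μ (λ _ → 0ℚ)) ⟩
  0ℚ ∎
  where open ≡-Reasoning

T-Mix : ∀ L μ → T 0ℤ μ (λ c → Mix.⟦ L ⟧ (μ , c)) ≡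
  sumℚ (map (λ p → proj₂ p *ℚ (moment (proj₁ (proj₁ p)) μ *ℚ evQ (proj₂ (proj₁ p)) μ)) L)
T-Mix []                  μ = T-0 0ℤ μ
T-Mix (((j , δ) , r) ∷ L) μ = begin
  T 0ℤ μ (λ c → r *ℚ (pow j c *ℚ evQ δ μ) ℚ.+ Mix.⟦ L ⟧ (μ , c))
    ≡⟨ T-cong′ 0ℤ μ (λ c → solve 4 (λ r p e l → r :* (p :* e) :+ l := (r :* e) :* p :+ con 1ℚ :* l) refl r (pow j c) (evQ δ μ) (Mix.⟦ L ⟧ (μ , c))) ⟩
  T 0ℤ μ (λ c → (r *ℚ evQ δ μ) *ℚ pow j c ℚ.+ 1ℚ *ℚ Mix.⟦ L ⟧ (μ , c))
    ≡⟨ T-linear 0ℤ μ (r *ℚ evQ δ μ) (pow j) 1ℚ (λ c → Mix.⟦ L ⟧ (μ , c)) ⟩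
  (r *ℚ evQ δ μ) *ℚ moment j μ ℚ.+ 1ℚ *ℚ T 0ℤ μ (λ c → Mix.⟦ L ⟧ (μ , c))
    ≡⟨ solve 4 (λ r e m t → (r :* e) :* m :+ con 1ℚ :* t := r :* (m :* e) :+ t) refl r (evQ δ μ) (moment j μ) (T 0ℤ μ (λ c → Mix.⟦ L ⟧ (μ , c))) ⟩
  r *ℚ (moment j μ *ℚ evQ δ μ) ℚ.+ T 0ℤ μ (λ c → Mix.⟦ L ⟧ (μ , c))
    ≡⟨ cong (r *ℚ (moment j μ *ℚ evQ δ μ) ℚ.+_) (T-Mix L μ) ⟩
  r *ℚ (moment j μ *ℚ evQ δ μ) ℚ.+ sumℚ (map (λ p → proj₂ p *ℚ (moment (proj₁ (proj₁ p)) μ *ℚ evQ (proj₂ (proj₁ p)) μ)) L) ∎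
  where open ≡-Reasoning

-- Averaging replaces c^j by the moment of order `j`, which has weight at most `j`, so weights do
-- not increase.
T-span : ∀ {e d f} → Mix.InSpan e d f → Qs.InSpan e d (λ μ → T 0ℤ μ (λ c → f (μ , c)))
T-span {e} {d} (Mix.span L degs f≡) = Qs.span-cong
  (λ μ _ → ≡.trans (T-cong′ 0ℤ μ (λ c → f≡ (μ , c) tt)) (T-Mix L μ))
  (Qs.span-sum _ L (All.map (λ { {(j , δ) , r} h → Qs.span-scale r
    (Qs.span-≤ (ℕₚ.≤-trans (ℕₚ.≤-reflexive (sym (ℕₚ.+-assoc j (LA.sum δ) e))) h)
      (Qs.span-* (moment-span j) (Qs.span-mono {e} δ ℕₚ.≤-refl))) }) degs))

-- The effect of adding a box

δ² : (ℤ → ℚ) → ℤ → ℚ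
δ² f c = f (1ℤ ℤ.+ c) ℚ.+ f (c ℤ.- 1ℤ) ℚ.- (f c ℚ.+ f c)

-- Lengthening a row moves its pair f(a) - f(a - 1) to f(a + 1) - f(a); a new row turns f(s) into
-- f(s + 1) - f(s) + f(s - 1). Either way the change is a second difference at the new content.
Q-Adds : ∀ {s μ m c} → Adds s μ m c → ∀ f → Q s m f ≡ Q s μ f ℚ.+ δ² f c
Q-Adds {s} new f = ≡.trans
  (cong (λ z → f (1ℤ ℤ.+ s) ℚ.- f z ℚ.+ f (s ℤ.- 1ℤ)) (pred-suc s))
  (solve 3 (λ p z m → p :- z :+ m := z :+ (p :+ m :- (z :+ z))) refl (f (1ℤ ℤ.+ s)) (f s) (f (s ℤ.- 1ℤ)))
  where
  pred-suc : ∀ s → 1ℤ ℤ.+ s ℤ.- 1ℤ ≡ s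
  pred-suc = solve-∀
Q-Adds {s} {x ∷ μ} here f = ≡.trans
  (cong₂ (λ y z → f y ℚ.- f z ℚ.+ Q (s ℤ.- 1ℤ) μ f) (ℤₚ.+-assoc 1ℤ (+ x) s) (pred-suc (+ x) s))
  (solve 4 (λ p z m q → p :- z :+ q := z :- m :+ q :+ (p :+ m :- (z :+ z))) refl
    (f (1ℤ ℤ.+ (+ x ℤ.+ s))) (f (+ x ℤ.+ s)) (f (+ x ℤ.+ s ℤ.- 1ℤ)) (Q (s ℤ.- 1ℤ) μ f))
  where
  pred-suc : ∀ x s → 1ℤ ℤ.+ x ℤ.+ s ℤ.- 1ℤ ≡ x ℤ.+ s
  pred-suc = solve-∀
Q-Adds {s} {x ∷ μ} (there {c = c} add) f = ≡.trans
  (cong (f (+ x ℤ.+ s) ℚ.- f (+ x ℤ.+ s ℤ.- 1ℤ) ℚ.+_) (Q-Adds add f))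
  (sym (ℚₚ.+-assoc (f (+ x ℤ.+ s) ℚ.- f (+ x ℤ.+ s ℤ.- 1ℤ)) (Q (s ℤ.- 1ℤ) μ f) (δ² f c)))

δ¹ : (ℤ → ℚ) → ℤ → ℚ
δ¹ f c = f (1ℤ ℤ.+ c) ℚ.- f (c ℤ.- 1ℤ)

pow-span : ∀ k → Mix.InSpan 0 k (λ x → pow k (proj₂ x))
pow-span k = Mix.span-cong (λ x _ → sym (ℚₚ.*-identityʳ (pow k (proj₂ x))))
  (Mix.span-mono (k , []) (ℕₚ.≤-reflexive (≡.trans (ℕₚ.+-identityʳ (k + 0)) (ℕₚ.+-identityʳ k))))

-- Multiplication by c mixes the two differences: δ²(c f) = c δ²f + δ¹f and δ¹(c f) = c δ¹f + δ²f +
-- 2f. Hence the two degree bounds are proved together.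
δ-pow-span : ∀ k → Mix.InSpan 2 k (λ x → δ² (pow k) (proj₂ x)) × Mix.InSpan 1 k (λ x → δ¹ (pow k) (proj₂ x))
δ-pow-span zero    = Mix.span-0 , Mix.span-0
δ-pow-span (suc k) =
    Mix.span-cong (λ x _ → δ²-suc (proj₂ x))
      (Mix.span-+ (Mix.span-* (pow-span 1) (proj₁ (δ-pow-span k)))
                  (Mix.span-weaken (λ w h → ℕₚ.≤-trans (ℕₚ.≤-reflexive (ℕₚ.+-suc w 1)) (s≤s h)) (proj₂ (δ-pow-span k))))
  , Mix.span-cong (λ x _ → δ¹-suc (proj₂ x))
      (Mix.span-+ (Mix.span-+
        (Mix.span-* (pow-span 1) (proj₂ (δ-pow-span k)))
        (Mix.span-weaken (λ w h → ℕₚ.≤-trans (ℕₚ.+-monoʳ-≤ w (s≤s z≤n)) (ℕₚ.m≤n⇒m≤1+n h)) (proj₁ (δ-pow-span k))))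
        (Mix.span-weaken (λ w h → ℕₚ.≤-trans (ℕₚ.≤-reflexive (ℕₚ.+-suc w 0)) (s≤s h)) (Mix.span-+ (pow-span k) (pow-span k))))
  where
  δ²-suc : ∀ c → δ² (pow (suc k)) c ≡ pow 1 c *ℚ δ² (pow k) c ℚ.+ δ¹ (pow k) c
  δ²-suc c = ≡.trans
    (cong₂ (λ a b → a *ℚ pow k (1ℤ ℤ.+ c) ℚ.+ b *ℚ pow k (c ℤ.- 1ℤ) ℚ.- (ℤtoℚ c *ℚ pow k c ℚ.+ ℤtoℚ c *ℚ pow k c)) (ι-+ 1ℤ c) (ι-- c 1ℤ))
    (solve 4 (λ c p m z → (con 1ℚ :+ c) :* p :+ (c :- con 1ℚ) :* m :- (c :* z :+ c :* z)
                       := c :* con 1ℚ :* (p :+ m :- (z :+ z)) :+ (p :- m)) refl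
      (ℤtoℚ c) (pow k (1ℤ ℤ.+ c)) (pow k (c ℤ.- 1ℤ)) (pow k c))
  δ¹-suc : ∀ c → δ¹ (pow (suc k)) c ≡ pow 1 c *ℚ δ¹ (pow k) c ℚ.+ δ² (pow k) c ℚ.+ (pow k c ℚ.+ pow k c)
  δ¹-suc c = ≡.trans
    (cong₂ (λ a b → a *ℚ pow k (1ℤ ℤ.+ c) ℚ.- b *ℚ pow k (c ℤ.- 1ℤ)) (ι-+ 1ℤ c) (ι-- c 1ℤ))
    (solve 4 (λ c p m z → (con 1ℚ :+ c) :* p :- (c :- con 1ℚ) :* m
                       := c :* con 1ℚ :* (p :- m) :+ (p :+ m :- (z :+ z)) :+ (z :+ z)) refl
      (ℤtoℚ c) (pow k (1ℤ ℤ.+ c)) (pow k (c ℤ.- 1ℤ)) (pow k c))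

evQ⁺ : List ℕ → List ℕ × ℤ → ℚ
evQ⁺ δ (μ , c) = prodℚ (map (λ k → Q 0ℤ μ (pow k) ℚ.+ δ² (pow k) c) δ)

evQ-Adds : ∀ {μ m c} → Adds 0ℤ μ m c → ∀ δ → evQ δ m ≡ evQ⁺ δ (μ , c)
evQ-Adds add []      = refl
evQ-Adds add (k ∷ δ) = cong₂ _*ℚ_ (Q-Adds add (pow k)) (evQ-Adds add δ)

evQ-Mix : ∀ δ → Mix.InSpan 0 (LA.sum δ) (λ x → evQ δ (proj₁ x))
evQ-Mix δ = Mix.span-cong (λ x _ → sym (ℚₚ.*-identityˡ (evQ δ (proj₁ x)))) (Mix.span-mono (0 , δ) (ℕₚ.≤-reflexive (ℕₚ.+-identityʳ (LA.sum δ))))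

-- After subtraction of `evQ`, every term of the expanded product contains at least one second
-- difference, which costs two in weight.
evQ⁺-evQ-span : ∀ δ → Mix.InSpan 2 (LA.sum δ) (λ x → evQ⁺ δ x ℚ.- evQ δ (proj₁ x))
evQ⁺-evQ-span []      = Mix.span-0
evQ⁺-evQ-span (k ∷ δ) = Mix.span-cong
  (λ x _ → solve 4 (λ q f a b → (q :+ f) :* a :- q :* b := q :* con 1ℚ :* (a :- b) :+ f :* b :+ f :* (a :- b)) refl
    (Q 0ℤ (proj₁ x) (pow k)) (δ² (pow k) (proj₂ x)) (evQ⁺ δ x) (evQ δ (proj₁ x)))
  (Mix.span-+ (Mix.span-+
    (Mix.span-* (Mix.span-≤ (ℕₚ.≤-reflexive (ℕₚ.+-identityʳ k)) (evQ-Mix (k ∷ []))) (evQ⁺-evQ-span δ))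
    (Mix.span-* (proj₁ (δ-pow-span k)) (evQ-Mix δ)))
    -- This product drops by four; only two of them are kept.
    (Mix.span-weaken (λ w h → ℕₚ.≤-trans (ℕₚ.+-monoʳ-≤ w (s≤s (s≤s z≤n))) h)
      (Mix.span-* (proj₁ (δ-pow-span k)) (evQ⁺-evQ-span δ))))

increment : Qs.Combination → List ℕ × ℤ → ℚ
increment L x = sumℚ (map (λ p → proj₂ p *ℚ (evQ⁺ (proj₁ p) x ℚ.- evQ (proj₁ p) (proj₁ x))) L)

increment-Adds : ∀ {μ m c} → Adds 0ℤ μ m c → ∀ L → Qs.⟦ L ⟧ m ≡ Qs.⟦ L ⟧ μ ℚ.+ increment L (μ , c)
increment-Adds add []            = refl
increment-Adds {μ} {m} {c} add ((δ , r) ∷ L) = begin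
  r *ℚ evQ δ m ℚ.+ Qs.⟦ L ⟧ m
    ≡⟨ cong₂ (λ a b → r *ℚ a ℚ.+ b) (evQ-Adds add δ) (increment-Adds add L) ⟩
  r *ℚ evQ⁺ δ (μ , c) ℚ.+ (Qs.⟦ L ⟧ μ ℚ.+ increment L (μ , c))
    ≡⟨ solve 5 (λ r a b l i → r :* a :+ (l :+ i) := (r :* b :+ l) :+ (r :* (a :- b) :+ i)) refl
         r (evQ⁺ δ (μ , c)) (evQ δ μ) (Qs.⟦ L ⟧ μ) (increment L (μ , c)) ⟩
  (r *ℚ evQ δ μ ℚ.+ Qs.⟦ L ⟧ μ) ℚ.+ (r *ℚ (evQ⁺ δ (μ , c) ℚ.- evQ δ μ) ℚ.+ increment L (μ , c)) ∎
  where open ≡-Reasoning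

increment-span : ∀ {e d} L → All (λ p → LA.sum (proj₁ p) + e ≤ d) L → Mix.InSpan (2 + e) d (increment L)
increment-span {e} {d} L degs = Mix.span-sum _ L (All.map (λ { {δ , r} h → Mix.span-scale r
  (Mix.span-weaken (λ w h' → ℕₚ.≤-trans (ℕₚ.≤-reflexive (sym (ℕₚ.+-assoc w 2 e))) (ℕₚ.≤-trans (ℕₚ.+-monoˡ-≤ e h') h))
    (evQ⁺-evQ-span δ)) }) degs)

-- The operator `D` on functions divided by `H`

D-cong : ∀ {f g} → (∀ μ → Par μ → f μ ≡ g μ) → ∀ μ → Par μ → D f μ ≡ D g μ
D-cong {f} {g} f≗g μ pμ = cong₂ ℚ._-_ (begin
  sumℚ (map f (addBox μ))              ≡⟨ sumℚ-addBoxFrom nothing 0ℤ μ f ⟩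
  sumAdd nothing 0ℤ μ (λ m _ → f m)    ≡⟨ sumAdd-cong nothing 0ℤ μ pμ tt (λ _ pm _ → f≗g _ pm) ⟩
  sumAdd nothing 0ℤ μ (λ m _ → g m)    ≡⟨ sym (sumℚ-addBoxFrom nothing 0ℤ μ g) ⟩
  sumℚ (map g (addBox μ)) ∎) (f≗g μ pμ)
  where open ≡-Reasoning

T-shift : ∀ s μ → Par μ → ∀ p f → T s μ (λ c → p ℚ.+ f c) ≡ p ℚ.+ T s μ f
T-shift s μ pμ p f = begin
  T s μ (λ c → p ℚ.+ f c)
    ≡⟨ T-cong′ s μ (λ c → solve 2 (λ p f → p :+ f := p :* con 1ℚ :+ con 1ℚ :* f) refl p (f c)) ⟩
  T s μ (λ c → p *ℚ 1ℚ ℚ.+ 1ℚ *ℚ f c)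
    ≡⟨ T-linear s μ p (λ _ → 1ℚ) 1ℚ f ⟩
  p *ℚ T s μ (λ _ → 1ℚ) ℚ.+ 1ℚ *ℚ T s μ f
    ≡⟨ cong (λ t → p *ℚ t ℚ.+ 1ℚ *ℚ T s μ f) (T-1 s μ pμ) ⟩
  p *ℚ 1ℚ ℚ.+ 1ℚ *ℚ T s μ f
    ≡⟨ solve 2 (λ p t → p :* con 1ℚ :+ con 1ℚ :* t := p :+ t) refl p (T s μ f) ⟩
  p ℚ.+ T s μ f ∎
  where open ≡-Reasoning

-- The weights sum to 1, so averaging reproduces `f μ` exactly and the subtraction in `D` removes
-- it. Only the averaged increment survives.
D-increment : ∀ (f : List ℕ → ℚ) (i : List ℕ → ℤ → ℚ) →
  (∀ {μ m c} → Adds 0ℤ μ m c → Par μ → Par m → f m ≡ f μ ℚ.+ i μ c) →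
  ∀ μ → Par μ → D (λ m → f m *ℚ inv (+ H m)) μ ≡ T 0ℤ μ (i μ) *ℚ inv (+ H μ)
D-increment f i f-Adds μ pμ = ≡.trans (cong (λ t → t ℚ.- f μ *ℚ h) total)
  (solve 3 (λ h f t → h :* (f :+ t) :- f :* h := t :* h) refl h (f μ) (T 0ℤ μ (i μ)))
  where
  open ≡-Reasoning
  h : ℚ
  h = inv (+ H μ)
  total : sumℚ (map (λ m → f m *ℚ inv (+ H m)) (addBox μ)) ≡ h *ℚ (f μ ℚ.+ T 0ℤ μ (i μ))
  total = begin
    sumℚ (map (λ m → f m *ℚ inv (+ H m)) (addBox μ))
      ≡⟨ sumℚ-addBoxFrom nothing 0ℤ μ (λ m → f m *ℚ inv (+ H m)) ⟩
    sumAdd nothing 0ℤ μ (λ m _ → f m *ℚ inv (+ H m))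
      ≡⟨ sumAdd-cong nothing 0ℤ μ pμ tt (λ {m} add pm _ → cong (_*ℚ inv (+ H m)) (f-Adds add pμ pm)) ⟩
    sumAdd nothing 0ℤ μ (λ m c → (f μ ℚ.+ i μ c) *ℚ inv (+ H m))
      ≡⟨ sumAdd-T 0ℤ μ pμ (λ c → f μ ℚ.+ i μ c) ⟩
    h *ℚ T 0ℤ μ (λ c → f μ ℚ.+ i μ c)
      ≡⟨ cong (h *ℚ_) (T-shift 0ℤ μ pμ (f μ) (i μ)) ⟩
    h *ℚ (f μ ℚ.+ T 0ℤ μ (i μ)) ∎

D-span : ∀ {e d f} → Qs.InSpan e d f → Σ (List ℕ → ℚ) λ g →
  Qs.InSpan (2 + e) d g × (∀ μ → Par μ → D (λ m → f m *ℚ inv (+ H m)) μ ≡ g μ *ℚ inv (+ H μ))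
D-span {f = f} (Qs.span L degs f≡) =
  (λ μ → T 0ℤ μ (λ c → increment L (μ , c))) , T-span (increment-span L degs) ,
  D-increment f (λ μ c → increment L (μ , c)) (λ {μ} {m} {c} add pμ pm → ≡.trans (f≡ m pm)
    (≡.trans (increment-Adds add L) (cong (ℚ._+ increment L (μ , c)) (sym (f≡ μ pμ)))))

D^-span : ∀ k {e d f} → Qs.InSpan e d f → Σ (List ℕ → ℚ) λ g →
  Qs.InSpan (2 * k + e) d g × (∀ μ → Par μ → D^ k (λ m → f m *ℚ inv (+ H m)) μ ≡ g μ *ℚ inv (+ H μ))
D^-span zero    {f = f} f∈ = f , f∈ , λ _ _ → refl
D^-span (suc k) {e} {d} {f} f∈ = g' , subst (λ e → Qs.InSpan e d g') (cong (_+ e) (sym (ℕₚ.*-suc 2 k))) g'∈ ,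
  λ μ pμ → ≡.trans (D-cong {D^ k (λ m → f m *ℚ inv (+ H m))} {λ m → g m *ℚ inv (+ H m)} D^≡ μ pμ) (D≡ μ pμ)
  where
  IH = D^-span k f∈
  g = proj₁ IH
  D^≡ = proj₂ (proj₂ IH)
  step = D-span {2 * k + e} {d} {g} (proj₁ (proj₂ IH))
  g' = proj₁ step
  g'∈ = proj₁ (proj₂ step)
  D≡ = proj₂ (proj₂ step)

-- Central factorials

ιℕ : ℕ → ℚ
ιℕ n = ℤtoℚ (+ n)

hookPolynomial : ℕ → ℚ → ℚ
hookPolynomial zero    z = 1ℚ
hookPolynomial (suc r) z = (z *ℚ z ℚ.- ιℕ (suc r) *ℚ ιℕ (suc r)) *ℚ hookPolynomial r z

-- z ∏ (z² - j²) over j ≤ r is the product of the 2r + 1 consecutive factors z - r, ..., z + r. For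
-- r + 1 at z + 1 the factors run from z - r to z + r + 2, so just two are new.
hookPolynomial-suc : ∀ r z → let n = ιℕ (suc r) in
  (z ℚ.+ 1ℚ) *ℚ hookPolynomial (suc r) (z ℚ.+ 1ℚ) ≡ (z ℚ.+ n) *ℚ (z ℚ.+ n ℚ.+ 1ℚ) *ℚ (z *ℚ hookPolynomial r z)
hookPolynomial-suc zero    z =
  solve 1 (λ z → (z :+ con 1ℚ) :* (((z :+ con 1ℚ) :* (z :+ con 1ℚ) :- con 1ℚ :* con 1ℚ) :* con 1ℚ)
              := (z :+ con 1ℚ) :* (z :+ con 1ℚ :+ con 1ℚ) :* (z :* con 1ℚ)) refl z
hookPolynomial-suc (suc r) z = begin
  w *ℚ ((w *ℚ w ℚ.- n' *ℚ n') *ℚ P⁺)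
    ≡⟨ solve 3 (λ w n' p → w :* ((w :* w :- n' :* n') :* p) := (w :* w :- n' :* n') :* (w :* p)) refl w n' P⁺ ⟩
  (w *ℚ w ℚ.- n' *ℚ n') *ℚ (w *ℚ P⁺)
    ≡⟨ cong₂ (λ n' p → (w *ℚ w ℚ.- n' *ℚ n') *ℚ p) (ι-suc (suc r)) (hookPolynomial-suc r z) ⟩
  (w *ℚ w ℚ.- (1ℚ ℚ.+ n) *ℚ (1ℚ ℚ.+ n)) *ℚ ((z ℚ.+ n) *ℚ (z ℚ.+ n ℚ.+ 1ℚ) *ℚ (z *ℚ p))
    ≡⟨ solve 3 (λ z n p →
         ((z :+ con 1ℚ) :* (z :+ con 1ℚ) :- (con 1ℚ :+ n) :* (con 1ℚ :+ n)) :* ((z :+ n) :* (z :+ n :+ con 1ℚ) :* (z :* p))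
         := (z :+ (con 1ℚ :+ n)) :* (z :+ (con 1ℚ :+ n) :+ con 1ℚ) :* (z :* ((z :* z :- n :* n) :* p))) refl z n p ⟩
  (z ℚ.+ (1ℚ ℚ.+ n)) *ℚ (z ℚ.+ (1ℚ ℚ.+ n) ℚ.+ 1ℚ) *ℚ (z *ℚ hookPolynomial (suc r) z)
    ≡⟨ cong (λ n' → (z ℚ.+ n') *ℚ (z ℚ.+ n' ℚ.+ 1ℚ) *ℚ (z *ℚ hookPolynomial (suc r) z)) (sym (ι-suc (suc r))) ⟩
  (z ℚ.+ n') *ℚ (z ℚ.+ n' ℚ.+ 1ℚ) *ℚ (z *ℚ hookPolynomial (suc r) z) ∎
  where
  open ≡-Reasoning
  w = z ℚ.+ 1ℚ
  n = ιℕ (suc r)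
  n' = ιℕ (suc (suc r))
  p = hookPolynomial r z
  P⁺ = hookPolynomial (suc r) w

hookPolynomial-even : ∀ r z → hookPolynomial r (ℚ.- z) ≡ hookPolynomial r z
hookPolynomial-even zero    z = refl
hookPolynomial-even (suc r) z = cong₂ _*ℚ_
  (solve 2 (λ z n → (:- z) :* (:- z) :- n :* n := z :* z :- n :* n) refl z (ιℕ (suc r))) (hookPolynomial-even r z)

hookPolynomial-pred : ∀ r z → let n = ιℕ (suc r) in
  (z ℚ.- 1ℚ) *ℚ hookPolynomial (suc r) (z ℚ.- 1ℚ) ≡ (z ℚ.- n) *ℚ (z ℚ.- n ℚ.- 1ℚ) *ℚ (z *ℚ hookPolynomial r z)
hookPolynomial-pred r z = begin
  (z ℚ.- 1ℚ) *ℚ h (suc r) (z ℚ.- 1ℚ)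
    ≡⟨ cong (λ w → (z ℚ.- 1ℚ) *ℚ h (suc r) w) (solve 1 (λ z → z :- con 1ℚ := :- (:- z :+ con 1ℚ)) refl z) ⟩
  (z ℚ.- 1ℚ) *ℚ h (suc r) (ℚ.- (ℚ.- z ℚ.+ 1ℚ))
    ≡⟨ cong ((z ℚ.- 1ℚ) *ℚ_) (hookPolynomial-even (suc r) (ℚ.- z ℚ.+ 1ℚ)) ⟩
  (z ℚ.- 1ℚ) *ℚ h (suc r) (ℚ.- z ℚ.+ 1ℚ)
    ≡⟨ solve 2 (λ z p → (z :- con 1ℚ) :* p := :- ((:- z :+ con 1ℚ) :* p)) refl z (h (suc r) (ℚ.- z ℚ.+ 1ℚ)) ⟩
  ℚ.- ((ℚ.- z ℚ.+ 1ℚ) *ℚ h (suc r) (ℚ.- z ℚ.+ 1ℚ))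
    ≡⟨ cong ℚ.-_ (≡.trans (hookPolynomial-suc r (ℚ.- z))
         (cong (λ p → (ℚ.- z ℚ.+ n) *ℚ (ℚ.- z ℚ.+ n ℚ.+ 1ℚ) *ℚ ((ℚ.- z) *ℚ p)) (hookPolynomial-even r z))) ⟩
  ℚ.- ((ℚ.- z ℚ.+ n) *ℚ (ℚ.- z ℚ.+ n ℚ.+ 1ℚ) *ℚ ((ℚ.- z) *ℚ h r z))
    ≡⟨ solve 3 (λ z n p → :- ((:- z :+ n) :* (:- z :+ n :+ con 1ℚ) :* ((:- z) :* p))
                       := (z :- n) :* (z :- n :- con 1ℚ) :* (z :* p)) refl z n (h r z) ⟩
  (z ℚ.- n) *ℚ (z ℚ.- n ℚ.- 1ℚ) *ℚ (z *ℚ h r z) ∎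
  where
  open ≡-Reasoning
  h = hookPolynomial
  n = ιℕ (suc r)

-- The value is 1 / ((2r + 4)(2r + 3)): the second central difference of z^(2r+4) has leading
-- coefficient (2r + 4)(2r + 3).
κ : ℕ → ℚ
κ r = inv (+ suc (suc (suc r + suc r))) *ℚ inv (+ suc (suc r + suc r))

κ-spec : ∀ r → let n = ιℕ (suc r) in κ r *ℚ ((1ℚ ℚ.+ (1ℚ ℚ.+ (n ℚ.+ n))) *ℚ (1ℚ ℚ.+ (n ℚ.+ n))) ≡ 1ℚ
κ-spec r = begin
  κ r *ℚ ((1ℚ ℚ.+ (1ℚ ℚ.+ (n ℚ.+ n))) *ℚ (1ℚ ℚ.+ (n ℚ.+ n)))
    ≡⟨ cong (λ m → κ r *ℚ ((1ℚ ℚ.+ m) *ℚ m)) (sym odd) ⟩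
  κ r *ℚ ((1ℚ ℚ.+ ιℕ (suc (suc r + suc r))) *ℚ ιℕ (suc (suc r + suc r)))
    ≡⟨ cong (λ m → κ r *ℚ (m *ℚ ιℕ (suc (suc r + suc r)))) (sym (ι-suc (suc (suc r + suc r)))) ⟩
  κ r *ℚ (ιℕ (suc (suc (suc r + suc r))) *ℚ ιℕ (suc (suc r + suc r)))
    ≡⟨ solve 4 (λ i j a b → (i :* j) :* (a :* b) := (a :* i) :* (b :* j)) refl
         (inv (+ suc (suc (suc r + suc r)))) (inv (+ suc (suc r + suc r))) (ιℕ (suc (suc (suc r + suc r)))) (ιℕ (suc (suc r + suc r))) ⟩
  (ιℕ (suc (suc (suc r + suc r))) *ℚ inv (+ suc (suc (suc r + suc r)))) *ℚ (ιℕ (suc (suc r + suc r)) *ℚ inv (+ suc (suc r + suc r)))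
    ≡⟨ cong₂ _*ℚ_ (*-inv {+ suc (suc (suc r + suc r))} (λ ())) (*-inv {+ suc (suc r + suc r)} (λ ())) ⟩
  1ℚ *ℚ 1ℚ
    ≡⟨ ℚₚ.*-identityˡ 1ℚ ⟩
  1ℚ ∎
  where
  open ≡-Reasoning
  n = ιℕ (suc r)
  odd : ιℕ (suc (suc r + suc r)) ≡ 1ℚ ℚ.+ (n ℚ.+ n)
  odd = ≡.trans (ι-suc (suc r + suc r)) (cong (1ℚ ℚ.+_) (ι-+ (+ suc r) (+ suc r)))

-- The even polynomial with F r 0 = 0 and second central difference hookPolynomial r;
-- the recursion holds because z² ∏_{1≤j≤r+1} (z² - j²) has second central difference
-- (2r+4)(2r+3) z² ∏_{1≤j≤r} (z² - j²).
F : ℕ → ℚ → ℚ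
F zero    z = ½ *ℚ (z *ℚ z)
F (suc r) z = κ r *ℚ (z *ℚ z *ℚ hookPolynomial (suc r) z) ℚ.- ιℕ (suc r) *ℚ ιℕ (suc r) *ℚ F r z

F-even : ∀ r z → F r (ℚ.- z) ≡ F r z
F-even zero    z = cong (½ *ℚ_) (solve 1 (λ z → (:- z) :* (:- z) := z :* z) refl z)
F-even (suc r) z = cong₂ (λ p f → κ r *ℚ p ℚ.- ιℕ (suc r) *ℚ ιℕ (suc r) *ℚ f)
  (cong₂ _*ℚ_ (solve 1 (λ z → (:- z) :* (:- z) := z :* z) refl z) (hookPolynomial-even (suc r) z)) (F-even r z)

F-0 : ∀ r → F r 0ℚ ≡ 0ℚ
F-0 zero    = refl
F-0 (suc r) = ≡.trans (cong (λ f → κ r *ℚ (0ℚ *ℚ 0ℚ *ℚ hookPolynomial (suc r) 0ℚ) ℚ.- ιℕ (suc r) *ℚ ιℕ (suc r) *ℚ f) (F-0 r))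
  (solve 3 (λ k p n → k :* (con 0ℚ :* con 0ℚ :* p) :- n :* n :* con 0ℚ := con 0ℚ) refl (κ r) (hookPolynomial (suc r) 0ℚ) (ιℕ (suc r)))

F-δ² : ∀ r z → F r (z ℚ.+ 1ℚ) ℚ.+ F r (z ℚ.- 1ℚ) ℚ.- (F r z ℚ.+ F r z) ≡ hookPolynomial r z
F-δ² zero    z = solve 1 (λ z → con ½ :* ((z :+ con 1ℚ) :* (z :+ con 1ℚ)) :+ con ½ :* ((z :- con 1ℚ) :* (z :- con 1ℚ))
  :- (con ½ :* (z :* z) :+ con ½ :* (z :* z)) := con 1ℚ) refl z
F-δ² (suc r) z = begin
  (κ r *ℚ (w *ℚ w *ℚ h (suc r) w) ℚ.- n *ℚ n *ℚ F r w) ℚ.+ (κ r *ℚ (v *ℚ v *ℚ h (suc r) v) ℚ.- n *ℚ n *ℚ F r v)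
    ℚ.- ((κ r *ℚ (z *ℚ z *ℚ ((z *ℚ z ℚ.- n *ℚ n) *ℚ p)) ℚ.- n *ℚ n *ℚ F r z) ℚ.+ (κ r *ℚ (z *ℚ z *ℚ ((z *ℚ z ℚ.- n *ℚ n) *ℚ p)) ℚ.- n *ℚ n *ℚ F r z))
    ≡⟨ solve 11 (λ k n z w v p pw pv f fw fv →
         (k :* (w :* w :* pw) :- n :* n :* fw) :+ (k :* (v :* v :* pv) :- n :* n :* fv)
           :- ((k :* (z :* z :* ((z :* z :- n :* n) :* p)) :- n :* n :* f) :+ (k :* (z :* z :* ((z :* z :- n :* n) :* p)) :- n :* n :* f))
         := k :* (w :* (w :* pw) :+ v :* (v :* pv) :- (z :* z :* ((z :* z :- n :* n) :* p) :+ z :* z :* ((z :* z :- n :* n) :* p)))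
            :- n :* n :* (fw :+ fv :- (f :+ f))) refl
         (κ r) n z w v p (h (suc r) w) (h (suc r) v) (F r z) (F r w) (F r v) ⟩
  κ r *ℚ (w *ℚ (w *ℚ h (suc r) w) ℚ.+ v *ℚ (v *ℚ h (suc r) v) ℚ.- (c ℚ.+ c)) ℚ.- n *ℚ n *ℚ (F r w ℚ.+ F r v ℚ.- (F r z ℚ.+ F r z))
    ≡⟨ cong₂ ℚ._-_ (cong₂ (λ a b → κ r *ℚ (w *ℚ a ℚ.+ v *ℚ b ℚ.- (c ℚ.+ c))) (hookPolynomial-suc r z) (hookPolynomial-pred r z))
                   (cong (n *ℚ n *ℚ_) (F-δ² r z)) ⟩
  κ r *ℚ (w *ℚ ((z ℚ.+ n) *ℚ (z ℚ.+ n ℚ.+ 1ℚ) *ℚ (z *ℚ p)) ℚ.+ v *ℚ ((z ℚ.- n) *ℚ (z ℚ.- n ℚ.- 1ℚ) *ℚ (z *ℚ p)) ℚ.- (c ℚ.+ c)) ℚ.- n *ℚ n *ℚ p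
    -- With n = r + 1 the bracket multiplied by `κ r` is (2n + 2)(2n + 1) z² p. Normalised by
    -- `κ-spec` it becomes z² p, and n² p is subtracted.
    ≡⟨ solve 4 (λ k n z p →
         k :* ((z :+ con 1ℚ) :* ((z :+ n) :* (z :+ n :+ con 1ℚ) :* (z :* p)) :+ (z :- con 1ℚ) :* ((z :- n) :* (z :- n :- con 1ℚ) :* (z :* p))
               :- (z :* z :* ((z :* z :- n :* n) :* p) :+ z :* z :* ((z :* z :- n :* n) :* p))) :- n :* n :* p
         := (z :* z :- n :* n) :* p
            :+ (z :* z :* p) :* (k :* ((con 1ℚ :+ (con 1ℚ :+ (n :+ n))) :* (con 1ℚ :+ (n :+ n))) :- con 1ℚ)) refl (κ r) n z p ⟩
  (z *ℚ z ℚ.- n *ℚ n) *ℚ p ℚ.+ (z *ℚ z *ℚ p) *ℚ (κ r *ℚ ((1ℚ ℚ.+ (1ℚ ℚ.+ (n ℚ.+ n))) *ℚ (1ℚ ℚ.+ (n ℚ.+ n))) ℚ.- 1ℚ)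
    ≡⟨ cong ((z *ℚ z ℚ.- n *ℚ n) *ℚ p ℚ.+_) (vanish (z *ℚ z *ℚ p) (κ-spec r)) ⟩
  (z *ℚ z ℚ.- n *ℚ n) *ℚ p ℚ.+ 0ℚ
    ≡⟨ ℚₚ.+-identityʳ ((z *ℚ z ℚ.- n *ℚ n) *ℚ p) ⟩
  hookPolynomial (suc r) z ∎
  where
  open ≡-Reasoning
  h = hookPolynomial
  n = ιℕ (suc r)
  w = z ℚ.+ 1ℚ
  v = z ℚ.- 1ℚ
  p = h r z
  c = z *ℚ z *ℚ ((z *ℚ z ℚ.- n *ℚ n) *ℚ p)

-- Sums over hooks

sumℚ-↭ : ∀ {A : Set} (f : A → ℚ) {l l'} → l ↭ l' → sumℚ (map f l) ≡ sumℚ (map f l')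
sumℚ-↭ f refl                = refl
sumℚ-↭ f (prep x p)          = cong (f x ℚ.+_) (sumℚ-↭ f p)
sumℚ-↭ f (swap {l} {l'} x y p) = ≡.trans
  (solve 3 (λ x y s → x :+ (y :+ s) := y :+ (x :+ s)) refl (f x) (f y) (sumℚ (map f l)))
  (cong (λ s → f y ℚ.+ (f x ℚ.+ s)) (sumℚ-↭ f p))
sumℚ-↭ f (trans p p')        = ≡.trans (sumℚ-↭ f p) (sumℚ-↭ f p')

sumℚ-map-++ : ∀ {A : Set} (f : A → ℚ) l l' → sumℚ (map f (l ++ l')) ≡ sumℚ (map f l) ℚ.+ sumℚ (map f l')
sumℚ-map-++ f l l' = ≡.trans (cong sumℚ (Listₚ.map-++ f l l')) (sumℚ-++ (map f l) (map f l'))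

Q-cong : ∀ s μ {f g} → (∀ z → f z ≡ g z) → Q s μ f ≡ Q s μ g
Q-cong s []      f≗g = f≗g s
Q-cong s (x ∷ μ) f≗g = cong₂ ℚ._+_ (cong₂ ℚ._-_ (f≗g (+ x ℤ.+ s)) (f≗g (+ x ℤ.+ s ℤ.- 1ℤ))) (Q-cong (s ℤ.- 1ℤ) μ f≗g)

Q-+ : ∀ s μ f g → Q s μ (λ z → f z ℚ.+ g z) ≡ Q s μ f ℚ.+ Q s μ g
Q-+ s []      f g = refl
Q-+ s (x ∷ μ) f g = ≡.trans (cong (f a ℚ.+ g a ℚ.- (f b ℚ.+ g b) ℚ.+_) (Q-+ (s ℤ.- 1ℤ) μ f g))
  (solve 6 (λ fa ga fb gb F G → fa :+ ga :- (fb :+ gb) :+ (F :+ G) := (fa :- fb :+ F) :+ (ga :- gb :+ G)) refl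
    (f a) (g a) (f b) (g b) (Q (s ℤ.- 1ℤ) μ f) (Q (s ℤ.- 1ℤ) μ g))
  where
  a = + x ℤ.+ s
  b = + x ℤ.+ s ℤ.- 1ℤ

Q-scale : ∀ s μ r f → Q s μ (λ z → r *ℚ f z) ≡ r *ℚ Q s μ f
Q-scale s []      r f = refl
Q-scale s (x ∷ μ) r f = ≡.trans (cong (r *ℚ f a ℚ.- r *ℚ f b ℚ.+_) (Q-scale (s ℤ.- 1ℤ) μ r f))
  (solve 4 (λ r fa fb F → r :* fa :- r :* fb :+ r :* F := r :* (fa :- fb :+ F)) refl r (f a) (f b) (Q (s ℤ.- 1ℤ) μ f))
  where
  a = + x ℤ.+ s
  b = + x ℤ.+ s ℤ.- 1ℤ

Q-- : ∀ s μ f g → Q s μ (λ z → f z ℚ.- g z) ≡ Q s μ f ℚ.- Q s μ g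
Q-- s μ f g = begin
  Q s μ (λ z → f z ℚ.- g z)
    ≡⟨ Q-cong s μ (λ z → solve 2 (λ f g → f :- g := f :+ (:- con 1ℚ) :* g) refl (f z) (g z)) ⟩
  Q s μ (λ z → f z ℚ.+ (ℚ.- 1ℚ) *ℚ g z)
    ≡⟨ Q-+ s μ f (λ z → (ℚ.- 1ℚ) *ℚ g z) ⟩
  Q s μ f ℚ.+ Q s μ (λ z → (ℚ.- 1ℚ) *ℚ g z)
    ≡⟨ cong (Q s μ f ℚ.+_) (Q-scale s μ (ℚ.- 1ℚ) g) ⟩
  Q s μ f ℚ.+ (ℚ.- 1ℚ) *ℚ Q s μ g
    ≡⟨ solve 2 (λ f g → f :+ (:- con 1ℚ) :* g := f :- g) refl (Q s μ f) (Q s μ g) ⟩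
  Q s μ f ℚ.- Q s μ g ∎
  where open ≡-Reasoning

module _ (r : ℕ) where

  private
    g : ℚ → ℚ
    g = hookPolynomial r

  -- The summand is a difference of first differences of `F r`, so the sum telescopes; the lower end
  -- is F(1) - F(0) = F(1).
  sum-range : ∀ n → sumℚ (map (g ∘ ιℕ) (range n)) ≡ F r (ιℕ n ℚ.+ 1ℚ) ℚ.- F r (ιℕ n) ℚ.- F r 1ℚ
  sum-range zero    = sym (≡.trans (cong (λ f → F r 1ℚ ℚ.- f ℚ.- F r 1ℚ) (F-0 r))
    (solve 1 (λ f → f :- con 0ℚ :- f := con 0ℚ) refl (F r 1ℚ)))
  sum-range (suc n) = begin
    sumℚ (map (g ∘ ιℕ) (range (suc n)))
      ≡⟨ ≡.trans (cong (λ l → sumℚ (map (g ∘ ιℕ) l)) (range-suc n)) (sumℚ-map-++ (g ∘ ιℕ) (range n) [ suc n ]) ⟩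
    sumℚ (map (g ∘ ιℕ) (range n)) ℚ.+ (g N ℚ.+ 0ℚ)
      ≡⟨ cong₂ (λ s p → s ℚ.+ (p ℚ.+ 0ℚ)) (sum-range n) (sym (F-δ² r N)) ⟩
    (F r (ιℕ n ℚ.+ 1ℚ) ℚ.- F r (ιℕ n) ℚ.- F r 1ℚ) ℚ.+ (F r (N ℚ.+ 1ℚ) ℚ.+ F r (N ℚ.- 1ℚ) ℚ.- (F r N ℚ.+ F r N) ℚ.+ 0ℚ)
      ≡⟨ cong₂ (λ a b → (F r a ℚ.- F r (ιℕ n) ℚ.- F r 1ℚ) ℚ.+ (F r (N ℚ.+ 1ℚ) ℚ.+ F r b ℚ.- (F r N ℚ.+ F r N) ℚ.+ 0ℚ))
           (≡.trans (ℚₚ.+-comm (ιℕ n) 1ℚ) (sym (ι-suc n)))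
           (≡.trans (cong (ℚ._- 1ℚ) (ι-suc n)) (solve 1 (λ n → con 1ℚ :+ n :- con 1ℚ := n) refl (ιℕ n))) ⟩
    (F r N ℚ.- F r (ιℕ n) ℚ.- F r 1ℚ) ℚ.+ (F r (N ℚ.+ 1ℚ) ℚ.+ F r (ιℕ n) ℚ.- (F r N ℚ.+ F r N) ℚ.+ 0ℚ)
      ≡⟨ solve 4 (λ a b c d → (a :- b :- c) :+ (d :+ b :- (a :+ a) :+ con 0ℚ) := d :- a :- c) refl
           (F r N) (F r (ιℕ n)) (F r 1ℚ) (F r (N ℚ.+ 1ℚ)) ⟩
    F r (N ℚ.+ 1ℚ) ℚ.- F r N ℚ.- F r 1ℚ ∎
    where
    open ≡-Reasoning
    N = ιℕ (suc n)

  -- With w = Z - a, the pair of a row in `Q` contributes minus the second difference of `F r` at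
  -- `w`, which cancels the summand g(w) of that row. Only the last entry of `X`, which has no
  -- partner, is left.
  Q-ΔF : ∀ s μ Z → Q s μ (λ v → F r (Z ℚ.- ℤtoℚ v) ℚ.- F r (Z ℚ.- 1ℚ ℚ.- ℤtoℚ v)) ℚ.+ sumℚ (map (λ c → g (Z ℚ.- ℤtoℚ c)) (init-X s μ))
    ≡ F r (Z ℚ.- ℤtoℚ s ℚ.+ ιℕ (length μ)) ℚ.- F r (Z ℚ.- ℤtoℚ s ℚ.+ ιℕ (length μ) ℚ.- 1ℚ)
  Q-ΔF s []      Z = ≡.trans (ℚₚ.+-identityʳ _) (cong₂ (λ a b → F r a ℚ.- F r b)
    (solve 2 (λ Z s → Z :- s := Z :- s :+ con 0ℚ) refl Z (ℤtoℚ s))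
    (solve 2 (λ Z s → Z :- con 1ℚ :- s := Z :- s :+ con 0ℚ :- con 1ℚ) refl Z (ℤtoℚ s)))
  Q-ΔF s (y ∷ μ) Z = begin
    (F r w ℚ.- F r (Z ℚ.- 1ℚ ℚ.- A) ℚ.- (F r (Z ℚ.- B) ℚ.- F r (Z ℚ.- 1ℚ ℚ.- B)) ℚ.+ q') ℚ.+ (g w ℚ.+ t)
      ≡⟨ cong₂ (λ a b → (F r w ℚ.- F r a ℚ.- b ℚ.+ q') ℚ.+ (g w ℚ.+ t))
           (solve 2 (λ Z A → Z :- con 1ℚ :- A := Z :- A :- con 1ℚ) refl Z A)
           (cong₂ (λ a b → F r a ℚ.- F r b)
             (≡.trans (cong (λ b → Z ℚ.- b) (ι-- a 1ℤ)) (solve 2 (λ Z A → Z :- (A :- con 1ℚ) := Z :- A :+ con 1ℚ) refl Z A))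
             (≡.trans (cong (λ b → Z ℚ.- 1ℚ ℚ.- b) (ι-- a 1ℤ)) (solve 2 (λ Z A → Z :- con 1ℚ :- (A :- con 1ℚ) := Z :- A) refl Z A))) ⟩
    (F r w ℚ.- F r (w ℚ.- 1ℚ) ℚ.- (F r (w ℚ.+ 1ℚ) ℚ.- F r w) ℚ.+ q') ℚ.+ (g w ℚ.+ t)
      ≡⟨ cong (λ p → (F r w ℚ.- F r (w ℚ.- 1ℚ) ℚ.- (F r (w ℚ.+ 1ℚ) ℚ.- F r w) ℚ.+ q') ℚ.+ (p ℚ.+ t)) (sym (F-δ² r w)) ⟩
    (F r w ℚ.- F r (w ℚ.- 1ℚ) ℚ.- (F r (w ℚ.+ 1ℚ) ℚ.- F r w) ℚ.+ q') ℚ.+ (F r (w ℚ.+ 1ℚ) ℚ.+ F r (w ℚ.- 1ℚ) ℚ.- (F r w ℚ.+ F r w) ℚ.+ t)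
      ≡⟨ solve 5 (λ f m p q t → (f :- m :- (p :- f) :+ q) :+ (p :+ m :- (f :+ f) :+ t) := q :+ t) refl
           (F r w) (F r (w ℚ.- 1ℚ)) (F r (w ℚ.+ 1ℚ)) q' t ⟩
    q' ℚ.+ t
      ≡⟨ Q-ΔF s' μ Z ⟩
    F r (Z ℚ.- ℤtoℚ s' ℚ.+ ιℕ (length μ)) ℚ.- F r (Z ℚ.- ℤtoℚ s' ℚ.+ ιℕ (length μ) ℚ.- 1ℚ)
      ≡⟨ cong (λ L → F r L ℚ.- F r (L ℚ.- 1ℚ)) (begin
           Z ℚ.- ℤtoℚ s' ℚ.+ ιℕ (length μ)
             ≡⟨ cong (λ b → Z ℚ.- b ℚ.+ ιℕ (length μ)) (ι-- s 1ℤ) ⟩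
           Z ℚ.- (ℤtoℚ s ℚ.- 1ℚ) ℚ.+ ιℕ (length μ)
             ≡⟨ solve 3 (λ Z s l → Z :- (s :- con 1ℚ) :+ l := Z :- s :+ (con 1ℚ :+ l)) refl Z (ℤtoℚ s) (ιℕ (length μ)) ⟩
           Z ℚ.- ℤtoℚ s ℚ.+ (1ℚ ℚ.+ ιℕ (length μ))
             ≡⟨ cong (Z ℚ.- ℤtoℚ s ℚ.+_) (sym (ι-suc (length μ))) ⟩
           Z ℚ.- ℤtoℚ s ℚ.+ ιℕ (suc (length μ)) ∎) ⟩
    F r (Z ℚ.- ℤtoℚ s ℚ.+ ιℕ (suc (length μ))) ℚ.- F r (Z ℚ.- ℤtoℚ s ℚ.+ ιℕ (suc (length μ)) ℚ.- 1ℚ) ∎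
    where
    open ≡-Reasoning
    s' = s ℤ.- 1ℤ
    a = + y ℤ.+ s
    A = ℤtoℚ a
    B = ℤtoℚ (a ℤ.- 1ℤ)
    w = Z ℚ.- A
    q' = Q s' μ (λ v → F r (Z ℚ.- ℤtoℚ v) ℚ.- F r (Z ℚ.- 1ℚ ℚ.- ℤtoℚ v))
    t = sumℚ (map (λ c → g (Z ℚ.- ℤtoℚ c)) (init-X s' μ))

  -- Hooks and gaps together sum to a first difference of `F r` at the end of the interval, and
  -- `Q-ΔF` plus the same gaps gives the same value. Subtracting the gaps leaves `Q` and the
  -- constant F(1).
  sum-topHooks : ∀ x s μ → HeadBound x μ → Par μ → let Z = ℤtoℚ (+ x ℤ.+ s) in
    sumℚ (map (g ∘ ιℕ) (topHooks x μ)) ≡ Q (s ℤ.- 1ℤ) μ (λ v → F r (Z ℚ.- ℤtoℚ v) ℚ.- F r (Z ℚ.- 1ℚ ℚ.- ℤtoℚ v)) ℚ.- F r 1ℚ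
  sum-topHooks x s μ hb pμ = begin
    h
      ≡⟨ solve 2 (λ h t → h := h :+ t :- t) refl h t ⟩
    h ℚ.+ t ℚ.- t
      ≡⟨ cong (ℚ._- t) (begin
           h ℚ.+ t                                             ≡⟨ cong (h ℚ.+_) (sym gaps≡) ⟩
           h ℚ.+ sumℚ (map (g ∘ ιℕ) (gaps x μ))                ≡⟨ sym (sumℚ-map-++ (g ∘ ιℕ) (topHooks x μ) (gaps x μ)) ⟩
           sumℚ (map (g ∘ ιℕ) (topHooks x μ ++ gaps x μ))      ≡⟨ sumℚ-↭ (g ∘ ιℕ) (topHooks-++-gaps x μ hb pμ) ⟩
           sumℚ (map (g ∘ ιℕ) (range (x + length μ)))          ≡⟨ sum-range (x + length μ) ⟩
           F r (N ℚ.+ 1ℚ) ℚ.- F r N ℚ.- F r 1ℚ                 ≡⟨ cong₂ (λ a b → F r a ℚ.- F r b ℚ.- F r 1ℚ) N+1≡ N≡ ⟩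
           F r (Z ℚ.- ℤtoℚ s' ℚ.+ ιℕ (length μ)) ℚ.- F r (Z ℚ.- ℤtoℚ s' ℚ.+ ιℕ (length μ) ℚ.- 1ℚ) ℚ.- F r 1ℚ
             ≡⟨ cong (ℚ._- F r 1ℚ) (sym (Q-ΔF s' μ Z)) ⟩
           (q' ℚ.+ t) ℚ.- F r 1ℚ ∎) ⟩
    (q' ℚ.+ t) ℚ.- F r 1ℚ ℚ.- t
      ≡⟨ solve 3 (λ q t f → (q :+ t) :- f :- t := q :- f) refl q' t (F r 1ℚ) ⟩
    q' ℚ.- F r 1ℚ ∎
    where
    open ≡-Reasoning
    s' = s ℤ.- 1ℤ
    Z = ℤtoℚ (+ x ℤ.+ s)
    N = ιℕ (x + length μ)
    h = sumℚ (map (g ∘ ιℕ) (topHooks x μ))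
    t = sumℚ (map (λ c → g (Z ℚ.- ℤtoℚ c)) (init-X s' μ))
    q' = Q s' μ (λ v → F r (Z ℚ.- ℤtoℚ v) ℚ.- F r (Z ℚ.- 1ℚ ℚ.- ℤtoℚ v))
    a≡ : ∀ x s → 1ℤ ℤ.+ x ℤ.+ (s ℤ.- 1ℤ) ≡ x ℤ.+ s
    a≡ = solve-∀
    gaps≡ : sumℚ (map (g ∘ ιℕ) (gaps x μ)) ≡ t
    gaps≡ = begin
      sumℚ (map (g ∘ ιℕ) (gaps x μ))
        ≡⟨ cong sumℚ (Listₚ.map-∘ (gaps x μ)) ⟩
      sumℚ (map (g ∘ ℤtoℚ) (map +_ (gaps x μ)))
        ≡⟨ cong (λ l → sumℚ (map (g ∘ ℤtoℚ) l)) (gaps-X s' μ hb pμ) ⟩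
      sumℚ (map (g ∘ ℤtoℚ) (map (λ c → + suc x ℤ.+ s' ℤ.- c) (init-X s' μ)))
        ≡⟨ cong sumℚ (sym (Listₚ.map-∘ (init-X s' μ))) ⟩
      sumℚ (map (λ c → g (ℤtoℚ (+ suc x ℤ.+ s' ℤ.- c))) (init-X s' μ))
        ≡⟨ cong sumℚ (Listₚ.map-cong (λ c → cong g (≡.trans (cong (λ a → ℤtoℚ (a ℤ.- c)) (a≡ (+ x) s)) (ι-- (+ x ℤ.+ s) c))) (init-X s' μ)) ⟩
      t ∎
    N+1≡ : N ℚ.+ 1ℚ ≡ Z ℚ.- ℤtoℚ s' ℚ.+ ιℕ (length μ)
    N+1≡ = begin
      N ℚ.+ 1ℚ
        ≡⟨ cong (ℚ._+ 1ℚ) (ι-+ (+ x) (+ length μ)) ⟩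
      ιℕ x ℚ.+ ιℕ (length μ) ℚ.+ 1ℚ
        ≡⟨ solve 3 (λ x l s → x :+ l :+ con 1ℚ := x :+ s :- (s :- con 1ℚ) :+ l) refl (ιℕ x) (ιℕ (length μ)) (ℤtoℚ s) ⟩
      ιℕ x ℚ.+ ℤtoℚ s ℚ.- (ℤtoℚ s ℚ.- 1ℚ) ℚ.+ ιℕ (length μ)
        ≡⟨ cong₂ (λ a b → a ℚ.- b ℚ.+ ιℕ (length μ)) (sym (ι-+ (+ x) s)) (sym (ι-- s 1ℤ)) ⟩
      Z ℚ.- ℤtoℚ s' ℚ.+ ιℕ (length μ) ∎
    N≡ : N ≡ Z ℚ.- ℤtoℚ s' ℚ.+ ιℕ (length μ) ℚ.- 1ℚ
    N≡ = ≡.trans (solve 1 (λ n → n := n :+ con 1ℚ :- con 1ℚ) refl N) (cong (ℚ._- 1ℚ) N+1≡)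

  -- Let the first row bring in `a` with sign + and b = a - 1 with sign -. In the double sum its
  -- diagonal terms are F(0) = 0, the two mixed ones give -2 F(1), and the cross terms with the
  -- lower rows occur twice because `F r` is even. Half of this is the first row's hook sum.
  sum-hooks : ∀ s μ → Par μ →
    sumℚ (map (g ∘ ιℕ) (hooks μ)) ≡ ½ *ℚ Q s μ (λ u → Q s μ (λ v → F r (ℤtoℚ u ℚ.- ℤtoℚ v)))
  sum-hooks s []      _                   = sym (≡.trans
    (cong (λ z → ½ *ℚ z) (≡.trans (cong (F r) (ℚₚ.+-inverseʳ (ℤtoℚ s))) (F-0 r))) (ℚₚ.*-zeroʳ ½))
  sum-hooks s (x ∷ μ) par@(_ , hb , pμ) = begin
    sumℚ (map (g ∘ ιℕ) (hooks (x ∷ μ)))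
      ≡⟨ ≡.trans (cong (λ l → sumℚ (map (g ∘ ιℕ) l)) (hooks-∷ x μ par)) (sumℚ-map-++ (g ∘ ιℕ) (topHooks x μ) (hooks μ)) ⟩
    sumℚ (map (g ∘ ιℕ) (topHooks x μ)) ℚ.+ sumℚ (map (g ∘ ιℕ) (hooks μ))
      ≡⟨ cong₂ ℚ._+_ (≡.trans (sum-topHooks x s μ hb pμ) (cong (ℚ._- F r 1ℚ) q'≡)) (sum-hooks s' μ pμ) ⟩
    (qA ℚ.- qB ℚ.- F r 1ℚ) ℚ.+ ½ *ℚ qq
      ≡⟨ solve 4 (λ a b f q → (a :- b :- f) :+ con ½ :* q
           := con ½ :* ((con 0ℚ :- f :+ a) :- (f :- con 0ℚ :+ b) :+ (a :- b :+ q))) refl qA qB (F r 1ℚ) qq ⟩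
    ½ *ℚ ((0ℚ ℚ.- F r 1ℚ ℚ.+ qA) ℚ.- (F r 1ℚ ℚ.- 0ℚ ℚ.+ qB) ℚ.+ (qA ℚ.- qB ℚ.+ qq))
      ≡⟨ cong (½ *ℚ_) (cong₂ ℚ._+_ (cong₂ ℚ._-_ (sym G-a) (sym G-b)) (sym Q-G)) ⟩
    ½ *ℚ (G a ℚ.- G b ℚ.+ Q s' μ G) ∎
    where
    open ≡-Reasoning
    s' = s ℤ.- 1ℤ
    a = + x ℤ.+ s
    b = a ℤ.- 1ℤ
    A = ℤtoℚ a
    B≡ : ℤtoℚ b ≡ A ℚ.- 1ℚ
    B≡ = ι-- a 1ℤ
    qA = Q s' μ (λ v → F r (A ℚ.- ℤtoℚ v))
    qB = Q s' μ (λ v → F r (ℤtoℚ b ℚ.- ℤtoℚ v))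
    qq = Q s' μ (λ u → Q s' μ (λ v → F r (ℤtoℚ u ℚ.- ℤtoℚ v)))
    G : ℤ → ℚ
    G u = Q s (x ∷ μ) (λ v → F r (ℤtoℚ u ℚ.- ℤtoℚ v))
    q'≡ : Q s' μ (λ v → F r (A ℚ.- ℤtoℚ v) ℚ.- F r (A ℚ.- 1ℚ ℚ.- ℤtoℚ v)) ≡ qA ℚ.- qB
    q'≡ = ≡.trans (Q-- s' μ _ (λ v → F r (A ℚ.- 1ℚ ℚ.- ℤtoℚ v)))
      (cong (λ t → qA ℚ.- t) (Q-cong s' μ (λ v → cong (λ b → F r (b ℚ.- ℤtoℚ v)) (sym B≡))))
    F-sym : ∀ u v → F r (u ℚ.- v) ≡ F r (v ℚ.- u)
    F-sym u v = ≡.trans (cong (F r) (solve 2 (λ u v → u :- v := :- (v :- u)) refl u v)) (F-even r (v ℚ.- u))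
    F-diag : ∀ u → F r (u ℚ.- u) ≡ 0ℚ
    F-diag u = ≡.trans (cong (F r) (ℚₚ.+-inverseʳ u)) (F-0 r)
    A-B : F r (A ℚ.- ℤtoℚ b) ≡ F r 1ℚ
    A-B = cong (F r) (≡.trans (cong (λ b → A ℚ.- b) B≡) (solve 1 (λ a → a :- (a :- con 1ℚ) := con 1ℚ) refl A))
    G-a : G a ≡ 0ℚ ℚ.- F r 1ℚ ℚ.+ qA
    G-a = cong₂ (λ d f → d ℚ.- f ℚ.+ qA) (F-diag A) A-B
    G-b : G b ≡ F r 1ℚ ℚ.- 0ℚ ℚ.+ qB
    G-b = cong₂ (λ f d → f ℚ.- d ℚ.+ qB) (≡.trans (F-sym (ℤtoℚ b) A) A-B) (F-diag (ℤtoℚ b))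
    Q-G : Q s' μ G ≡ qA ℚ.- qB ℚ.+ qq
    Q-G = ≡.trans (Q-+ s' μ (λ u → F r (ℤtoℚ u ℚ.- A) ℚ.- F r (ℤtoℚ u ℚ.- ℤtoℚ b)) (λ u → Q s' μ (λ v → F r (ℤtoℚ u ℚ.- ℤtoℚ v))))
      (cong (ℚ._+ qq) (≡.trans (Q-- s' μ (λ u → F r (ℤtoℚ u ℚ.- A)) (λ u → F r (ℤtoℚ u ℚ.- ℤtoℚ b)))
        (cong₂ ℚ._-_ (Q-cong s' μ (λ u → F-sym (ℤtoℚ u) A)) (Q-cong s' μ (λ u → F-sym (ℤtoℚ u) (ℤtoℚ b))))))

-- Hook sums as polynomials in the power sums

evBiv : ℕ × ℕ → ℤ × ℤ → ℚ
evBiv (i , j) (u , v) = pow i u *ℚ pow j v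

module Biv where
  open Span (λ _ → ⊤) evBiv (λ m → proj₁ m + proj₂ m) public
  open Product
    (λ m n → proj₁ m + proj₁ n , proj₂ m + proj₂ n)
    (λ m n x → ≡.trans
      (cong₂ _*ℚ_ (pow-+ (proj₁ m) (proj₁ n) (proj₁ x)) (pow-+ (proj₂ m) (proj₂ n) (proj₂ x)))
      (solve 4 (λ a b c d → (a :* b) :* (c :* d) := (a :* c) :* (b :* d)) refl
        (pow (proj₁ m) (proj₁ x)) (pow (proj₁ n) (proj₁ x)) (pow (proj₂ m) (proj₂ x)) (pow (proj₂ n) (proj₂ x))))
    (λ m n → +-interchange (proj₁ m) (proj₁ n) (proj₂ m) (proj₂ n)) public

difference : ℤ × ℤ → ℚ
difference (u , v) = ℤtoℚ u ℚ.- ℤtoℚ v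

difference-span : Biv.InSpan 0 1 difference
difference-span = Biv.span-cong
  (λ x _ → solve 2 (λ u v → u :- v := u :* con 1ℚ :* con 1ℚ :+ (:- con 1ℚ) :* (con 1ℚ :* (v :* con 1ℚ))) refl (ℤtoℚ (proj₁ x)) (ℤtoℚ (proj₂ x)))
  (Biv.span-+ (Biv.span-mono (1 , 0) (s≤s z≤n)) (Biv.span-scale (ℚ.- 1ℚ) (Biv.span-mono (0 , 1) (s≤s z≤n))))

square-span : Biv.InSpan 0 2 (λ x → difference x *ℚ difference x)
square-span = Biv.span-* difference-span difference-span

constant-span : ∀ {d} r → Biv.InSpan 0 d (λ _ → r)
constant-span r = Biv.span-cong (λ _ _ → solve 1 (λ r → r := r :* (con 1ℚ :* con 1ℚ)) refl r)
  (Biv.span-scale r (Biv.span-mono (0 , 0) z≤n))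

hookPolynomial-span : ∀ r → Biv.InSpan 0 (2 * r) (hookPolynomial r ∘ difference)
hookPolynomial-span zero    = constant-span 1ℚ
hookPolynomial-span (suc r) = Biv.span-≤ (ℕₚ.≤-reflexive (sym (ℕₚ.*-suc 2 r)))
  (Biv.span-* (Biv.span-+ square-span (constant-span (ℚ.- (ιℕ (suc r) *ℚ ιℕ (suc r))))) (hookPolynomial-span r))

F-span : ∀ r → Biv.InSpan 0 (2 * suc r) (F r ∘ difference)
F-span zero    = Biv.span-scale ½ square-span
F-span (suc r) = Biv.span-cong
  (λ x _ → solve 4 (λ p k n f → k :* p :- n :* n :* f := k :* p :+ (:- (n :* n)) :* f) refl
    (difference x *ℚ difference x *ℚ hookPolynomial (suc r) (difference x)) (κ r) (ιℕ (suc r)) (F r (difference x)))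
  (Biv.span-+
    (Biv.span-scale (κ r) (Biv.span-≤ (ℕₚ.≤-reflexive (sym (ℕₚ.*-suc 2 (suc r)))) (Biv.span-* square-span (hookPolynomial-span (suc r)))))
    (Biv.span-scale (ℚ.- (ιℕ (suc r) *ℚ ιℕ (suc r))) (Biv.span-≤ (ℕₚ.*-monoʳ-≤ 2 (ℕₚ.n≤1+n (suc r))) (F-span r))))

Q² : (ℤ × ℤ → ℚ) → List ℕ → ℚ
Q² f μ = Q 0ℤ μ (λ u → Q 0ℤ μ (λ v → f (u , v)))

Q²-cong : ∀ {f g} → (∀ x → f x ≡ g x) → ∀ μ → Q² f μ ≡ Q² g μ
Q²-cong f≗g μ = Q-cong 0ℤ μ (λ u → Q-cong 0ℤ μ (λ v → f≗g (u , v)))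

Q-0 : ∀ s μ → Q s μ (λ _ → 0ℚ) ≡ 0ℚ
Q-0 s μ = begin
  Q s μ (λ _ → 0ℚ)               ≡⟨ Q-scale s μ 0ℚ (λ _ → 0ℚ) ⟩
  0ℚ *ℚ Q s μ (λ _ → 0ℚ)         ≡⟨ ℚₚ.*-zeroˡ (Q s μ (λ _ → 0ℚ)) ⟩
  0ℚ ∎
  where open ≡-Reasoning

-- `Q` is linear and acts on each variable separately, so u^i v^j becomes q_i q_j and total degree
-- in (u, v) becomes weight.
Q²-Biv : ∀ L μ → Q² Biv.⟦ L ⟧ μ ≡ sumℚ (map (λ p → proj₂ p *ℚ evQ (proj₁ (proj₁ p) ∷ proj₂ (proj₁ p) ∷ []) μ) L)
Q²-Biv []                  μ = ≡.trans (Q-cong 0ℤ μ (λ _ → Q-0 0ℤ μ)) (Q-0 0ℤ μ)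
Q²-Biv (((i , j) , r) ∷ L) μ = begin
  Q 0ℤ μ (λ u → Q 0ℤ μ (λ v → r *ℚ (pow i u *ℚ pow j v) ℚ.+ Biv.⟦ L ⟧ (u , v)))
    ≡⟨ Q-cong 0ℤ μ (λ u → ≡.trans (Q-+ 0ℤ μ (λ v → r *ℚ (pow i u *ℚ pow j v)) (λ v → Biv.⟦ L ⟧ (u , v)))
         (cong (ℚ._+ Q 0ℤ μ (λ v → Biv.⟦ L ⟧ (u , v))) (inner u))) ⟩
  Q 0ℤ μ (λ u → (r *ℚ qj) *ℚ pow i u ℚ.+ Q 0ℤ μ (λ v → Biv.⟦ L ⟧ (u , v)))
    ≡⟨ Q-+ 0ℤ μ (λ u → (r *ℚ qj) *ℚ pow i u) (λ u → Q 0ℤ μ (λ v → Biv.⟦ L ⟧ (u , v))) ⟩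
  Q 0ℤ μ (λ u → (r *ℚ qj) *ℚ pow i u) ℚ.+ Q² Biv.⟦ L ⟧ μ
    ≡⟨ cong₂ ℚ._+_ (≡.trans (Q-scale 0ℤ μ (r *ℚ qj) (pow i))
         (solve 3 (λ r a b → r :* b :* a := r :* (a :* (b :* con 1ℚ))) refl r (Q 0ℤ μ (pow i)) qj)) (Q²-Biv L μ) ⟩
  r *ℚ evQ (i ∷ j ∷ []) μ ℚ.+ sumℚ (map (λ p → proj₂ p *ℚ evQ (proj₁ (proj₁ p) ∷ proj₂ (proj₁ p) ∷ []) μ) L) ∎
  where
  open ≡-Reasoning
  qj = Q 0ℤ μ (pow j)
  inner : ∀ u → Q 0ℤ μ (λ v → r *ℚ (pow i u *ℚ pow j v)) ≡ (r *ℚ qj) *ℚ pow i u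
  inner u = begin
    Q 0ℤ μ (λ v → r *ℚ (pow i u *ℚ pow j v))   ≡⟨ Q-scale 0ℤ μ r (λ v → pow i u *ℚ pow j v) ⟩
    r *ℚ Q 0ℤ μ (λ v → pow i u *ℚ pow j v)     ≡⟨ cong (r *ℚ_) (Q-scale 0ℤ μ (pow i u) (pow j)) ⟩
    r *ℚ (pow i u *ℚ qj)                       ≡⟨ solve 3 (λ r p q → r :* (p :* q) := r :* q :* p) refl r (pow i u) qj ⟩
    (r *ℚ qj) *ℚ pow i u ∎

Q²-span : ∀ {d f} → Biv.InSpan 0 d f → Qs.InSpan 0 d (Q² f)
Q²-span (Biv.span L degs f≡) = Qs.span-cong
  (λ μ _ → ≡.trans (Q²-cong (λ x → f≡ x tt) μ) (Q²-Biv L μ))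
  (Qs.span-sum _ L (All.map (λ { {(i , j) , r} h → Qs.span-scale r (Qs.span-mono (i ∷ j ∷ [])
    (ℕₚ.≤-trans (ℕₚ.≤-reflexive (cong (_+ 0) (cong (_+_ i) (ℕₚ.+-identityʳ j)))) h)) }) degs))

ι-sum : ∀ {A : Set} (f : A → ℤ) l → ℤtoℚ (sumℤ (map f l)) ≡ sumℚ (map (ℤtoℚ ∘ f) l)
ι-sum f []      = refl
ι-sum f (x ∷ l) = ≡.trans (ι-+ (f x) (sumℤ (map f l))) (cong (ℤtoℚ (f x) ℚ.+_) (ι-sum f l))

ι-prod : ∀ {A : Set} (f : A → ℤ) l → ℤtoℚ (prodℤ (map f l)) ≡ prodℚ (map (ℤtoℚ ∘ f) l)
ι-prod f []      = refl
ι-prod f (x ∷ l) = ≡.trans (ι-* (f x) (prodℤ (map f l))) (cong (ℤtoℚ (f x) *ℚ_) (ι-prod f l))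

prodℤ-++ : ∀ l l' → prodℤ (l ++ l') ≡ prodℤ l ℤ.* prodℤ l'
prodℤ-++ []      l' = sym (ℤₚ.*-identityˡ (prodℤ l'))
prodℤ-++ (x ∷ l) l' = ≡.trans (cong (x ℤ.*_) (prodℤ-++ l l')) (sym (ℤₚ.*-assoc x (prodℤ l) (prodℤ l')))

hookPolynomial-ℕ : ∀ r h → ℤtoℚ (prodℤ (map (λ j → (+ (h * h)) ℤ.- (+ (suc j * suc j))) (upTo r))) ≡ hookPolynomial r (ιℕ h)
hookPolynomial-ℕ zero    h = refl
hookPolynomial-ℕ (suc r) h = begin
  ℤtoℚ (prodℤ (map f (upTo (suc r))))
    ≡⟨ cong (λ l → ℤtoℚ (prodℤ l)) (≡.trans (cong (map f) (sym (Listₚ.upTo-∷ʳ r))) (Listₚ.map-++ f (upTo r) [ r ])) ⟩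
  ℤtoℚ (prodℤ (map f (upTo r) ++ [ f r ]))
    ≡⟨ cong ℤtoℚ (prodℤ-++ (map f (upTo r)) [ f r ]) ⟩
  ℤtoℚ (prodℤ (map f (upTo r)) ℤ.* (f r ℤ.* 1ℤ))
    ≡⟨ ι-* (prodℤ (map f (upTo r))) (f r ℤ.* 1ℤ) ⟩
  ℤtoℚ (prodℤ (map f (upTo r))) *ℚ ℤtoℚ (f r ℤ.* 1ℤ)
    ≡⟨ cong₂ _*ℚ_ (hookPolynomial-ℕ r h) (≡.trans (cong ℤtoℚ (ℤₚ.*-identityʳ (f r))) (ι-- (+ (h * h)) (+ (suc r * suc r)))) ⟩
  hookPolynomial r (ιℕ h) *ℚ (ιℕ (h * h) ℚ.- ιℕ (suc r * suc r))
    ≡⟨ cong₂ (λ a b → hookPolynomial r (ιℕ h) *ℚ (a ℚ.- b)) (ι-square h) (ι-square (suc r)) ⟩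
  hookPolynomial r (ιℕ h) *ℚ (ιℕ h *ℚ ιℕ h ℚ.- ιℕ (suc r) *ℚ ιℕ (suc r))
    ≡⟨ ℚₚ.*-comm (hookPolynomial r (ιℕ h)) (ιℕ h *ℚ ιℕ h ℚ.- ιℕ (suc r) *ℚ ιℕ (suc r)) ⟩
  hookPolynomial (suc r) (ιℕ h) ∎
  where
  open ≡-Reasoning
  f : ℕ → ℤ
  f j = (+ (h * h)) ℤ.- (+ (suc j * suc j))
  ι-square : ∀ n → ιℕ (n * n) ≡ ιℕ n *ℚ ιℕ n
  ι-square n = ≡.trans (cong ℤtoℚ (ℤₚ.pos-* n n)) (ι-* (+ n) (+ n))

S-span : ∀ r → Qs.InSpan 0 (2 * suc r) (λ μ → ℤtoℚ (S μ r))
S-span r = Qs.span-cong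
  (λ μ pμ → ≡.trans (ι-sum (λ h → prodℤ (map (λ j → (+ (h * h)) ℤ.- (+ (suc j * suc j))) (upTo r))) (hooks μ))
    (≡.trans (cong sumℚ (Listₚ.map-cong (hookPolynomial-ℕ r) (hooks μ))) (sum-hooks r 0ℤ μ pμ)))
  (Qs.span-scale ½ (Q²-span (F-span r)))

Sν-span : ∀ ν → Qs.InSpan 0 (2 * size ν + 2 * length ν) (λ μ → ℤtoℚ (Sν ν μ))
Sν-span []      = Qs.span-mono [] z≤n
Sν-span (r ∷ ν) = Qs.span-cong (λ μ _ → ι-* (S μ r) (Sν ν μ))
  (Qs.span-≤ (ℕₚ.≤-reflexive (degree r (size ν) (length ν))) (Qs.span-* (S-span r) (Sν-span ν)))
  where
  degree : ∀ r n l → 2 * suc r + (2 * n + 2 * l) ≡ 2 * (r + n) + 2 * suc l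
  degree = ℕ-solve-∀

-- Corner coordinates

corners : ℕ → List ℕ → List (ℕ × ℕ)
corners i []          = []
corners i (x ∷ [])    = (i , x) ∷ []
corners i (x ∷ y ∷ μ) = (if y <ᵇ x then ((i , x) ∷ []) else []) ++ corners (suc i) (y ∷ μ)

-- The local function of removableTop cannot be named here: `_` is solved to it by the
-- use in removableTop≡corners, once all its arguments have been generalised to variables.
go≡corners : ∀ la i μ → _ ≡ corners i μ
removableTop≡corners : ∀ la → removableTop la ≡ corners 1 la
removableTop≡corners []       = refl
removableTop≡corners (x ∷ []) = refl
removableTop≡corners (x ∷ y ∷ μ) with y ∷ μ
... | μ' with x ∷ μ' | 2
... | la | i = cong ((if y <ᵇ x then ((1 , x) ∷ []) else []) ++_) (go≡corners la i μ')

go≡corners la i []          = refl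
go≡corners la i (x ∷ [])    = refl
go≡corners la i (x ∷ y ∷ μ) = cong ((if y <ᵇ x then ((i , x) ∷ []) else []) ++_) (go≡corners la (suc i) (y ∷ μ))

-- Σ f(x_i) read off from the corners listed from top to bottom, p being the row of
-- the corner above (the paper lists them from bottom to top).
cornerSum : (ℤ → ℚ) → ℕ → List (ℕ × ℕ) → ℚ
cornerSum f p []            = f ((+ 0) ℤ.- (+ p))
cornerSum f p ((α , β) ∷ L) = f ((+ β) ℤ.- (+ p)) ℚ.+ cornerSum f α L

-- The formula for `xs` with its two boundary zeros made arguments: they must vary when a corner is
-- split off either end of the reversed list.
outer : ℕ → List (ℕ × ℕ) → ℕ → List ℤ
outer β₀ R e = zipWith (λ b a → (+ b) ℤ.- (+ a)) (β₀ ∷ map proj₂ R) (map proj₁ R ++ (e ∷ []))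

outer-++ : ∀ β₀ R α β e → outer β₀ (R ++ [ (α , β) ]) e ≡ outer β₀ R α ++ [ (+ β) ℤ.- (+ e) ]
outer-++ β₀ []            α β e = refl
outer-++ β₀ ((a , b) ∷ R) α β e = cong (((+ β₀) ℤ.- (+ a)) ∷_) (outer-++ b R α β e)

sum-outer : ∀ f p L → sumℚ (map f (outer 0 (reverse L) p)) ≡ cornerSum f p L
sum-outer f p []            = ℚₚ.+-identityʳ (f ((+ 0) ℤ.- (+ p)))
sum-outer f p ((α , β) ∷ L) = begin
  sumℚ (map f (outer 0 (reverse ((α , β) ∷ L)) p))
    ≡⟨ cong (λ R → sumℚ (map f (outer 0 R p))) (Listₚ.unfold-reverse (α , β) L) ⟩
  sumℚ (map f (outer 0 (reverse L ++ [ (α , β) ]) p))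
    ≡⟨ cong (λ l → sumℚ (map f l)) (outer-++ 0 (reverse L) α β p) ⟩
  sumℚ (map f (outer 0 (reverse L) α ++ [ (+ β) ℤ.- (+ p) ]))
    ≡⟨ sumℚ-map-++ f (outer 0 (reverse L) α) [ (+ β) ℤ.- (+ p) ] ⟩
  sumℚ (map f (outer 0 (reverse L) α)) ℚ.+ (f ((+ β) ℤ.- (+ p)) ℚ.+ 0ℚ)
    ≡⟨ cong (ℚ._+ (f ((+ β) ℤ.- (+ p)) ℚ.+ 0ℚ)) (sum-outer f α L) ⟩
  cornerSum f α L ℚ.+ (f ((+ β) ℤ.- (+ p)) ℚ.+ 0ℚ)
    ≡⟨ solve 2 (λ c d → c :+ (d :+ con 0ℚ) := d :+ c) refl (cornerSum f α L) (f ((+ β) ℤ.- (+ p))) ⟩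
  cornerSum f p ((α , β) ∷ L) ∎
  where open ≡-Reasoning

inner : ℕ × ℕ → ℤ
inner p = (+ proj₂ p) ℤ.- (+ proj₁ p)

-- Row `i` has length `x`, and `p` is the row of the last corner above it, so x - p is the pending
-- coordinate x_i of the block of equal rows containing row `i`.
corners-Q : ∀ f i p x μ → Par (x ∷ μ) →
  cornerSum f p (corners i (x ∷ μ)) ℚ.- sumℚ (map (f ∘ inner) (corners i (x ∷ μ)))
    ≡ f ((+ x) ℤ.- (+ p)) ℚ.- f ((+ x) ℤ.- (+ i)) ℚ.+ Q (ℤ.- (+ i)) μ f
corners-Q f i p x []      _ = ≡.trans
  (cong (λ z → f ((+ x) ℤ.- (+ p)) ℚ.+ f z ℚ.- (f ((+ x) ℤ.- (+ i)) ℚ.+ 0ℚ)) (ℤₚ.+-identityˡ (ℤ.- (+ i))))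
  (solve 3 (λ a b c → a :+ b :- (c :+ con 0ℚ) := a :- c :+ b) refl (f ((+ x) ℤ.- (+ p))) (f (ℤ.- (+ i))) (f ((+ x) ℤ.- (+ i))))
corners-Q f i p x (y ∷ μ) (_ , y≤x , pμ) with y <ᵇ x in eq
... | true  = begin
  (fp ℚ.+ c) ℚ.- (fi ℚ.+ t)                    ≡⟨ solve 4 (λ p c i t → (p :+ c) :- (i :+ t) := p :- i :+ (c :- t)) refl fp c fi t ⟩
  fp ℚ.- fi ℚ.+ (c ℚ.- t)                      ≡⟨ cong (fp ℚ.- fi ℚ.+_) (corners-Q f (suc i) i y μ pμ) ⟩
  fp ℚ.- fi ℚ.+ (f ((+ y) ℤ.- (+ i)) ℚ.- f ((+ y) ℤ.- (+ suc i)) ℚ.+ Q (ℤ.- (+ suc i)) μ f)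
    ≡⟨ cong (fp ℚ.- fi ℚ.+_) (cong₂ (λ a s → f ((+ y) ℤ.- (+ i)) ℚ.- f a ℚ.+ Q s μ f) (sub-suc (+ y) (+ i)) (neg-suc (+ i))) ⟩
  fp ℚ.- fi ℚ.+ Q (ℤ.- (+ i)) (y ∷ μ) f ∎
  where
  open ≡-Reasoning
  fp = f ((+ x) ℤ.- (+ p))
  fi = f ((+ x) ℤ.- (+ i))
  c = cornerSum f i (corners (suc i) (y ∷ μ))
  t = sumℚ (map (f ∘ inner) (corners (suc i) (y ∷ μ)))
  sub-suc : ∀ y i → y ℤ.- (1ℤ ℤ.+ i) ≡ y ℤ.+ ℤ.- i ℤ.- 1ℤ
  sub-suc = solve-∀
  neg-suc : ∀ i → ℤ.- (1ℤ ℤ.+ i) ≡ ℤ.- i ℤ.- 1ℤ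
  neg-suc = solve-∀
-- Row `i` is no corner and `p` stays pending. On the right, the terms at x - i, minus from row `i`
-- and plus from the next row, cancel.
... | false with ℕₚ.≤-antisym (≮ᵇ⇒≥ eq) y≤x
... | refl = begin
  cornerSum f p (corners (suc i) (x ∷ μ)) ℚ.- sumℚ (map (f ∘ inner) (corners (suc i) (x ∷ μ)))
    ≡⟨ corners-Q f (suc i) p x μ pμ ⟩
  fp ℚ.- f ((+ x) ℤ.- (+ suc i)) ℚ.+ Q (ℤ.- (+ suc i)) μ f
    ≡⟨ cong₂ (λ a s → fp ℚ.- f a ℚ.+ Q s μ f) (sub-suc (+ x) (+ i)) (neg-suc (+ i)) ⟩
  fp ℚ.- f ((+ x) ℤ.- (+ i) ℤ.- 1ℤ) ℚ.+ Q (ℤ.- (+ i) ℤ.- 1ℤ) μ f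
    ≡⟨ solve 4 (λ p i s q → p :- s :+ q := p :- i :+ (i :- s :+ q)) refl fp fi (f ((+ x) ℤ.- (+ i) ℤ.- 1ℤ)) (Q (ℤ.- (+ i) ℤ.- 1ℤ) μ f) ⟩
  fp ℚ.- fi ℚ.+ Q (ℤ.- (+ i)) (x ∷ μ) f ∎
  where
  open ≡-Reasoning
  fp = f ((+ x) ℤ.- (+ p))
  fi = f ((+ x) ℤ.- (+ i))
  sub-suc : ∀ y i → y ℤ.- (1ℤ ℤ.+ i) ≡ y ℤ.- i ℤ.- 1ℤ
  sub-suc = solve-∀
  neg-suc : ∀ i → ℤ.- (1ℤ ℤ.+ i) ≡ ℤ.- i ℤ.- 1ℤ
  neg-suc = solve-∀

removable-Q : ∀ f la → Par la → sumℚ (map f (xs la)) ℚ.- sumℚ (map f (ys la)) ≡ Q 0ℤ la f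
removable-Q f []      _   = solve 1 (λ a → a :+ con 0ℚ :- con 0ℚ := a) refl (f 0ℤ)
removable-Q f (x ∷ μ) par = begin
  sumℚ (map f (outer 0 (reverse (removableTop (x ∷ μ))) 0)) ℚ.- sumℚ (map f (map inner (reverse (removableTop (x ∷ μ)))))
    ≡⟨ cong (λ L → sumℚ (map f (outer 0 (reverse L) 0)) ℚ.- sumℚ (map f (map inner (reverse L)))) (removableTop≡corners (x ∷ μ)) ⟩
  sumℚ (map f (outer 0 (reverse L) 0)) ℚ.- sumℚ (map f (map inner (reverse L)))
    ≡⟨ cong₂ ℚ._-_ (sum-outer f 0 L) (≡.trans (cong sumℚ (sym (Listₚ.map-∘ (reverse L)))) (sumℚ-↭ (f ∘ inner) (↭ₚ.↭-reverse L))) ⟩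
  cornerSum f 0 L ℚ.- sumℚ (map (f ∘ inner) L)
    ≡⟨ corners-Q f 1 0 x μ par ⟩
  f ((+ x) ℤ.- (+ 0)) ℚ.- f ((+ x) ℤ.- (+ 1)) ℚ.+ Q (ℤ.- (+ 1)) μ f
    ≡⟨ cong (λ z → f (+ x ℤ.+ 0ℤ) ℚ.- f (z ℤ.- 1ℤ) ℚ.+ Q (ℤ.- (+ 1)) μ f) (sym (ℤₚ.+-identityʳ (+ x))) ⟩
  Q 0ℤ (x ∷ μ) f ∎
  where
  open ≡-Reasoning
  L = corners 1 (x ∷ μ)

ι-q : ∀ k la → Par la → ℤtoℚ (q k la) ≡ Q 0ℤ la (pow k)
ι-q k la pla = begin
  ℤtoℚ (q k la)
    ≡⟨ ι-- (sumℤ (map (ℤ._^ k) (xs la))) (sumℤ (map (ℤ._^ k) (ys la))) ⟩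
  ℤtoℚ (sumℤ (map (ℤ._^ k) (xs la))) ℚ.- ℤtoℚ (sumℤ (map (ℤ._^ k) (ys la)))
    ≡⟨ cong₂ ℚ._-_ (powerSum (xs la)) (powerSum (ys la)) ⟩
  sumℚ (map (pow k) (xs la)) ℚ.- sumℚ (map (pow k) (ys la))
    ≡⟨ removable-Q (pow k) la pla ⟩
  Q 0ℤ la (pow k) ∎
  where
  open ≡-Reasoning
  powerSum : ∀ l → ℤtoℚ (sumℤ (map (ℤ._^ k) l)) ≡ sumℚ (map (pow k) l)
  powerSum l = ≡.trans (ι-sum (ℤ._^ k) l) (cong sumℚ (Listₚ.map-cong (λ z → ι-^ z k) l))

ι-qδ : ∀ δ la → Par la → ℤtoℚ (qδ δ la) ≡ evQ δ la
ι-qδ δ la pla = ≡.trans (ι-prod (λ k → q k la) δ) (cong prodℚ (Listₚ.map-cong (λ k → ι-q k la pla) δ))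

-- Sorting the index of a monomial into a partition

Par⇒IsPartition : ∀ δ → Par δ → IsPartition δ
Par⇒IsPartition []          _                = [] , []
Par⇒IsPartition (x ∷ [])    (0<x , _)        = 0<x ∷ [] , [-]
Par⇒IsPartition (x ∷ y ∷ δ) (0<x , y≤x , pδ) =
  0<x ∷ proj₁ (Par⇒IsPartition (y ∷ δ) pδ) , y≤x ∷ proj₂ (Par⇒IsPartition (y ∷ δ) pδ)

insert : ℕ → List ℕ → List ℕ
insert k []      = k ∷ []
insert k (y ∷ δ) = if k <ᵇ y then y ∷ insert k δ else k ∷ y ∷ δ

insert-HeadBound : ∀ {x} k δ → k ≤ x → HeadBound x δ → HeadBound x (insert k δ)
insert-HeadBound k []      k≤x _  = k≤x
insert-HeadBound k (y ∷ δ) k≤x y≤x with k <ᵇ y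
... | true  = y≤x
... | false = k≤x

insert-Par : ∀ k δ → 0 < k → Par δ → Par (insert k δ)
insert-Par k []      0<k _                = 0<k , tt , tt
insert-Par k (y ∷ δ) 0<k (0<y , hb , pδ) with k <ᵇ y in eq
... | true  = 0<y , insert-HeadBound k δ (ℕₚ.<⇒≤ (<ᵇ⇒< eq)) hb , insert-Par k δ 0<k pδ
... | false = 0<k , ≮ᵇ⇒≥ eq , 0<y , hb , pδ

insert-↭ : ∀ k δ → insert k δ ↭ k ∷ δ
insert-↭ k []      = ↭-refl
insert-↭ k (y ∷ δ) with k <ᵇ y
... | true  = trans (prep y (insert-↭ k δ)) (swap y k ↭-refl)
... | false = ↭-refl

evQ-↭ : ∀ {δ ε} μ → δ ↭ ε → evQ δ μ ≡ evQ ε μ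
evQ-↭ μ refl         = refl
evQ-↭ μ (prep k p)   = cong (Q 0ℤ μ (pow k) *ℚ_) (evQ-↭ μ p)
evQ-↭ μ (swap {δ} {ε} j k p) = ≡.trans
  (solve 3 (λ a b c → a :* (b :* c) := b :* (a :* c)) refl (Q 0ℤ μ (pow j)) (Q 0ℤ μ (pow k)) (evQ δ μ))
  (cong (λ e → Q 0ℤ μ (pow k) *ℚ (Q 0ℤ μ (pow j) *ℚ e)) (evQ-↭ μ p))
evQ-↭ μ (trans p p') = ≡.trans (evQ-↭ μ p) (evQ-↭ μ p')

-- There is one more x_i than y_j, so q_0 = 1. Zero indices, which arise from constant factors of
-- the bivariate monomials, can therefore be dropped when δ is made a partition.
Q-1 : ∀ s μ → Q s μ (pow 0) ≡ 1ℚ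
Q-1 s []      = refl
Q-1 s (x ∷ μ) = ≡.trans (cong (1ℚ ℚ.- 1ℚ ℚ.+_) (Q-1 (s ℤ.- 1ℤ) μ)) refl

toPartition : List ℕ → List ℕ
toPartition []          = []
toPartition (zero ∷ δ)  = toPartition δ
toPartition (suc k ∷ δ) = insert (suc k) (toPartition δ)

toPartition-Par : ∀ δ → Par (toPartition δ)
toPartition-Par []          = tt
toPartition-Par (zero ∷ δ)  = toPartition-Par δ
toPartition-Par (suc k ∷ δ) = insert-Par (suc k) (toPartition δ) (s≤s z≤n) (toPartition-Par δ)

toPartition-size : ∀ δ → size (toPartition δ) ≡ size δ
toPartition-size []          = refl
toPartition-size (zero ∷ δ)  = toPartition-size δ
toPartition-size (suc k ∷ δ) = ≡.trans (LAₚ.sum-↭ (insert-↭ (suc k) (toPartition δ))) (cong (_+_ (suc k)) (toPartition-size δ))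

evQ-toPartition : ∀ δ μ → evQ (toPartition δ) μ ≡ evQ δ μ
evQ-toPartition []          μ = refl
evQ-toPartition (zero ∷ δ)  μ = ≡.trans (evQ-toPartition δ μ)
  (≡.trans (sym (ℚₚ.*-identityˡ (evQ δ μ))) (cong (_*ℚ evQ δ μ) (sym (Q-1 0ℤ μ))))
evQ-toPartition (suc k ∷ δ) μ = ≡.trans (evQ-↭ μ (insert-↭ (suc k) (toPartition δ)))
  (cong (Q 0ℤ μ (pow (suc k)) *ℚ_) (evQ-toPartition δ μ))

-- The expansion and the degree bound

D^-cong : ∀ {f g} → (∀ μ → Par μ → f μ ≡ g μ) → ∀ k μ → Par μ → D^ k f μ ≡ D^ k g μ
D^-cong         f≗g zero    = f≗g
D^-cong {f} {g} f≗g (suc k) = D-cong {D^ k f} {D^ k g} (D^-cong f≗g k)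

qExpansion : (nu : List ℕ) (k : ℕ) → Σ (List (List ℕ × ℚ)) λ L →
  All (λ p → IsPartition (proj₁ p) × size (proj₁ p) + 2 * k ≤ 2 * size nu + 2 * length nu) L
  × ((la : List ℕ) → IsPartition la →
      D^ k (λ mu → ℤtoℚ (Sν nu mu) ÷ℕ H mu) la
        ≡ sumℚ (map (λ p → proj₂ p *ℚ (ℤtoℚ (qδ (proj₁ p) la) ÷ℕ H la)) L))
qExpansion nu k = map sorted L , Allₚ.map⁺ (All.map (λ {p} → degree p) (Qs.InSpan.degrees g∈)) , expansion
  where
  open ≡-Reasoning
  f : List ℕ → ℚ
  f μ = ℤtoℚ (Sν nu μ)
  iterated = D^-span k (Sν-span nu)
  g : List ℕ → ℚ
  g = proj₁ iterated
  g∈ = proj₁ (proj₂ iterated)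
  L = Qs.InSpan.combination g∈
  sorted : List ℕ × ℚ → List ℕ × ℚ
  sorted p = toPartition (proj₁ p) , proj₂ p
  degree : ∀ p → LA.sum (proj₁ p) + (2 * k + 0) ≤ 2 * size nu + 2 * length nu →
    IsPartition (toPartition (proj₁ p)) × size (toPartition (proj₁ p)) + 2 * k ≤ 2 * size nu + 2 * length nu
  degree (δ , _) h = Par⇒IsPartition (toPartition δ) (toPartition-Par δ) ,
    ℕₚ.≤-trans (ℕₚ.≤-reflexive (cong₂ _+_ (toPartition-size δ) (sym (ℕₚ.+-identityʳ (2 * k))))) h
  module _ (la : List ℕ) (par : IsPartition la) where
    pla : Par la
    pla = IsPartition⇒Par par
    h : ℚ
    h = inv (+ H la)
    term : ∀ p → h *ℚ (proj₂ p *ℚ evQ (proj₁ p) la) ≡ proj₂ p *ℚ (ℤtoℚ (qδ (toPartition (proj₁ p)) la) ÷ℕ H la)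
    term (δ , r) = begin
      h *ℚ (r *ℚ evQ δ la)
        ≡⟨ solve 3 (λ h r e → h :* (r :* e) := r :* (e :* h)) refl h r (evQ δ la) ⟩
      r *ℚ (evQ δ la *ℚ h)
        ≡⟨ cong (λ e → r *ℚ (e *ℚ h)) (≡.trans (sym (evQ-toPartition δ la)) (sym (ι-qδ (toPartition δ) la pla))) ⟩
      r *ℚ (ℤtoℚ (qδ (toPartition δ) la) *ℚ h)
        ≡⟨ cong (r *ℚ_) (sym (÷ℕ-inv (ℤtoℚ (qδ (toPartition δ) la)) (H la))) ⟩
      r *ℚ (ℤtoℚ (qδ (toPartition δ) la) ÷ℕ H la) ∎
    expansion : D^ k (λ mu → ℤtoℚ (Sν nu mu) ÷ℕ H mu) la
      ≡ sumℚ (map (λ p → proj₂ p *ℚ (ℤtoℚ (qδ (proj₁ p) la) ÷ℕ H la)) (map sorted L))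
    expansion = begin
      D^ k (λ mu → ℤtoℚ (Sν nu mu) ÷ℕ H mu) la
        ≡⟨ D^-cong (λ μ _ → ÷ℕ-inv (f μ) (H μ)) k la pla ⟩
      D^ k (λ μ → f μ *ℚ inv (+ H μ)) la
        ≡⟨ proj₂ (proj₂ iterated) la pla ⟩
      g la *ℚ h
        ≡⟨ ≡.trans (cong (_*ℚ h) (Qs.InSpan.agrees g∈ la pla)) (ℚₚ.*-comm (Qs.⟦ L ⟧ la) h) ⟩
      h *ℚ Qs.⟦ L ⟧ la
        ≡⟨ sym (sumℚ-map-scale h (λ p → proj₂ p *ℚ evQ (proj₁ p) la) L) ⟩
      sumℚ (map (λ p → h *ℚ (proj₂ p *ℚ evQ (proj₁ p) la)) L)
        ≡⟨ cong sumℚ (≡.trans (Listₚ.map-cong term L) (Listₚ.map-∘ L)) ⟩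
      sumℚ (map (λ p → proj₂ p *ℚ (ℤtoℚ (qδ (proj₁ p) la) ÷ℕ H la)) (map sorted L)) ∎

degree-bound : ∀ m a b → ¬ (m + 2 * suc (a + b) ≤ 2 * a + 2 * b)
degree-bound m a b h = ℕₚ.m+1+n≰m (2 * a + 2 * b) {m + 1} (ℕₚ.≤-trans (ℕₚ.≤-reflexive (regroup m a b)) h)
  where
  regroup : ∀ m a b → 2 * a + 2 * b + suc (m + 1) ≡ m + 2 * suc (a + b)
  regroup = ℕ-solve-∀

theorem7p3 : (nu : List ℕ) → IsPartition nu →
    IsDPoly (λ la → ℤtoℚ (Sν nu la)) (size nu + length nu)
    × ((k : ℕ) → Σ (List (List ℕ × ℚ)) λ L →
    All (λ p → IsPartition (proj₁ p) × size (proj₁ p) + 2 * k ≤ 2 * size nu + 2 * length nu) L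
    × ((la : List ℕ) → IsPartition la →
    D^ k (λ mu → ℤtoℚ (Sν nu mu) ÷ℕ H mu) la
    ≡ sumℚ (map (λ p → proj₂ p *ℚ (ℤtoℚ (qδ (proj₁ p) la) ÷ℕ H la)) L)))
theorem7p3 nu _ = isDPoly (qExpansion nu (suc (size nu + length nu))) , qExpansion nu
  where
  isDPoly : Σ (List (List ℕ × ℚ)) (λ L →
    All (λ p → IsPartition (proj₁ p) × size (proj₁ p) + 2 * suc (size nu + length nu) ≤ 2 * size nu + 2 * length nu) L
    × ((la : List ℕ) → IsPartition la →
        D^ (suc (size nu + length nu)) (λ mu → ℤtoℚ (Sν nu mu) ÷ℕ H mu) la
          ≡ sumℚ (map (λ p → proj₂ p *ℚ (ℤtoℚ (qδ (proj₁ p) la) ÷ℕ H la)) L))) →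
    IsDPoly (λ la → ℤtoℚ (Sν nu la)) (size nu + length nu)
  -- For k = |ν| + ℓ + 1 any index δ would satisfy |δ| + 2k ≤ 2k - 2. So the list is empty, and the
  -- expansion reads `D^ k` = 0.
  isDPoly ([]          , _               , expansion) = expansion
  isDPoly ((p ∷ _)     , ((_ , deg) ∷ _) , _)         = ⊥-elim (degree-bound (size (proj₁ p)) (size nu) (length nu) deg)
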